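{- Let $(G,\mathcal{B},\mathcal{L},\mathcal{F})$ be a quasi-biased graph in which each connected component of $G$ has at least two vertices, and suppose $M=M(G,\mathcal{B},\mathcal{L},\mathcal{F})$ is $3$-connected, unbreakable, and not graphic. Assume $G$ is $2$-connected but not $3$-connected. Then either $|V(G)|\le 6$, or $\mathrm{si}(G)$ is a cycle and $\mathcal{F}$ is degenerate.
   Context: Graphs are finite with loops and parallel edges allowed; cycles include loops and 2-cycles. A quasi-biased graph $(G,\mathcal{B},\mathcal{L},\mathcal{F})$ is a graph with a partition $(\mathcal{B},\mathcal{L},\mathcal{F})$ of its cycles such that no theta subgraph contains exactly two cycles of $\mathcal{B}$ and every cycle in $\mathcal{L}$ shares a vertex with every cycle in $\mathcal{F}$. $M(G,\mathcal{B},\mathcal{L},\mathcal{F})$ is the matroid on $E(G)$ with circuits: cycles in $\mathcal{B}$; theta subgraphs with no cycle in $\mathcal{B}$; tight handcuffs (two edge-disjoint cycles sharing exactly one vertex) with neither cycle in $\mathcal{B}$; unions of two vertex-disjoint cycles of $\mathcal{L}$; loose handcuffs (two vertex-disjoint cycles plus a minimal path joining them) with both cycles in $\mathcal{F}$. $\mathcal{F}$ is degenerate if no two cycles in $\mathcal{F}$ are vertex-disjoint. A matroid is unbreakable if it is connected and $M/F$ is connected for every flat $F$. $\mathrm{si}(G)$ is the simplification. -}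

module Defs where

open import Data.Nat using (ℕ; zero; suc; _+_; _≤_; _<_)
open import Data.Fin using (Fin; zero; suc; _≟_)
open import Data.Fin.Subset using (Subset; _∈_; _∉_; _⊆_; _∪_; _─_; _-_; ∣_∣; Nonempty; ⊤; ⁅_⁆)
open import Data.Bool using (Bool; true; false; if_then_else_)
open import Data.Vec using (lookup)
open import Data.Product using (Σ; ∃; ∃-syntax; _×_; _,_)
open import Data.Sum using (_⊎_)
open import Relation.Nullary using (¬_; does)
open import Relation.Binary.PropositionalEquality using (_≡_; _≢_)
open import Function.Bundles using (_⇔_)

sumFin : (m : ℕ) → (Fin m → ℕ) → ℕ
sumFin zero    f = 0
sumFin (suc m) f = f zero + sumFin m (λ i → f (suc i))

-- Graphs: vertex set Fin n, edge set Fin m; edge e has ends src e, tgt e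
-- (unordered; loops when src e ≡ tgt e; parallel edges allowed).

record Graph (n m : ℕ) : Set where
  field
    src : Fin m → Fin n
    tgt : Fin m → Fin n
open Graph public

module _ {n m : ℕ} (G : Graph n m) where

  Inc : Fin m → Fin n → Set
  Inc e v = src G e ≡ v ⊎ tgt G e ≡ v

  InV : Subset m → Fin n → Set
  InV X v = ∃[ e ] (e ∈ X × Inc e v)

  -- degree of v in the subgraph X (a loop counts twice)
  deg : Subset m → Fin n → ℕ
  deg X v = sumFin m (λ e →
    if lookup X e
      then ((if does (src G e ≟ v) then 1 else 0) + (if does (tgt G e ≟ v) then 1 else 0))
      else 0)

  EdgeConnected : Subset m → Set
  EdgeConnected X = ∀ A → A ⊆ X → Nonempty A → Nonempty (X ─ A) →
    ∃[ v ] (InV A v × InV (X ─ A) v)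

  -- cycles: nonempty connected 2-regular subgraphs (loops and 2-cycles included)
  IsCycle : Subset m → Set
  IsCycle C = Nonempty C × EdgeConnected C × (∀ v → InV C v → deg C v ≡ 2)

  -- theta subgraphs: connected, bridgeless, exactly two vertices of degree 3,
  -- all other vertices of degree 2 (= three internally disjoint paths
  -- between two distinct vertices)
  IsTheta : Subset m → Set
  IsTheta T = EdgeConnected T
    × (∀ e → e ∈ T → EdgeConnected (T - e))
    × ∃[ u ] ∃[ w ] (u ≢ w × deg T u ≡ 3 × deg T w ≡ 3
        × (∀ v → InV T v → v ≢ u → v ≢ w → deg T v ≡ 2))

  IsPath : Subset m → Fin n → Fin n → Set
  IsPath P u v = u ≢ v × EdgeConnected P × deg P u ≡ 1 × deg P v ≡ 1
    × (∀ w → InV P w → w ≢ u → w ≢ v → deg P w ≡ 2)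

  VertexDisjoint : Subset m → Subset m → Set
  VertexDisjoint X Y = ∀ v → ¬ (InV X v × InV Y v)

  EdgeDisjoint : Subset m → Subset m → Set
  EdgeDisjoint X Y = ∀ e → ¬ (e ∈ X × e ∈ Y)

  TightHandcuff : Subset m → Subset m → Set
  TightHandcuff C₁ C₂ = IsCycle C₁ × IsCycle C₂ × EdgeDisjoint C₁ C₂
    × ∃[ v ] (InV C₁ v × InV C₂ v × (∀ w → InV C₁ w → InV C₂ w → w ≡ v))

  LooseHandcuff : Subset m → Subset m → Subset m → Set
  LooseHandcuff C₁ C₂ P = IsCycle C₁ × IsCycle C₂ × VertexDisjoint C₁ C₂
    × ∃[ u ] ∃[ v ] (IsPath P u v × InV C₁ u × InV C₂ v
        × (∀ w → InV P w → InV C₁ w → w ≡ u)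
        × (∀ w → InV P w → InV C₂ w → w ≡ v))

  SameComponent : Fin n → Fin n → Set
  SameComponent v w = ∀ (A : Subset n) → v ∈ A →
    (∀ e → src G e ∈ A → tgt G e ∈ A) → (∀ e → tgt G e ∈ A → src G e ∈ A) → w ∈ A

  ConnectedOn : Subset n → Set
  ConnectedOn S = Nonempty S × (∀ A → A ⊆ S → Nonempty A → Nonempty (S ─ A) →
    ∃[ e ] ((src G e ∈ A × tgt G e ∈ (S ─ A)) ⊎ (tgt G e ∈ A × src G e ∈ (S ─ A))))

  -- k-connected (Diestel): more than k vertices, and G - X connected
  -- whenever |X| < k
  KConnected : ℕ → Set
  KConnected k = k < n × (∀ (X : Subset n) → ∣ X ∣ < k → ConnectedOn (⊤ ─ X))

  IsLoop : Fin m → Set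
  IsLoop e = src G e ≡ tgt G e

  Parallel : Fin m → Fin m → Set
  Parallel e f = (src G e ≡ src G f × tgt G e ≡ tgt G f) ⊎ (src G e ≡ tgt G f × tgt G e ≡ src G f)

  -- S is the edge set of a simplification si(G): delete all loops and keep
  -- exactly one edge from each parallel class (all vertices are kept)
  SimplificationEdges : Subset m → Set
  SimplificationEdges S = (∀ e → e ∈ S → ¬ IsLoop e)
    × (∀ e → ¬ IsLoop e → ∃[ f ] (f ∈ S × Parallel e f))
    × (∀ e f → e ∈ S → f ∈ S → Parallel e f → e ≡ f)

  SiIsCycle : Set
  SiIsCycle = ∃[ S ] (SimplificationEdges S × IsCycle S × (∀ v → InV S v))

-- Quasi-biased graphs: the partition (B, L, F) of the cycles is given by a
-- labelling of edge sets; only the labels of cycles matter.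

data Label : Set where
  bal lin fre : Label

module _ {n m : ℕ} (G : Graph n m) (lab : Subset m → Label) where

  QuasiBiased : Set
  QuasiBiased =
    -- no theta subgraph contains exactly two cycles of 𝓑 (a theta contains
    -- exactly three cycles)
      (∀ T → IsTheta G T → ¬ (∃[ C₁ ] ∃[ C₂ ] ∃[ C₃ ]
          (IsCycle G C₁ × IsCycle G C₂ × IsCycle G C₃
           × C₁ ⊆ T × C₂ ⊆ T × C₃ ⊆ T
           × C₁ ≢ C₂ × C₁ ≢ C₃ × C₂ ≢ C₃
           × lab C₁ ≡ bal × lab C₂ ≡ bal × ¬ (lab C₃ ≡ bal))))
    × (∀ C₁ C₂ → IsCycle G C₁ → IsCycle G C₂ → lab C₁ ≡ lin → lab C₂ ≡ fre →
         ∃[ v ] (InV G C₁ v × InV G C₂ v))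

  data MCircuit : Subset m → Set where
    balCycle : ∀ C → IsCycle G C → lab C ≡ bal → MCircuit C
    theta : ∀ T → IsTheta G T →
      (∀ C → IsCycle G C → C ⊆ T → ¬ (lab C ≡ bal)) → MCircuit T
    tight : ∀ C₁ C₂ → TightHandcuff G C₁ C₂ →
      ¬ (lab C₁ ≡ bal) → ¬ (lab C₂ ≡ bal) → MCircuit (C₁ ∪ C₂)
    linPair : ∀ C₁ C₂ → IsCycle G C₁ → IsCycle G C₂ → VertexDisjoint G C₁ C₂ →
      lab C₁ ≡ lin → lab C₂ ≡ lin → MCircuit (C₁ ∪ C₂)
    loose : ∀ C₁ C₂ P → LooseHandcuff G C₁ C₂ P →
      lab C₁ ≡ fre → lab C₂ ≡ fre → MCircuit (C₁ ∪ C₂ ∪ P)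

  Degenerate : Set
  Degenerate = ∀ C₁ C₂ → IsCycle G C₁ → IsCycle G C₂ →
    lab C₁ ≡ fre → lab C₂ ≡ fre → ¬ VertexDisjoint G C₁ C₂

-- Matroids given by ground set S ⊆ Fin m and circuit predicate Circ.

module _ {m : ℕ} (S : Subset m) (Circ : Subset m → Set) where

  Indep : Subset m → Set
  Indep I = I ⊆ S × (∀ C → Circ C → ¬ (C ⊆ I))

  Rank : Subset m → ℕ → Set
  Rank X k = (∃[ I ] (I ⊆ X × Indep I × ∣ I ∣ ≡ k))
    × (∀ I → I ⊆ X → Indep I → ∣ I ∣ ≤ k)

  Separation : ℕ → Subset m → Set
  Separation l X = X ⊆ S × l ≤ ∣ X ∣ × l ≤ ∣ S ─ X ∣
    × ∃[ a ] ∃[ b ] ∃[ c ] (Rank X a × Rank (S ─ X) b × Rank S c × a + b < c + l)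

  Connected : Set
  Connected = ∀ X → ¬ Separation 1 X

  ThreeConnected : Set
  ThreeConnected = ∀ X → ¬ Separation 1 X × ¬ Separation 2 X

  Flat : Subset m → Set
  Flat F = F ⊆ S × (∀ e → e ∈ S → e ∉ F → ∀ a b → Rank F a → Rank (F ∪ ⁅ e ⁆) b → a < b)

  ContractCirc : Subset m → Subset m → Set
  ContractCirc F C = Nonempty C × (∃[ D ] (Circ D × C ≡ D ─ F))
    × (∀ C' → Nonempty C' → (∃[ D ] (Circ D × C' ≡ D ─ F)) → C' ⊆ C → C' ≡ C)

Unbreakable : {m : ℕ} → Subset m → (Subset m → Set) → Set
Unbreakable S Circ = Connected S Circ
  × (∀ F → Flat S Circ F → Connected (S ─ F) (ContractCirc S Circ F))

Graphic : {m : ℕ} → (Subset m → Set) → Set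
Graphic {m} Circ = ∃[ n' ] ∃[ H ] (∀ X → Circ X ⇔ IsCycle {n'} {m} H X)

{-# OPTIONS --safe #-}

-- Call a vertex set good if it induces a connected subgraph with an unbalanced cycle. The edges inside a good
-- set W have rank |W|, while no independent set has more edges than vertices; hence if W is good and G − W were
-- disconnected, contracting the closure of the edges inside W would disconnect the matroid. Dually,
-- 3-connectivity makes the edges meeting either side of a 2-vertex cut contain an unbalanced cycle.
--
-- Let {u, v} be a cut with sides A and B. If every vertex of every side of every cut separates the two cut
-- vertices within its side, then every vertex has exactly two neighbours and si(G) is a cycle. Otherwise take a
-- side A that is smallest among those with a vertex not doing so; then no vertex of A does, so G − {a, b} is
-- connected for all a ∈ A and b ∈ B. As a and b are not adjacent, G − {a, b} must be balanced, so every
-- unbalanced cycle contains all of A or all of B. Rerouting unbalanced cycles along chords (theta property) then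
-- gives |A|, |B| ≤ 3 and finally |A| + |B| ≤ 4, that is |V(G)| ≤ 6.
--
-- If si(G) is a cycle and |V(G)| ≥ 7, two disjoint free cycles would be loops or digons, and such a cycle on
-- {p, q} together with an unbalanced cycle far from it spans all vertices except the outer neighbours of p and
-- q; these are not adjacent, which again disconnects a contraction.

module Submission where

open import Defs
import Data.Bool as Bool
open import Data.Bool using (true; false; if_then_else_)
open import Data.Empty using (⊥; ⊥-elim)
open import Data.Fin using (Fin; zero; suc; toℕ; _≟_)
open import Data.Fin.Properties using (any?; all?; toℕ-injective)
open import Data.Fin.Subset using (Subset; _∈_; _∉_; _⊆_; _∪_; _∩_; _─_; _-_; ∣_∣; Nonempty; ⊤; ⁅_⁆; ∁) renaming (⊥ to ∅)
open import Data.Fin.Subset.Properties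
open import Data.Nat using (ℕ; zero; suc; _+_; _*_; _∸_; _≤_; _<_; z≤n; s≤s; _≤?_)
open import Data.Nat.Induction using (<-wellFounded)
open import Data.Nat.Properties hiding (_≟_)
open import Data.Nat.Solver using (module +-*-Solver)
open import Data.Product using (∃-syntax; _×_; _,_; proj₁; proj₂)
open import Data.Sum using (_⊎_; inj₁; inj₂; [_,_]′; swap)
open import Data.Vec using (lookup; tabulate; _∷_; [])
open import Data.Vec.Properties using (≡-dec; lookup⇒[]=; []=⇒lookup; lookup∘tabulate)
open import Function using (_∘_)
open import Function.Bundles using (mk⇔)
open import Induction.WellFounded using (Acc; acc)
open import Relation.Binary.PropositionalEquality using (_≡_; _≢_; refl; sym; trans; cong; cong₂; subst; module ≡-Reasoning)
open import Relation.Nullary using (¬_; Dec; yes; no; does)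
open import Relation.Nullary.Decidable using (dec-true; dec-false; ¬?; _×-dec_; _⊎-dec_; _→-dec_; decidable-stable; map′)

-- Structure is found by counting, not by tracing walks. A cycle is a minimal nonempty edge set with
-- at least as many edges as vertices. A minimal edge set with more edges than vertices has degree
-- sum 2|V| + 2, hence one vertex of degree four or two of degree three, and in each case it
-- contains a circuit; two disjoint cycles labelled `lin` and `fre` are what quasi-bias excludes. A
-- closure is taken as a maximal edge set of rank at most |W|, so that flatness comes from
-- maximality, and ranks are estimated by comparing edges with vertices. Rerouting works because an
-- unbalanced cycle that misses a vertex of B has to contain all of A. After a chord is inserted
-- inside A, the new cycle still passes through every vertex of A, and the edges at vertices away
-- from the chord survive; repeated insertion forces three edges of a cycle at one vertex. The
-- number 7 enters as |A| + |B| = |V(G)| - 2, which is then at least 5.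

private variable k l : ℕ

-- Finite subsets

∈∪ˡ : ∀ {x} {p q : Subset k} → x ∈ p → x ∈ p ∪ q
∈∪ˡ = x∈p∪q⁺ ∘ inj₁

∈∪ʳ : ∀ {x} {p q : Subset k} → x ∈ q → x ∈ p ∪ q
∈∪ʳ = x∈p∪q⁺ ∘ inj₂

∪-case : ∀ {x} {p q : Subset k} → x ∈ p ∪ q → x ∈ p ⊎ x ∈ q
∪-case {p = p} {q} = x∈p∪q⁻ p q

∪-lub : ∀ {p q r : Subset k} → p ⊆ r → q ⊆ r → p ∪ q ⊆ r
∪-lub p⊆r q⊆r x∈ = [ p⊆r , q⊆r ]′ (∪-case x∈)

∈─ : ∀ {x} {p q : Subset k} → x ∈ p → x ∉ q → x ∈ p ─ q
∈─ = x∈p∧x∉q⇒x∈p─q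

─ˡ : ∀ {x} {p q : Subset k} → x ∈ p ─ q → x ∈ p
─ˡ {p = p} {q} = p─q⊆p p q

─ʳ : ∀ {x} {p q : Subset k} → x ∈ p ─ q → x ∉ q
─ʳ {x = zero}  {p = b ∷ p} {true ∷ q} () _
─ʳ {x = zero}  {p = b ∷ p} {false ∷ q} _ ()
─ʳ {x = suc x} {p = b ∷ p} {c ∷ q} x∈ x∈q = ─ʳ {x = x} {p} {q} (drop-there x∈) (drop-there x∈q)

∈sing : ∀ {x y : Fin k} → x ≡ y → x ∈ ⁅ y ⁆
∈sing refl = x∈⁅x⁆ _

sing≡ : ∀ {x y : Fin k} → x ∈ ⁅ y ⁆ → x ≡ y
sing≡ = x∈⁅y⁆⇒x≡y _

∈- : ∀ {x y} {p : Subset k} → x ∈ p → x ≢ y → x ∈ p - y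
∈- = x∈p∧x≢y⇒x∈p-y

-≢ : ∀ {x y} {p : Subset k} → x ∈ p - y → x ≢ y
-≢ {p = p} x∈ x≡y = ─ʳ {p = p} x∈ (∈sing x≡y)

-ˡ : ∀ {x y} {p : Subset k} → x ∈ p - y → x ∈ p
-ˡ {p = p} = ─ˡ {p = p}

infix 4 _≟ˢ_
_≟ˢ_ : (p q : Subset k) → Dec (p ≡ q)
_≟ˢ_ = ≡-dec Bool._≟_

abstract
  ⊆-or-witness : (p q : Subset k) → p ⊆ q ⊎ ∃[ x ] (x ∈ p × x ∉ q)
  ⊆-or-witness p q with any? (λ x → (x ∈? p) ×-dec ¬? (x ∈? q))
  ... | yes r = inj₂ r
  ... | no ¬r = inj₁ λ {x} x∈p → decidable-stable (x ∈? q) (λ x∉q → ¬r (x , x∈p , x∉q))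

abstract
  allSubset? : {P : Subset k → Set} → (∀ X → Dec (P X)) → Dec (∀ X → P X)
  allSubset? P? with anySubset? (λ X → ¬? (P? X))
  ... | yes (X , ¬p) = no λ f → ¬p (f X)
  ... | no ¬e = yes λ X → decidable-stable (P? X) (λ ¬p → ¬e (X , ¬p))

⟪_⟫ : {P : Fin k → Set} → (∀ x → Dec (P x)) → Subset k
⟪ P? ⟫ = tabulate (does ∘ P?)

∈⟪⟫ : {P : Fin k → Set} (P? : ∀ x → Dec (P x)) → ∀ {x} → P x → x ∈ ⟪ P? ⟫
∈⟪⟫ P? {x} p = lookup⇒[]= x _ (trans (lookup∘tabulate _ x) (dec-true (P? x) p))

⟪⟫∈ : {P : Fin k → Set} (P? : ∀ x → Dec (P x)) → ∀ {x} → x ∈ ⟪ P? ⟫ → P x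
⟪⟫∈ P? {x} x∈ = decidable-stable (P? x) λ ¬p →
  case-false (trans (sym (trans (lookup∘tabulate _ x) (dec-false (P? x) ¬p))) ([]=⇒lookup x∈))
  where
  case-false : false ≡ true → ⊥
  case-false ()

-- A disjoint union given by four pointwise facts, so that `A` with `X ─ A`, the two members of
-- `X ∪ Y`, and the same parts in either order all fit without equations between sets.
record _≐_⊔_ (Z X Y : Subset k) : Set where
  field
    inˡ : X ⊆ Z
    inʳ : Y ⊆ Z
    cov : ∀ {x} → x ∈ Z → x ∈ X ⊎ x ∈ Y
    dis : ∀ {x} → x ∈ X → x ∉ Y
open _≐_⊔_ public

part-─ : {X A : Subset k} → A ⊆ X → X ≐ A ⊔ (X ─ A)
part-─ {X = X} {A} A⊆X = record
  { inˡ = A⊆X ; inʳ = ─ˡ {p = X}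
  ; cov = λ {x} x∈ → case x∈ (x ∈? A)
  ; dis = λ x∈A x∈ → ─ʳ {p = X} x∈ x∈A }
  where
  case : ∀ {x} → x ∈ X → Dec (x ∈ A) → x ∈ A ⊎ x ∈ X ─ A
  case _ (yes a) = inj₁ a
  case x∈ (no ¬a) = inj₂ (∈─ x∈ ¬a)

part-- : {X : Subset k} {e : Fin k} → e ∈ X → X ≐ ⁅ e ⁆ ⊔ (X - e)
part-- e∈X = part-─ (λ x∈ → subst (_∈ _) (sym (sing≡ x∈)) e∈X)

part-∪ : {X Y : Subset k} → (∀ {x} → x ∈ X → x ∉ Y) → (X ∪ Y) ≐ X ⊔ Y
part-∪ d = record { inˡ = ∈∪ˡ ; inʳ = ∈∪ʳ ; cov = ∪-case ; dis = d }

part-swap : {Z X Y : Subset k} → Z ≐ X ⊔ Y → Z ≐ Y ⊔ X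
part-swap p = record { inˡ = inʳ p ; inʳ = inˡ p ; cov = swap ∘ cov p ; dis = λ y x → dis p x y }

abstract
  minimalSubset : {P : Subset k → Set} → (∀ X → Dec (P X)) → ∀ X → P X →
    ∃[ Y ] (Y ⊆ X × P Y × (∀ Z → Z ⊆ Y → P Z → Y ⊆ Z))
  minimalSubset {P = P} P? X₀ = go X₀ (<-wellFounded ∣ X₀ ∣)
    where
    go : ∀ X → Acc _<_ ∣ X ∣ → P X → ∃[ Y ] (Y ⊆ X × P Y × (∀ Z → Z ⊆ Y → P Z → Y ⊆ Z))
    go X (acc rs) pX with anySubset? (λ Z → Z ⊂? X ×-dec P? Z)
    ... | yes (Z , Z⊂X , pZ) with go Z (rs (p⊂q⇒∣p∣<∣q∣ Z⊂X)) pZ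
    ...   | Y , Y⊆Z , pY , min = Y , proj₁ Z⊂X ∘ Y⊆Z , pY , min
    go X (acc rs) pX | no ¬e = X , ⊆-refl , pX , minimal
      where
      minimal : ∀ Z → Z ⊆ X → P Z → X ⊆ Z
      minimal Z Z⊆X pZ with ⊆-or-witness X Z
      ... | inj₁ s = s
      ... | inj₂ w = ⊥-elim (¬e (Z , (Z⊆X , w) , pZ))

abstract
  maximalSubset : {P : Subset k → Set} → (∀ X → Dec (P X)) → ∀ X → P X →
    ∃[ Y ] (X ⊆ Y × P Y × (∀ Z → Y ⊆ Z → P Z → Z ⊆ Y))
  maximalSubset {k} {P} P? X₀ = go X₀ (<-wellFounded (k ∸ ∣ X₀ ∣))
    where
    go : ∀ X → Acc _<_ (k ∸ ∣ X ∣) → P X → ∃[ Y ] (X ⊆ Y × P Y × (∀ Z → Y ⊆ Z → P Z → Z ⊆ Y))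
    go X (acc rs) pX with anySubset? (λ Z → X ⊂? Z ×-dec P? Z)
    ... | yes (Z , X⊂Z , pZ) with go Z (rs (∸-monoʳ-< (p⊂q⇒∣p∣<∣q∣ X⊂Z) (∣p∣≤n Z))) pZ
    ...   | Y , Z⊆Y , pY , max = Y , Z⊆Y ∘ proj₁ X⊂Z , pY , max
    go X (acc rs) pX | no ¬e = X , ⊆-refl , pX , maximal
      where
      maximal : ∀ Z → X ⊆ Z → P Z → Z ⊆ X
      maximal Z X⊆Z pZ with ⊆-or-witness Z X
      ... | inj₁ s = s
      ... | inj₂ w = ⊥-elim (¬e (Z , (X⊆Z , w) , pZ))

abstract
  largestSubset : {P : Subset k → Set} → (∀ X → Dec (P X)) → ∀ X → P X →
    ∃[ r ] ((∃[ I ] (P I × ∣ I ∣ ≡ r)) × (∀ I → P I → ∣ I ∣ ≤ r))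
  largestSubset {k} {P} P? X pX = go k (λ I _ → ∣p∣≤n I)
    where
    go : ∀ b → (∀ I → P I → ∣ I ∣ ≤ b) → ∃[ r ] ((∃[ I ] (P I × ∣ I ∣ ≡ r)) × (∀ I → P I → ∣ I ∣ ≤ r))
    go b bound with anySubset? (λ I → P? I ×-dec (∣ I ∣ Data.Nat.≟ b))
    ... | yes w = b , w , bound
    go zero bound | no ¬w = ⊥-elim (¬w (X , pX , n≤0⇒n≡0 (bound X pX)))
    go (suc b) bound | no ¬w = go b (λ I pI → ≤-pred (≤∧≢⇒< (bound I pI) (λ eq → ¬w (I , pI , eq))))

-- Sums over finite sets

sumFin-cong : {f g : Fin k → ℕ} → (∀ i → f i ≡ g i) → sumFin k f ≡ sumFin k g
sumFin-cong {zero}  h = refl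
sumFin-cong {suc k} h = cong₂ _+_ (h zero) (sumFin-cong (h ∘ suc))

sumFin-≤ : {f g : Fin k → ℕ} → (∀ i → f i ≤ g i) → sumFin k f ≤ sumFin k g
sumFin-≤ {zero}  h = z≤n
sumFin-≤ {suc k} h = +-mono-≤ (h zero) (sumFin-≤ (h ∘ suc))

sumFin-0 : ∀ k → sumFin k (λ _ → 0) ≡ 0
sumFin-0 zero    = refl
sumFin-0 (suc k) = sumFin-0 k

+-interchange : ∀ a b c d → (a + b) + (c + d) ≡ (a + c) + (b + d)
+-interchange = solve 4 (λ a b c d → (a :+ b) :+ (c :+ d) := (a :+ c) :+ (b :+ d)) refl
  where open +-*-Solver

sumFin-+ : (f g : Fin k → ℕ) → sumFin k (λ i → f i + g i) ≡ sumFin k f + sumFin k g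
sumFin-+ {zero}  f g = refl
sumFin-+ {suc k} f g = trans (cong (f zero + g zero +_) (sumFin-+ (f ∘ suc) (g ∘ suc)))
  (+-interchange (f zero) (g zero) (sumFin k (f ∘ suc)) (sumFin k (g ∘ suc)))

sumFin-swap : (f : Fin k → Fin l → ℕ) →
  sumFin k (λ i → sumFin l (f i)) ≡ sumFin l (λ j → sumFin k (λ i → f i j))
sumFin-swap {zero}  {l} f = sym (sumFin-0 l)
sumFin-swap {suc k} {l} f = trans (cong (sumFin l (f zero) +_) (sumFin-swap (f ∘ suc)))
  (sym (sumFin-+ (f zero) (λ j → sumFin k (λ i → f (suc i) j))))

-- Shaped like the body of `deg`: with the weight `inc e v` introduced below it is the degree of
-- `v`, and with constant weight 1 it is the cardinality.
wsum : Subset k → (Fin k → ℕ) → ℕ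
wsum {k} X w = sumFin k (λ e → if lookup X e then w e else 0)

ite-in : ∀ {X : Subset k} {e} {a : ℕ} → e ∈ X → (if lookup X e then a else 0) ≡ a
ite-in e∈X rewrite []=⇒lookup e∈X = refl

ite-out : ∀ {X : Subset k} {e} {a : ℕ} → e ∉ X → (if lookup X e then a else 0) ≡ 0
ite-out {X = X} {e} e∉X with lookup X e in eq
... | true  = ⊥-elim (e∉X (lookup⇒[]= e X eq))
... | false = refl

module _ {X : Subset k} where

  wsum-≤ : {w w′ : Fin k → ℕ} → (∀ {e} → e ∈ X → w e ≤ w′ e) → wsum X w ≤ wsum X w′
  wsum-≤ {w} {w′} h = sumFin-≤ pt
    where
    pt : ∀ e → (if lookup X e then w e else 0) ≤ (if lookup X e then w′ e else 0)
    pt e with lookup X e in eq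
    ... | true  = h (lookup⇒[]= e X eq)
    ... | false = z≤n

  wsum-cong : {w w′ : Fin k → ℕ} → (∀ {e} → e ∈ X → w e ≡ w′ e) → wsum X w ≡ wsum X w′
  wsum-cong h = ≤-antisym (wsum-≤ (≤-reflexive ∘ h)) (wsum-≤ (≤-reflexive ∘ sym ∘ h))

  wsum-+ : (w w′ : Fin k → ℕ) → wsum X (λ e → w e + w′ e) ≡ wsum X w + wsum X w′
  wsum-+ w w′ = trans (sumFin-cong pt)
    (sumFin-+ {k} (λ e → if lookup X e then w e else 0) (λ e → if lookup X e then w′ e else 0))
    where
    pt : ∀ e → (if lookup X e then w e + w′ e else 0) ≡ (if lookup X e then w e else 0) + (if lookup X e then w′ e else 0)
    pt e with lookup X e
    ... | true  = refl
    ... | false = refl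

  wsum-support : {w : Fin k → ℕ} → (∀ {e} → e ∉ X → w e ≡ 0) → sumFin k w ≡ wsum X w
  wsum-support {w} h = sumFin-cong pt
    where
    pt : ∀ e → w e ≡ (if lookup X e then w e else 0)
    pt e with e ∈? X
    ... | yes i = sym (ite-in i)
    ... | no ¬i = trans (h ¬i) (sym (ite-out ¬i))

wsum-split : {Z X Y : Subset k} → Z ≐ X ⊔ Y → (w : Fin k → ℕ) → wsum Z w ≡ wsum X w + wsum Y w
wsum-split {k} {Z} {X} {Y} p w = trans (sumFin-cong pt)
  (sumFin-+ {k} (λ e → if lookup X e then w e else 0) (λ e → if lookup Y e then w e else 0))
  where
  pt : ∀ e → (if lookup Z e then w e else 0) ≡ (if lookup X e then w e else 0) + (if lookup Y e then w e else 0)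
  pt e with e ∈? X | e ∈? Y
  ... | yes x | yes y = ⊥-elim (dis p x y)
  ... | yes x | no ¬y = trans (ite-in (inˡ p x)) (sym (trans (cong₂ _+_ (ite-in x) (ite-out ¬y)) (+-identityʳ _)))
  ... | no ¬x | yes y = trans (ite-in (inʳ p y)) (sym (cong₂ _+_ (ite-out ¬x) (ite-in y)))
  ... | no ¬x | no ¬y = trans (ite-out (λ z → [ ¬x , ¬y ]′ (cov p z))) (sym (cong₂ _+_ (ite-out ¬x) (ite-out ¬y)))

wsum-mono : {X Z : Subset k} → X ⊆ Z → (w : Fin k → ℕ) → wsum X w ≤ wsum Z w
wsum-mono {X = X} {Z} X⊆Z w = subst (wsum X w ≤_) (sym (wsum-split (part-─ X⊆Z) w)) (m≤m+n _ _)

wsum-∅ : (w : Fin k → ℕ) → wsum ∅ w ≡ 0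
wsum-∅ {k} w = trans (sumFin-cong {k} (λ e → ite-out {a = w e} (∉⊥ {x = e}))) (sumFin-0 k)

wsum-sing : (e : Fin k) (w : Fin k → ℕ) → wsum ⁅ e ⁆ w ≡ w e
wsum-sing zero    w = trans (cong (w zero +_) (wsum-∅ (w ∘ suc))) (+-identityʳ _)
wsum-sing (suc e) w = wsum-sing e (w ∘ suc)

wsum-remove : {X : Subset k} {e : Fin k} → e ∈ X → (w : Fin k → ℕ) → wsum X w ≡ w e + wsum (X - e) w
wsum-remove {X = X} {e} e∈X w = trans (wsum-split (part-- e∈X) w) (cong (_+ wsum (X - e) w) (wsum-sing e w))

wsum-elem : {X : Subset k} {e : Fin k} → e ∈ X → (w : Fin k → ℕ) → w e ≤ wsum X w
wsum-elem e∈X w = subst (w _ ≤_) (sym (wsum-remove e∈X w)) (m≤m+n _ _)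

wsum-two : {X : Subset k} {e f : Fin k} → e ∈ X → f ∈ X → e ≢ f → (w : Fin k → ℕ) → w e + w f ≤ wsum X w
wsum-two {X = X} e∈X f∈X e≢f w = subst (w _ + w _ ≤_) (sym (wsum-remove e∈X w))
  (+-monoʳ-≤ (w _) (wsum-elem (∈- f∈X (e≢f ∘ sym)) w))

wsum-three : {X : Subset k} {e f g : Fin k} → e ∈ X → f ∈ X → g ∈ X → e ≢ f → e ≢ g → f ≢ g →
  (w : Fin k → ℕ) → w e + (w f + w g) ≤ wsum X w
wsum-three {X = X} e∈X f∈X g∈X e≢f e≢g f≢g w = subst (w _ + (w _ + w _) ≤_) (sym (wsum-remove e∈X w))
  (+-monoʳ-≤ (w _) (wsum-two (∈- f∈X (e≢f ∘ sym)) (∈- g∈X (e≢g ∘ sym)) f≢g w))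

abstract
  wsum-pos : {X : Subset k} {w : Fin k → ℕ} → 1 ≤ wsum X w → ∃[ e ] (e ∈ X × 1 ≤ w e)
  wsum-pos {k} {X} {w} pos with any? (λ e → (e ∈? X) ×-dec (1 ≤? w e))
  ... | yes r = r
  ... | no ¬r = ⊥-elim (<⇒≢ pos (sym (trans (wsum-cong {X = X} {w} {λ _ → 0} zeros) zero-sum)))
    where
    zeros : ∀ {e} → e ∈ X → w e ≡ 0
    zeros {e} e∈ = n<1⇒n≡0 (≰⇒> (λ h → ¬r (e , e∈ , h)))
    zero-sum : wsum X (λ _ → 0) ≡ 0
    zero-sum = trans (sumFin-cong pt) (sumFin-0 k)
      where
      pt : ∀ e → (if lookup X e then 0 else 0) ≡ 0
      pt e with lookup X e
      ... | true  = refl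
      ... | false = refl

card-wsum : (X : Subset k) → ∣ X ∣ ≡ wsum X (λ _ → 1)
card-wsum []          = refl
card-wsum (true ∷ X)  = cong suc (card-wsum X)
card-wsum (false ∷ X) = card-wsum X

card-split : {Z X Y : Subset k} → Z ≐ X ⊔ Y → ∣ Z ∣ ≡ ∣ X ∣ + ∣ Y ∣
card-split {Z = Z} {X} {Y} p = trans (card-wsum Z) (trans (wsum-split p _) (sym (cong₂ _+_ (card-wsum X) (card-wsum Y))))

card-remove : {X : Subset k} {e : Fin k} → e ∈ X → ∣ X ∣ ≡ suc ∣ X - e ∣
card-remove {X = X} {e} e∈X = trans (card-split (part-- e∈X)) (cong (_+ ∣ X - e ∣) (∣⁅x⁆∣≡1 e))

card-insert : {X : Subset k} {e : Fin k} → e ∉ X → ∣ X ∪ ⁅ e ⁆ ∣ ≡ suc ∣ X ∣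
card-insert {X = X} {e} e∉X = trans (card-split (part-∪ (λ x∈ x∈e → e∉X (subst (_∈ X) (sing≡ x∈e) x∈))))
  (trans (cong (∣ X ∣ +_) (∣⁅x⁆∣≡1 e)) (+-comm ∣ X ∣ 1))

card-pos : {X : Subset k} {e : Fin k} → e ∈ X → 1 ≤ ∣ X ∣
card-pos e∈X = subst (1 ≤_) (sym (card-remove e∈X)) (s≤s z≤n)

card-two : {X : Subset k} {e f : Fin k} → e ∈ X → f ∈ X → e ≢ f → 2 ≤ ∣ X ∣
card-two {X = X} e∈X f∈X e≢f = subst (2 ≤_) (sym (card-wsum X)) (wsum-two e∈X f∈X e≢f _)

card-three : {X : Subset k} {e f g : Fin k} → e ∈ X → f ∈ X → g ∈ X → e ≢ f → e ≢ g → f ≢ g → 3 ≤ ∣ X ∣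
card-three {X = X} e∈X f∈X g∈X e≢f e≢g f≢g =
  subst (3 ≤_) (sym (card-wsum X)) (wsum-three e∈X f∈X g∈X e≢f e≢g f≢g _)

abstract
  card-elem : {X : Subset k} → 1 ≤ ∣ X ∣ → Nonempty X
  card-elem {X = X} h with wsum-pos {X = X} (subst (1 ≤_) (card-wsum X) h)
  ... | e , e∈X , _ = e , e∈X

abstract
  card-second : {X : Subset k} (x : Fin k) → 2 ≤ ∣ X ∣ → ∃[ y ] (y ∈ X × y ≢ x)
  card-second {X = X} x h with x ∈? X
  ... | yes x∈X with card-elem {X = X - x} (≤-pred (subst (2 ≤_) (card-remove x∈X) h))
  ...   | y , y∈ = y , -ˡ {p = X} y∈ , -≢ {p = X} y∈
  card-second {X = X} x h | no x∉X with card-elem {X = X} (≤-trans (s≤s z≤n) h)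
  ... | y , y∈ = y , y∈ , λ { refl → x∉X y∈ }

wsum-const : (X : Subset k) (c : ℕ) → wsum X (λ _ → c) ≡ c * ∣ X ∣
wsum-const {k} X zero    = trans (sumFin-cong pt) (sumFin-0 k)
  where
  pt : ∀ e → (if lookup X e then 0 else 0) ≡ 0
  pt e with lookup X e
  ... | true  = refl
  ... | false = refl
wsum-const X (suc c) = trans (wsum-+ {X = X} (λ _ → 1) (λ _ → c))
  (cong₂ _+_ (sym (card-wsum X)) (wsum-const X c))

-- Degree sequences

module _ {S : Subset k} {w : Fin k → ℕ} (w≥2 : ∀ {v} → v ∈ S → 2 ≤ w v) where

  wsum≥2 : 2 * ∣ S ∣ ≤ wsum S w
  wsum≥2 = subst (_≤ wsum S w) (wsum-const S 2) (wsum-≤ {X = S} {λ _ → 2} w≥2)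

-- The other elements of `S` already use up 2 each, so a single element can exceed 2 by at most the
-- total surplus `c`.
wsum-excess : {S : Subset k} {w : Fin k → ℕ} → (∀ {v} → v ∈ S → 2 ≤ w v) →
  ∀ c → wsum S w ≤ 2 * ∣ S ∣ + c → ∀ {v} → v ∈ S → w v ≤ 2 + c
wsum-excess {S = S} {w} w≥2 c h {v} v∈S = +-cancelʳ-≤ (2 * ∣ S - v ∣) (w v) (2 + c) (begin
  w v + 2 * ∣ S - v ∣        ≤⟨ +-monoʳ-≤ (w v) (wsum≥2 {S = S - v} (w≥2 ∘ -ˡ {p = S})) ⟩
  w v + wsum (S - v) w       ≡⟨ sym (wsum-remove v∈S w) ⟩
  wsum S w                   ≤⟨ h ⟩
  2 * ∣ S ∣ + c              ≡⟨ cong (λ t → 2 * t + c) (card-remove v∈S) ⟩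
  2 * suc ∣ S - v ∣ + c      ≡⟨ solve 2 (λ s c → con 2 :* (con 1 :+ s) :+ c := (con 2 :+ c) :+ con 2 :* s) refl ∣ S - v ∣ c ⟩
  2 + c + 2 * ∣ S - v ∣      ∎)
  where
  open ≤-Reasoning
  open +-*-Solver

wsum-all2 : {S : Subset k} {w : Fin k → ℕ} → (∀ {v} → v ∈ S → 2 ≤ w v) →
  wsum S w ≤ 2 * ∣ S ∣ → ∀ {v} → v ∈ S → w v ≡ 2
wsum-all2 {S = S} {w} w≥2 h v∈S = ≤-antisym
  (wsum-excess w≥2 0 (subst (wsum S w ≤_) (sym (+-identityʳ _)) h) v∈S) (w≥2 v∈S)

wsum-rest : {S : Subset k} {w : Fin k → ℕ} → ∀ c d {v} → v ∈ S → w v ≡ 2 + d →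
  wsum S w ≡ 2 * ∣ S ∣ + (d + c) → wsum (S - v) w ≡ 2 * ∣ S - v ∣ + c
wsum-rest {S = S} {w} c d {v} v∈S eq h = +-cancelˡ-≡ (2 + d) _ _ (begin
  2 + d + wsum (S - v) w        ≡⟨ cong (_+ wsum (S - v) w) (sym eq) ⟩
  w v + wsum (S - v) w          ≡⟨ sym (wsum-remove v∈S w) ⟩
  wsum S w                      ≡⟨ h ⟩
  2 * ∣ S ∣ + (d + c)           ≡⟨ cong (λ t → 2 * t + (d + c)) (card-remove v∈S) ⟩
  2 * suc ∣ S - v ∣ + (d + c)   ≡⟨ solve 3 (λ s d c → con 2 :* (con 1 :+ s) :+ (d :+ c) := (con 2 :+ d) :+ (con 2 :* s :+ c)) refl ∣ S - v ∣ d c ⟩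
  2 + d + (2 * ∣ S - v ∣ + c)   ∎)
  where
  open ≡-Reasoning
  open +-*-Solver

-- The two ways to distribute a degree surplus of two: the pattern of a tight handcuff, and that of
-- a theta graph or a loose handcuff.
data Excess2 (S : Subset k) (w : Fin k → ℕ) : Set where
  one4 : ∀ v → v ∈ S → w v ≡ 4 → (∀ {x} → x ∈ S → x ≢ v → w x ≡ 2) → Excess2 S w
  two3 : ∀ u v → u ∈ S → v ∈ S → u ≢ v → w u ≡ 3 → w v ≡ 3 →
         (∀ {x} → x ∈ S → x ≢ u → x ≢ v → w x ≡ 2) → Excess2 S w

abstract
  wsum-some3 : {S : Subset k} {w : Fin k → ℕ} → (∀ {v} → v ∈ S → 2 ≤ w v) →
    ∀ c → wsum S w ≡ 2 * ∣ S ∣ + suc c → ∃[ v ] (v ∈ S × 3 ≤ w v)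
  wsum-some3 {S = S} {w} w≥2 c h with any? (λ v → (v ∈? S) ×-dec (3 ≤? w v))
  ... | yes r = r
  ... | no ¬r = ⊥-elim (m+1+n≰m (2 * ∣ S ∣) (begin
    2 * ∣ S ∣ + suc c   ≡⟨ sym h ⟩
    wsum S w            ≤⟨ wsum-≤ {X = S} (λ {v} v∈ → ≤-pred (≰⇒> (λ q → ¬r (v , v∈ , q)))) ⟩
    wsum S (λ _ → 2)    ≡⟨ wsum-const S 2 ⟩
    2 * ∣ S ∣           ∎))
    where open ≤-Reasoning

abstract
  excess2 : {S : Subset k} {w : Fin k → ℕ} → (∀ {v} → v ∈ S → 2 ≤ w v) →
    wsum S w ≡ 2 * ∣ S ∣ + 2 → Excess2 S w
  excess2 {S = S} {w} w≥2 h with wsum-some3 w≥2 1 h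
  ... | v , v∈S , 3≤ with w v in eq | 3≤ | wsum-excess w≥2 2 (≤-reflexive h) v∈S
  ... | 3 | _ | _ = second (wsum-some3 {S = S - v} (w≥2 ∘ -ˡ {p = S}) 0 rest)
    where
    rest : wsum (S - v) w ≡ 2 * ∣ S - v ∣ + 1
    rest = wsum-rest 1 1 v∈S eq h
    second : ∃[ u ] (u ∈ S - v × 3 ≤ w u) → Excess2 S w
    second (u , u∈ , 3≤u) = two3 v u v∈S (-ˡ {p = S} u∈) (-≢ {p = S} u∈ ∘ sym) eq eq-u
        (λ x∈S x≢v x≢u → wsum-all2 {S = S - v - u} (w≥2 ∘ -ˡ {p = S} ∘ -ˡ {p = S - v})
          (≤-reflexive (trans (wsum-rest 0 1 u∈ eq-u rest) (+-identityʳ _)))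
          (∈- (∈- x∈S x≢v) x≢u))
      where
      eq-u : w u ≡ 3
      eq-u = ≤-antisym (wsum-excess {S = S - v} (w≥2 ∘ -ˡ {p = S}) 1 (≤-reflexive rest) u∈) 3≤u
  ... | 4 | _ | _ = one4 v v∈S eq
    (λ x∈S x≢v → wsum-all2 {S = S - v} (w≥2 ∘ -ˡ {p = S})
      (≤-reflexive (trans (wsum-rest 0 2 v∈S eq h) (+-identityʳ _))) (∈- x∈S x≢v))
  ... | suc (suc (suc (suc (suc _)))) | _ | s≤s (s≤s (s≤s (s≤s ())))
  ... | 2 | s≤s (s≤s ()) | _
  ... | 1 | s≤s () | _

-- Degrees, connectedness and cycles of edge sets.

module EdgeSets {n m : ℕ} (G : Graph n m) where

  V : Subset m → Fin n → Set
  V = InV G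

  d : Subset m → Fin n → ℕ
  d = deg G

  Cycle : Subset m → Set
  Cycle = IsCycle G

  EConn : Subset m → Set
  EConn = EdgeConnected G

  abstract
    Inc? : ∀ e v → Dec (Inc G e v)
    Inc? e v = (src G e ≟ v) ⊎-dec (tgt G e ≟ v)

  abstract
    V? : ∀ X v → Dec (V X v)
    V? X v = any? (λ e → (e ∈? X) ×-dec Inc? e v)

  VS : Subset m → Subset n
  VS X = ⟪ V? X ⟫

  inVS : ∀ {X v} → V X v → v ∈ VS X
  inVS {X} = ∈⟪⟫ (V? X)

  outVS : ∀ {X v} → v ∈ VS X → V X v
  outVS {X} = ⟪⟫∈ (V? X)

  VS⊆ : ∀ {X} {W : Subset n} → (∀ {v} → V X v → v ∈ W) → VS X ⊆ W
  VS⊆ {X} h = h ∘ outVS {X}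

  inc : Fin m → Fin n → ℕ
  inc e v = (if does (src G e ≟ v) then 1 else 0) + (if does (tgt G e ≟ v) then 1 else 0)

  inc-pos : ∀ {e v} → Inc G e v → 1 ≤ inc e v
  inc-pos {e} {v} (inj₁ p) rewrite dec-true (src G e ≟ v) p = s≤s z≤n
  inc-pos {e} {v} (inj₂ p) rewrite dec-true (tgt G e ≟ v) p = m≤n+m 1 _

  inc-zero : ∀ {e v} → ¬ Inc G e v → inc e v ≡ 0
  inc-zero {e} {v} ¬i rewrite dec-false (src G e ≟ v) (¬i ∘ inj₁) | dec-false (tgt G e ≟ v) (¬i ∘ inj₂) = refl

  inc-Inc : ∀ {e v} → 1 ≤ inc e v → Inc G e v
  inc-Inc {e} {v} h = decidable-stable (Inc? e v) (λ ¬i → <⇒≢ h (sym (inc-zero ¬i)))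

  inc-loop : ∀ {e v} → IsLoop G e → Inc G e v → inc e v ≡ 2
  inc-loop {e} {v} l (inj₁ p) rewrite dec-true (src G e ≟ v) p | dec-true (tgt G e ≟ v) (trans (sym l) p) = refl
  inc-loop {e} {v} l (inj₂ p) rewrite dec-true (src G e ≟ v) (trans l p) | dec-true (tgt G e ≟ v) p = refl

  inc-nonloop : ∀ {e v} → ¬ IsLoop G e → Inc G e v → inc e v ≡ 1
  inc-nonloop {e} {v} ¬l (inj₁ p) rewrite dec-true (src G e ≟ v) p
    | dec-false (tgt G e ≟ v) (λ q → ¬l (trans p (sym q))) = refl
  inc-nonloop {e} {v} ¬l (inj₂ p) rewrite dec-true (tgt G e ≟ v) p
    | dec-false (src G e ≟ v) (λ q → ¬l (trans q (sym p))) = refl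

  sum-point : ∀ {k} (a : Fin k) → sumFin k (λ v → if does (a ≟ v) then 1 else 0) ≡ 1
  sum-point {suc k} zero    = cong suc (sumFin-0 k)
  sum-point {suc k} (suc a) = sum-point a

  inc-sum : ∀ e → sumFin n (inc e) ≡ 2
  inc-sum e = trans (sumFin-+ {n} (λ v → if does (src G e ≟ v) then 1 else 0) (λ v → if does (tgt G e ≟ v) then 1 else 0))
    (cong₂ _+_ (sum-point (src G e)) (sum-point (tgt G e)))

  d-split : ∀ {Z X Y} → Z ≐ X ⊔ Y → ∀ v → d Z v ≡ d X v + d Y v
  d-split p v = wsum-split p (λ e → inc e v)

  d-mono : ∀ {X Z} → X ⊆ Z → ∀ v → d X v ≤ d Z v
  d-mono X⊆Z v = wsum-mono X⊆Z (λ e → inc e v)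

  d-pos : ∀ {X v} → V X v → 1 ≤ d X v
  d-pos {X} {v} (e , e∈X , i) = ≤-trans (inc-pos i) (wsum-elem {X = X} e∈X (λ e → inc e v))

  d-V : ∀ {X v} → 1 ≤ d X v → V X v
  d-V {X} {v} h with wsum-pos {X = X} {λ e → inc e v} h
  ... | e , e∈X , p = e , e∈X , inc-Inc p

  d-zero : ∀ {X v} → ¬ V X v → d X v ≡ 0
  d-zero {X} {v} ¬i = n<1⇒n≡0 (≰⇒> (¬i ∘ d-V {X} {v}))

  d-part : ∀ {Z X Y} → Z ≐ X ⊔ Y → ∀ {v} → ¬ V Y v → d X v ≡ d Z v
  d-part {Z} {X} {Y} p {v} ¬y = sym (trans (d-split p v) (trans (cong (d X v +_) (d-zero {Y} ¬y)) (+-identityʳ _)))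

  d-remove : ∀ {X e} → e ∈ X → ∀ v → d X v ≡ inc e v + d (X - e) v
  d-remove {X} e∈X v = wsum-remove {X = X} e∈X (λ e → inc e v)

  d-sing : ∀ e v → d ⁅ e ⁆ v ≡ inc e v
  d-sing e v = wsum-sing e (λ e → inc e v)

  d-elem : ∀ {X e} → e ∈ X → ∀ v → inc e v ≤ d X v
  d-elem {X} e∈X v = wsum-elem {X = X} e∈X (λ e → inc e v)

  d-two : ∀ {X e f} → e ∈ X → f ∈ X → e ≢ f → ∀ v → inc e v + inc f v ≤ d X v
  d-two {X} e∈X f∈X e≢f v = wsum-two {X = X} e∈X f∈X e≢f (λ e → inc e v)

  abstract
    d-second : ∀ {X e w} → e ∈ X → inc e w ≤ 1 → 2 ≤ d X w → ∃[ f ] (f ∈ X × f ≢ e × Inc G f w)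
    d-second {X} {e} {w} e∈X le h with d-V {X - e} {w} (+-cancelˡ-≤ 1 _ _ (≤-trans h
        (≤-trans (≤-reflexive (d-remove {X} e∈X w)) (+-monoˡ-≤ (d (X - e) w) le))))
    ... | f , f∈ , i = f , -ˡ {p = X} f∈ , -≢ {p = X} f∈ , i

  V-mono : ∀ {X Y} → X ⊆ Y → ∀ {v} → V X v → V Y v
  V-mono X⊆Y (e , e∈X , i) = e , X⊆Y e∈X , i

  V-cov : ∀ {Z X Y} → Z ≐ X ⊔ Y → ∀ {v} → V Z v → V X v ⊎ V Y v
  V-cov p (e , e∈Z , i) = [ (λ x → inj₁ (e , x , i)) , (λ y → inj₂ (e , y , i)) ]′ (cov p e∈Z)

  V-∪ : ∀ {X Y v} → V (X ∪ Y) v → V X v ⊎ V Y v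
  V-∪ (e , e∈ , i) = [ (λ x → inj₁ (e , x , i)) , (λ y → inj₂ (e , y , i)) ]′ (∪-case e∈)

  V-sing : ∀ {e v} → V ⁅ e ⁆ v → Inc G e v
  V-sing (f , f∈ , i) = subst (λ g → Inc G g _) (sing≡ f∈) i

  sing-V : ∀ {e v} → Inc G e v → V ⁅ e ⁆ v
  sing-V {e} i = e , x∈⁅x⁆ e , i

  VS-mono : ∀ {X Y} → X ⊆ Y → VS X ⊆ VS Y
  VS-mono {X} {Y} X⊆Y = inVS {Y} ∘ V-mono X⊆Y ∘ outVS {X}

  VS-split : ∀ {Z X Y} → Z ≐ X ⊔ Y → VertexDisjoint G X Y → VS Z ≐ VS X ⊔ VS Y
  VS-split {Z} {X} {Y} p vd = record
    { inˡ = VS-mono (inˡ p) ; inʳ = VS-mono (inʳ p)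
    ; cov = λ v∈ → [ inj₁ ∘ inVS {X} , inj₂ ∘ inVS {Y} ]′ (V-cov p (outVS {Z} v∈))
    ; dis = λ x y → vd _ (outVS {X} x , outVS {Y} y) }

  handshake : ∀ X → wsum (VS X) (d X) ≡ 2 * ∣ X ∣
  handshake X = begin
    wsum (VS X) (d X)                  ≡⟨ sym (wsum-support {X = VS X} (λ v∉ → d-zero {X} (v∉ ∘ inVS {X}))) ⟩
    sumFin n (d X)                     ≡⟨ sumFin-swap {n} {m} (λ v e → if lookup X e then inc e v else 0) ⟩
    sumFin m (λ e → sumFin n (λ v → if lookup X e then inc e v else 0)) ≡⟨ sumFin-cong {m} pt ⟩
    wsum X (λ _ → 2)                   ≡⟨ wsum-const X 2 ⟩
    2 * ∣ X ∣                          ∎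
    where
    open ≡-Reasoning
    pt : ∀ e → sumFin n (λ v → if lookup X e then inc e v else 0) ≡ (if lookup X e then 2 else 0)
    pt e with lookup X e
    ... | true  = inc-sum e
    ... | false = sumFin-0 n

  -- Connected edge sets

  vd-sym : ∀ {X Y} → VertexDisjoint G X Y → VertexDisjoint G Y X
  vd-sym vd v (a , b) = vd v (b , a)

  abstract
    share : ∀ {Z X Y} → EConn Z → Z ≐ X ⊔ Y → Nonempty X → Nonempty Y → ∃[ v ] (V X v × V Y v)
    share {Z} {X} {Y} ec p nx (y , y∈Y) with ec X (inˡ p) nx (y , ∈─ (inʳ p y∈Y) (λ x → dis p x y∈Y))
    ... | v , vx , vz = v , vx , V-mono {Z ─ X} {Y}
      (λ e∈ → [ (λ x → ⊥-elim (─ʳ {p = Z} e∈ x)) , (λ y → y) ]′ (cov p (─ˡ {p = Z} e∈))) vz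

  abstract
    mkConn : ∀ {Z} → (∀ X Y → Z ≐ X ⊔ Y → Nonempty X → Nonempty Y → VertexDisjoint G X Y → ⊥) → EConn Z
    mkConn {Z} h A A⊆Z na nb with any? (λ v → V? A v ×-dec V? (Z ─ A) v)
    ... | yes r = r
    ... | no ¬r = ⊥-elim (h A (Z ─ A) (part-─ A⊆Z) na nb (λ v p → ¬r (v , p)))

  abstract
    EConn? : ∀ Z → Dec (EConn Z)
    EConn? Z = allSubset? λ A → (A ⊆? Z) →-dec (nonempty? A →-dec (nonempty? (Z ─ A) →-dec
      any? (λ v → V? A v ×-dec V? (Z ─ A) v)))

  abstract
    ¬conn : ∀ {Z} → ¬ EConn Z → ∃[ X ] ∃[ Y ] (Z ≐ X ⊔ Y × Nonempty X × Nonempty Y × VertexDisjoint G X Y)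
    ¬conn {Z} ¬ec with anySubset? (λ A → (A ⊆? Z) ×-dec (nonempty? A ×-dec (nonempty? (Z ─ A) ×-dec
        ¬? (any? (λ v → V? A v ×-dec V? (Z ─ A) v)))))
    ... | yes (A , A⊆Z , na , nb , ¬r) = A , Z ─ A , part-─ A⊆Z , na , nb , λ v p → ¬r (v , p)
    ... | no ¬e = ⊥-elim (¬ec (λ A A⊆Z na nb → decidable-stable (any? (λ v → V? A v ×-dec V? (Z ─ A) v))
        (λ ¬r → ¬e (A , A⊆Z , na , nb , ¬r))))

  abstract
    inOne : ∀ {K X Y} → EConn K → (∀ {e} → e ∈ K → e ∈ X ⊎ e ∈ Y) → VertexDisjoint G X Y → K ⊆ X ⊎ K ⊆ Y
    inOne {K} {X} {Y} ec c vd with ⊆-or-witness K X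
    ... | inj₁ K⊆X = inj₁ K⊆X
    ... | inj₂ (f , f∈K , f∉X) with ⊆-or-witness K Y
    ...   | inj₁ K⊆Y = inj₂ K⊆Y
    ...   | inj₂ (g , g∈K , g∉Y) with share {K} {K ∩ X} {K ─ (K ∩ X)} ec (part-─ (p∩q⊆p K X))
              (g , x∈p∩q⁺ (g∈K , [ (λ x → x) , ⊥-elim ∘ g∉Y ]′ (c g∈K)))
              (f , ∈─ f∈K (f∉X ∘ p∩q⊆q K X))
    ...     | v , vx , (e , e∈ , i) = ⊥-elim (vd v (V-mono (p∩q⊆q K X) vx , e , y , i))
      where
      y : e ∈ Y
      y with c (─ˡ {p = K} e∈)
      ... | inj₁ x = ⊥-elim (─ʳ {p = K} e∈ (x∈p∩q⁺ (─ˡ {p = K} e∈ , x)))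
      ... | inj₂ y = y

  conn-∪ : ∀ {X Y v} → EConn X → EConn Y → V X v → V Y v → EConn (X ∪ Y)
  conn-∪ {X} {Y} {v} ex ey vx vy = mkConn λ A B p na nb vd →
    both A B p na nb vd (inOne {X} ex (cov p ∘ ∈∪ˡ) vd) (inOne {Y} ey (cov p ∘ ∈∪ʳ) vd)
    where
    both : ∀ A B → (X ∪ Y) ≐ A ⊔ B → Nonempty A → Nonempty B → VertexDisjoint G A B →
      X ⊆ A ⊎ X ⊆ B → Y ⊆ A ⊎ Y ⊆ B → ⊥
    both A B p na (b , b∈) vd (inj₁ xa) (inj₁ ya) = dis p (∪-lub {p = X} xa ya (inʳ p b∈)) b∈
    both A B p (a , a∈) nb vd (inj₂ xb) (inj₂ yb) = dis p a∈ (∪-lub {p = X} xb yb (inˡ p a∈))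
    both A B p na nb vd (inj₁ xa) (inj₂ yb) = vd v (V-mono xa vx , V-mono yb vy)
    both A B p na nb vd (inj₂ xb) (inj₁ ya) = vd v (V-mono ya vy , V-mono xb vx)

  sing-conn : ∀ e → EConn ⁅ e ⁆
  sing-conn e = mkConn λ A B p (a , a∈) (b , b∈) _ →
    dis p a∈ (subst (_∈ B) (trans (sing≡ (inʳ p b∈)) (sym (sing≡ (inˡ p a∈)))) b∈)

  -- Cycles

  abstract
    Cycle? : ∀ C → Dec (Cycle C)
    Cycle? C = nonempty? C ×-dec (EConn? C ×-dec all? (λ v → V? C v →-dec (d C v Data.Nat.≟ 2)))

  -- If an edge of `C` were left over, connectedness would give a vertex shared by `Y` and the rest,
  -- of degree at least 2 + 1 in `C`. This is how a set inside a cycle is recognised as the whole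
  -- cycle.
  cycle-closed : ∀ {C Y} → Cycle C → Y ⊆ C → Nonempty Y → (∀ {v} → V Y v → 2 ≤ d Y v) → C ⊆ Y
  cycle-closed {C} {Y} (_ , ec , d2) Y⊆C ne h with ⊆-or-witness C Y
  ... | inj₁ s = s
  ... | inj₂ (e , e∈C , e∉Y) with share ec (part-─ Y⊆C) ne (e , ∈─ e∈C e∉Y)
  ...   | v , vy , vr = ⊥-elim (<-irrefl refl (begin-strict
    2                        <⟨ ≤-refl ⟩
    2 + 1                    ≤⟨ +-mono-≤ (h vy) (d-pos {C ─ Y} vr) ⟩
    d Y v + d (C ─ Y) v      ≡⟨ sym (d-split (part-─ Y⊆C) v) ⟩
    d C v                    ≡⟨ d2 v (V-mono Y⊆C vy) ⟩
    2                        ∎))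
    where open ≤-Reasoning

  cycle-⊆ : ∀ {C K} → Cycle C → Cycle K → K ⊆ C → K ≡ C
  cycle-⊆ c (ne , _ , d2) K⊆C = ⊆-antisym K⊆C (cycle-closed c K⊆C ne (λ v → ≤-reflexive (sym (d2 _ v))))

  cycle-card : ∀ {C} → Cycle C → ∣ C ∣ ≡ ∣ VS C ∣
  cycle-card {C} (_ , _ , d2) = *-cancelˡ-≡ ∣ C ∣ ∣ VS C ∣ 2 (begin
    2 * ∣ C ∣               ≡⟨ sym (handshake C) ⟩
    wsum (VS C) (d C)       ≡⟨ wsum-cong {X = VS C} (λ v∈ → d2 _ (outVS {C} v∈)) ⟩
    wsum (VS C) (λ _ → 2)   ≡⟨ wsum-const (VS C) 2 ⟩
    2 * ∣ VS C ∣            ∎)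
    where open ≡-Reasoning

  VS-drop : ∀ {Z e v} → e ∈ Z → Inc G e v → d Z v ≡ 1 → ∣ VS (Z - e) ∣ < ∣ VS Z ∣
  VS-drop {Z} {e} {v} e∈Z i d1 = p⊂q⇒∣p∣<∣q∣ (VS-mono (-ˡ {p = Z}) , v , inVS {Z} (e , e∈Z , i) , gone)
    where
    gone : v ∉ VS (Z - e)
    gone v∈ = <-irrefl refl (begin-strict
      1                     <⟨ ≤-refl ⟩
      1 + 1                 ≤⟨ +-mono-≤ (inc-pos i) (d-pos {Z - e} (outVS {Z - e} v∈)) ⟩
      inc e v + d (Z - e) v ≡⟨ sym (d-remove {Z} e∈Z v) ⟩
      d Z v                 ≡⟨ d1 ⟩
      1                     ∎)
      where open ≤-Reasoning

  d≥2 : ∀ {X v} → V X v → d X v ≢ 1 → 2 ≤ d X v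
  d≥2 {X} vx ≢1 = ≤∧≢⇒< (d-pos {X} vx) (≢1 ∘ sym)

  other-end : ∀ {e v} → ¬ IsLoop G e → Inc G e v → ∃[ w ] (w ≢ v × Inc G e w)
  other-end {e} ¬l (inj₁ p) = tgt G e , (λ q → ¬l (trans p (sym q))) , inj₂ refl
  other-end {e} ¬l (inj₂ p) = src G e , (λ q → ¬l (trans q (sym p))) , inj₁ refl

  private
    Dense : Subset m → Set
    Dense Z = Nonempty Z × ∣ VS Z ∣ ≤ ∣ Z ∣

    Dense? : ∀ Z → Dec (Dense Z)
    Dense? Z = nonempty? Z ×-dec (∣ VS Z ∣ ≤? ∣ Z ∣)

    -- Minimality leaves every nonempty proper subset with fewer edges than vertices. Adding this
    -- over two vertex-disjoint parts gives connectedness, deleting the edge at a leaf excludes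
    -- degree one, and deleting an arbitrary edge bounds the degree sum by 2|V|, so that all degrees
    -- are two.
    minimal-cycle : ∀ {Z} → Dense Z → (∀ Y → Y ⊆ Z → Dense Y → Z ⊆ Y) → Cycle Z
    minimal-cycle {Z} ((f , f∈Z) , dense) min =
        (f , f∈Z) , mkConn conn
      , λ v vz → wsum-all2 {S = VS Z} deg≥2 total (inVS {Z} vz)
      where
      sparse : ∀ {Y e} → Y ⊆ Z → Nonempty Y → e ∈ Z → e ∉ Y → ∣ Y ∣ < ∣ VS Y ∣
      sparse {Y} Y⊆Z ne e∈Z e∉Y = ≰⇒> (λ le → e∉Y (min Y Y⊆Z (ne , le) e∈Z))
      conn : ∀ X Y → Z ≐ X ⊔ Y → Nonempty X → Nonempty Y → VertexDisjoint G X Y → ⊥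
      conn X Y p (x , x∈) (y , y∈) vd = <-irrefl refl (begin-strict
        ∣ Z ∣               ≡⟨ card-split p ⟩
        ∣ X ∣ + ∣ Y ∣       <⟨ +-mono-< (sparse {X} (inˡ p) (x , x∈) (inʳ p y∈) (λ z → dis p z y∈))
                                        (sparse {Y} (inʳ p) (y , y∈) (inˡ p x∈) (λ z → dis p x∈ z)) ⟩
        ∣ VS X ∣ + ∣ VS Y ∣ ≡⟨ sym (card-split (VS-split p vd)) ⟩
        ∣ VS Z ∣            ≤⟨ dense ⟩
        ∣ Z ∣               ∎)
        where open ≤-Reasoning
      deg≥2 : ∀ {v} → v ∈ VS Z → 2 ≤ d Z v
      deg≥2 {v} v∈ = d≥2 {Z} (outVS {Z} v∈) leaf
        where
        leaf : d Z v ≢ 1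
        leaf d1 with outVS {Z} v∈
        ... | e , e∈Z , i with nonempty? (Z - e)
        ...   | yes ne = -≢ {p = Z} (min (Z - e) (-ˡ {p = Z}) (ne , ≤-pred (begin
          suc ∣ VS (Z - e) ∣  ≤⟨ VS-drop {Z} e∈Z i d1 ⟩
          ∣ VS Z ∣            ≤⟨ dense ⟩
          ∣ Z ∣               ≡⟨ card-remove e∈Z ⟩
          suc ∣ Z - e ∣       ∎)) e∈Z) refl
          where open ≤-Reasoning
        -- Here `e` is the only edge, and degree one makes it a non-loop, so there are two vertices
        -- against one edge.
        ...   | no ¬ne with other-end (λ l → <⇒≢ (≤-trans (≤-reflexive (sym (inc-loop l i))) (d-elem {Z} e∈Z v)) (sym d1)) i
        ...     | w , w≢v , j = <-irrefl refl (begin-strict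
          ∣ Z ∣               ≡⟨ card-remove e∈Z ⟩
          suc ∣ Z - e ∣       ≡⟨ cong suc (trans (cong ∣_∣ (Empty-unique ¬ne)) (∣⊥∣≡0 m)) ⟩
          1                   <⟨ card-two (inVS {Z} (e , e∈Z , j)) v∈ w≢v ⟩
          ∣ VS Z ∣            ≤⟨ dense ⟩
          ∣ Z ∣               ∎)
          where open ≤-Reasoning
      total : wsum (VS Z) (d Z) ≤ 2 * ∣ VS Z ∣
      total = ≤-trans (≤-reflexive (handshake Z)) (*-monoʳ-≤ 2 le)
        where
        le : ∣ Z ∣ ≤ ∣ VS Z ∣
        le with nonempty? (Z - f)
        ... | yes ne = ≤-trans (≤-reflexive (card-remove f∈Z))
              (≤-trans (sparse {Z - f} (-ˡ {p = Z}) ne f∈Z (λ q → -≢ {p = Z} q refl)) (p⊆q⇒∣p∣≤∣q∣ (VS-mono (-ˡ {p = Z}))))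
        ... | no ¬ne = ≤-trans (≤-reflexive (trans (card-remove f∈Z)
              (cong suc (trans (cong ∣_∣ (Empty-unique ¬ne)) (∣⊥∣≡0 m))))) (card-pos (inVS {Z} (f , f∈Z , inj₁ refl)))

  abstract
    -- Finds cycles in theta graphs, in independent sets and in a cycle with a chord by counting
    -- alone: a minimal dense subset is the cycle.
    hasCycle : ∀ {Z} → Nonempty Z → ∣ VS Z ∣ ≤ ∣ Z ∣ → ∃[ C ] (C ⊆ Z × Cycle C)
    hasCycle {Z} ne le with minimalSubset Dense? Z (ne , le)
    ... | C , C⊆Z , dense , min = C , C⊆Z , minimal-cycle dense min

  double-odd : ∀ a b → 2 * a ≢ 1 + 2 * b
  double-odd zero b ()
  double-odd (suc a) zero eq = helper a eq
    where
    helper : ∀ a → 2 * suc a ≢ 1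
    helper a eq rewrite +-suc a (a + 0) with eq
    ... | ()
  double-odd (suc a) (suc b) eq = double-odd a b (+-cancelˡ-≡ 2 _ _ (trans
    (trans (sym (*-distribˡ-+ 2 1 a)) eq) (cong suc (*-distribˡ-+ 2 1 b))))

  -- Only one end of `f` lies in `Y`, so the degrees in `T` over the vertices of `Y` add up to 1
  -- plus the degree sum of `Y` itself. That is odd, while each of these degrees is two.
  oddCut : ∀ {T f X Y} → f ∈ T → (T - f) ≐ X ⊔ Y → VertexDisjoint G X Y → (∀ {v} → V Y v → d T v ≡ 2) →
    ∀ {z} → V Y z → Inc G f z → ¬ IsLoop G f → (∀ {v} → Inc G f v → V Y v → v ≡ z) → ⊥
  oddCut {T} {f} {X} {Y} f∈T p vd even {z} yz fz ¬l only = double-odd ∣ VS Y ∣ ∣ Y ∣ (begin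
    2 * ∣ VS Y ∣                                ≡⟨ sym (wsum-const (VS Y) 2) ⟩
    wsum (VS Y) (λ _ → 2)                       ≡⟨ wsum-cong {X = VS Y} pt ⟩
    wsum (VS Y) (λ v → inc f v + d Y v)         ≡⟨ wsum-+ {X = VS Y} (inc f) (d Y) ⟩
    wsum (VS Y) (inc f) + wsum (VS Y) (d Y)     ≡⟨ cong₂ _+_ one (handshake Y) ⟩
    1 + 2 * ∣ Y ∣                               ∎)
    where
    open ≡-Reasoning
    pt : ∀ {v} → v ∈ VS Y → 2 ≡ inc f v + d Y v
    pt {v} v∈ = trans (sym (even (outVS {Y} v∈))) (trans (d-remove {T} f∈T v)
      (cong (inc f v +_) (sym (d-part (part-swap p) (λ vx → vd v (vx , outVS {Y} v∈))))))
    one : wsum (VS Y) (inc f) ≡ 1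
    one = trans (wsum-remove {X = VS Y} (inVS {Y} yz) (inc f)) (cong₂ _+_ (inc-nonloop ¬l fz)
      (trans (wsum-cong {X = VS Y - z} (λ v∈ → inc-zero (λ i → -≢ {p = VS Y} v∈ (only i (outVS {Y} (-ˡ {p = VS Y} v∈))))))
        (wsum-const (VS Y - z) 0)))

  -- By parity, deleting one edge cannot separate off a part all of whose vertices have degree two.
  evenCut : ∀ {T f X Y} → EConn T → f ∈ T → (T - f) ≐ X ⊔ Y → Nonempty X → Nonempty Y → VertexDisjoint G X Y →
    (∀ {v} → V Y v → d T v ≡ 2) → ⊥
  evenCut {T} {f} {X} {Y} ec f∈T p (x , x∈) (y , y∈) vd even with V? Y (src G f) | V? Y (tgt G f)
  ... | yes s | yes t = sep (share {T} {X} {Y ∪ ⁅ f ⁆} ec part (x , x∈) (y , ∈∪ˡ y∈))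
    where
    part : T ≐ X ⊔ (Y ∪ ⁅ f ⁆)
    part = record
      { inˡ = -ˡ {p = T} ∘ inˡ p
      ; inʳ = ∪-lub {p = Y} (-ˡ {p = T} ∘ inʳ p) (λ e∈ → subst (_∈ T) (sym (sing≡ e∈)) f∈T)
      ; cov = λ {e} e∈ → cv e∈ (e ≟ f)
      ; dis = λ e∈X e∈ → [ dis p e∈X , (λ e∈f → -≢ {p = T} (inˡ p e∈X) (sing≡ e∈f)) ]′ (∪-case e∈) }
      where
      cv : ∀ {e} → e ∈ T → Dec (e ≡ f) → e ∈ X ⊎ e ∈ Y ∪ ⁅ f ⁆
      cv e∈ (yes refl) = inj₂ (∈∪ʳ (x∈⁅x⁆ _))
      cv e∈ (no e≢f) = [ inj₁ , inj₂ ∘ ∈∪ˡ ]′ (cov p (∈- e∈ e≢f))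
    sep : ¬ (∃[ v ] (V X v × V (Y ∪ ⁅ f ⁆) v))
    sep (v , vx , vy) with V-∪ {Y} vy
    ... | inj₁ vy′ = vd v (vx , vy′)
    ... | inj₂ vf with V-sing vf
    ...   | inj₁ refl = vd v (vx , s)
    ...   | inj₂ refl = vd v (vx , t)
  ... | no ¬s | no ¬t = sep (share {T} {X ∪ ⁅ f ⁆} {Y} ec part (x , ∈∪ˡ x∈) (y , y∈))
    where
    part : T ≐ (X ∪ ⁅ f ⁆) ⊔ Y
    part = record
      { inˡ = ∪-lub {p = X} (-ˡ {p = T} ∘ inˡ p) (λ e∈ → subst (_∈ T) (sym (sing≡ e∈)) f∈T)
      ; inʳ = -ˡ {p = T} ∘ inʳ p
      ; cov = λ {e} e∈ → cv e∈ (e ≟ f)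
      ; dis = λ e∈ e∈Y → [ (λ e∈X → dis p e∈X e∈Y) , (λ e∈f → -≢ {p = T} (inʳ p e∈Y) (sing≡ e∈f)) ]′ (∪-case e∈) }
      where
      cv : ∀ {e} → e ∈ T → Dec (e ≡ f) → e ∈ X ∪ ⁅ f ⁆ ⊎ e ∈ Y
      cv e∈ (yes refl) = inj₁ (∈∪ʳ (x∈⁅x⁆ _))
      cv e∈ (no e≢f) = [ inj₁ ∘ ∈∪ˡ , inj₂ ]′ (cov p (∈- e∈ e≢f))
    sep : ¬ (∃[ v ] (V (X ∪ ⁅ f ⁆) v × V Y v))
    sep (v , vx , vy) with V-∪ {X} vx
    ... | inj₁ vx′ = vd v (vx′ , vy)
    ... | inj₂ vf with V-sing vf
    ...   | inj₁ refl = ¬s vy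
    ...   | inj₂ refl = ¬t vy
  ... | yes s | no ¬t = oddCut f∈T p vd even s (inj₁ refl) (λ l → ¬t (subst (V Y) l s))
    (λ { (inj₁ refl) _ → refl ; (inj₂ refl) vy → ⊥-elim (¬t vy) })
  ... | no ¬s | yes t = oddCut f∈T p vd even t (inj₂ refl) (λ l → ¬s (subst (V Y) (sym l) t))
    (λ { (inj₂ refl) _ → refl ; (inj₁ refl) vy → ⊥-elim (¬s vy) })

-- Circuits of the matroid, and the bound on independent sets.

module Circuits {n m : ℕ} (G : Graph n m) (lab : Subset m → Label) where
  open EdgeSets G public

  _≟ᴸ_ : (a b : Label) → Dec (a ≡ b)
  bal ≟ᴸ bal = yes refl
  bal ≟ᴸ lin = no λ ()
  bal ≟ᴸ fre = no λ ()
  lin ≟ᴸ bal = no λ ()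
  lin ≟ᴸ lin = yes refl
  lin ≟ᴸ fre = no λ ()
  fre ≟ᴸ bal = no λ ()
  fre ≟ᴸ lin = no λ ()
  fre ≟ᴸ fre = yes refl

  Unb : Subset m → Set
  Unb C = Cycle C × lab C ≢ bal

  Unb? : ∀ C → Dec (Unb C)
  Unb? C = Cycle? C ×-dec ¬? (lab C ≟ᴸ bal)

  Circuit : Subset m → Set
  Circuit = MCircuit G lab

  -- Independence in the matroid on all edges; not to be confused with the label `fre`.
  Free : Subset m → Set
  Free I = ∀ D → Circuit D → ¬ (D ⊆ I)

  abstract
    IsTheta? : ∀ T → Dec (IsTheta G T)
    IsTheta? T = EConn? T ×-dec (all? (λ e → (e ∈? T) →-dec EConn? (T - e)) ×-dec
      any? (λ u → any? (λ w → ¬? (u ≟ w) ×-dec ((d T u Data.Nat.≟ 3) ×-dec ((d T w Data.Nat.≟ 3) ×-dec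
        all? (λ v → V? T v →-dec (¬? (v ≟ u) →-dec (¬? (v ≟ w) →-dec (d T v Data.Nat.≟ 2)))))))))

  abstract
    IsPath? : ∀ P u v → Dec (IsPath G P u v)
    IsPath? P u v = ¬? (u ≟ v) ×-dec (EConn? P ×-dec ((d P u Data.Nat.≟ 1) ×-dec ((d P v Data.Nat.≟ 1) ×-dec
      all? (λ w → V? P w →-dec (¬? (w ≟ u) →-dec (¬? (w ≟ v) →-dec (d P w Data.Nat.≟ 2)))))))

  VertexDisjoint? : ∀ X Y → Dec (VertexDisjoint G X Y)
  VertexDisjoint? X Y = all? (λ v → ¬? (V? X v ×-dec V? Y v))

  TightHandcuff? : ∀ C₁ C₂ → Dec (TightHandcuff G C₁ C₂)
  TightHandcuff? C₁ C₂ = Cycle? C₁ ×-dec (Cycle? C₂ ×-dec (all? (λ e → ¬? ((e ∈? C₁) ×-dec (e ∈? C₂))) ×-dec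
    any? (λ v → V? C₁ v ×-dec (V? C₂ v ×-dec all? (λ w → V? C₁ w →-dec (V? C₂ w →-dec (w ≟ v)))))))

  LooseHandcuff? : ∀ C₁ C₂ P → Dec (LooseHandcuff G C₁ C₂ P)
  LooseHandcuff? C₁ C₂ P = Cycle? C₁ ×-dec (Cycle? C₂ ×-dec (VertexDisjoint? C₁ C₂ ×-dec
    any? (λ u → any? (λ v → IsPath? P u v ×-dec (V? C₁ u ×-dec (V? C₂ v ×-dec
      (all? (λ w → V? P w →-dec (V? C₁ w →-dec (w ≟ u))) ×-dec
       all? (λ w → V? P w →-dec (V? C₂ w →-dec (w ≟ v))))))))))

  private
    -- `Circuit` with the equation for its index made explicit, which turns each constructor into a
    -- finite search over subsets.
    Cases : Subset m → Set
    Cases X = (Cycle X × lab X ≡ bal)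
      ⊎ (IsTheta G X × (∀ C → Cycle C → C ⊆ X → ¬ (lab C ≡ bal)))
      ⊎ (∃[ C₁ ] ∃[ C₂ ] (X ≡ C₁ ∪ C₂ × TightHandcuff G C₁ C₂ × ¬ (lab C₁ ≡ bal) × ¬ (lab C₂ ≡ bal)))
      ⊎ (∃[ C₁ ] ∃[ C₂ ] (X ≡ C₁ ∪ C₂ × Cycle C₁ × Cycle C₂ × VertexDisjoint G C₁ C₂ × lab C₁ ≡ lin × lab C₂ ≡ lin))
      ⊎ (∃[ C₁ ] ∃[ C₂ ] ∃[ P ] (X ≡ C₁ ∪ C₂ ∪ P × LooseHandcuff G C₁ C₂ P × lab C₁ ≡ fre × lab C₂ ≡ fre))

    Cases? : ∀ X → Dec (Cases X)
    Cases? X = (Cycle? X ×-dec (lab X ≟ᴸ bal))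
      ⊎-dec ((IsTheta? X ×-dec allSubset? (λ C → Cycle? C →-dec ((C ⊆? X) →-dec ¬? (lab C ≟ᴸ bal))))
      ⊎-dec ((anySubset? λ C₁ → anySubset? λ C₂ → (X ≟ˢ C₁ ∪ C₂) ×-dec (TightHandcuff? C₁ C₂ ×-dec
               (¬? (lab C₁ ≟ᴸ bal) ×-dec ¬? (lab C₂ ≟ᴸ bal))))
      ⊎-dec ((anySubset? λ C₁ → anySubset? λ C₂ → (X ≟ˢ C₁ ∪ C₂) ×-dec (Cycle? C₁ ×-dec (Cycle? C₂ ×-dec
               (VertexDisjoint? C₁ C₂ ×-dec ((lab C₁ ≟ᴸ lin) ×-dec (lab C₂ ≟ᴸ lin))))))
      ⊎-dec (anySubset? λ C₁ → anySubset? λ C₂ → anySubset? λ P → (X ≟ˢ C₁ ∪ C₂ ∪ P) ×-dec (LooseHandcuff? C₁ C₂ P ×-dec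
               ((lab C₁ ≟ᴸ fre) ×-dec (lab C₂ ≟ᴸ fre)))))))

    to : ∀ {X} → Cases X → Circuit X
    to (inj₁ (c , l)) = balCycle _ c l
    to (inj₂ (inj₁ (t , h))) = theta _ t h
    to (inj₂ (inj₂ (inj₁ (C₁ , C₂ , refl , t , l₁ , l₂)))) = tight C₁ C₂ t l₁ l₂
    to (inj₂ (inj₂ (inj₂ (inj₁ (C₁ , C₂ , refl , c₁ , c₂ , vd , l₁ , l₂))))) = linPair C₁ C₂ c₁ c₂ vd l₁ l₂
    to (inj₂ (inj₂ (inj₂ (inj₂ (C₁ , C₂ , P , refl , h , l₁ , l₂))))) = loose C₁ C₂ P h l₁ l₂

    from : ∀ {X} → Circuit X → Cases X
    from (balCycle _ c l) = inj₁ (c , l)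
    from (theta _ t h) = inj₂ (inj₁ (t , h))
    from (tight C₁ C₂ t l₁ l₂) = inj₂ (inj₂ (inj₁ (C₁ , C₂ , refl , t , l₁ , l₂)))
    from (linPair C₁ C₂ c₁ c₂ vd l₁ l₂) = inj₂ (inj₂ (inj₂ (inj₁ (C₁ , C₂ , refl , c₁ , c₂ , vd , l₁ , l₂))))
    from (loose C₁ C₂ P h l₁ l₂) = inj₂ (inj₂ (inj₂ (inj₂ (C₁ , C₂ , P , refl , h , l₁ , l₂))))

  abstract
    Circuit? : ∀ X → Dec (Circuit X)
    Circuit? X = map′ to from (Cases? X)

  abstract
    Free? : ∀ I → Dec (Free I)
    Free? I = allSubset? (λ D → Circuit? D →-dec ¬? (D ⊆? I))

  free-cycle-unb : ∀ {I C} → Free I → C ⊆ I → Cycle C → lab C ≢ bal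
  free-cycle-unb free C⊆I c l = free _ (balCycle _ c l) C⊆I

  -- A minimal edge set with more edges than vertices is a theta graph or a handcuff.

  module _ (qb : QuasiBiased G lab) where

    private
      Over : Subset m → Set
      Over Z = ∣ VS Z ∣ < ∣ Z ∣

    module Minimal {I : Subset m} (free : Free I) (over : Over I)
                   (min : ∀ Y → Y ⊆ I → Over Y → I ⊆ Y) where

      sparse : ∀ {Y e} → Y ⊆ I → e ∈ I → e ∉ Y → ∣ Y ∣ ≤ ∣ VS Y ∣
      sparse {Y} Y⊆I e∈I e∉Y = ≮⇒≥ (λ o → e∉Y (min Y Y⊆I o e∈I))

      conn : EConn I
      conn = mkConn λ X Y p (x , x∈) (y , y∈) vd → <⇒≱ over (begin
        ∣ I ∣               ≡⟨ card-split p ⟩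
        ∣ X ∣ + ∣ Y ∣       ≤⟨ +-mono-≤ (sparse {X} (inˡ p) (inʳ p y∈) (λ z → dis p z y∈))
                                        (sparse {Y} (inʳ p) (inˡ p x∈) (dis p x∈)) ⟩
        ∣ VS X ∣ + ∣ VS Y ∣ ≡⟨ sym (card-split (VS-split p vd)) ⟩
        ∣ VS I ∣            ∎)
        where open ≤-Reasoning

      deg≥2 : ∀ {v} → v ∈ VS I → 2 ≤ d I v
      deg≥2 {v} v∈ = d≥2 {I} (outVS {I} v∈) leaf
        where
        leaf : d I v ≢ 1
        leaf d1 with outVS {I} v∈
        ... | e , e∈I , i = <⇒≱ over (begin
          ∣ I ∣               ≡⟨ card-remove e∈I ⟩
          suc ∣ I - e ∣       ≤⟨ s≤s (sparse {I - e} (-ˡ {p = I}) e∈I (λ q → -≢ {p = I} q refl)) ⟩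
          suc ∣ VS (I - e) ∣  ≤⟨ VS-drop {I} e∈I i d1 ⟩
          ∣ VS I ∣            ∎)
          where open ≤-Reasoning

      someEdge : Nonempty I
      someEdge = card-elem (≤-trans (s≤s z≤n) over)

      -- Deleting one edge leaves a set with at most as many edges as vertices, so the excess is
      -- exactly one and the degree sum is 2|V| + 2.
      size : ∣ I ∣ ≡ suc ∣ VS I ∣
      size = ≤-antisym (begin
        ∣ I ∣              ≡⟨ card-remove (proj₂ someEdge) ⟩
        suc ∣ I - e ∣      ≤⟨ s≤s (sparse {I - e} (-ˡ {p = I}) (proj₂ someEdge) (λ q → -≢ {p = I} q refl)) ⟩
        suc ∣ VS (I - e) ∣ ≤⟨ s≤s (p⊆q⇒∣p∣≤∣q∣ (VS-mono (-ˡ {p = I}))) ⟩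
        suc ∣ VS I ∣       ∎) over
        where
        open ≤-Reasoning
        e = proj₁ someEdge

      shape : Excess2 (VS I) (d I)
      shape = excess2 deg≥2 (trans (handshake I) (trans (cong (2 *_) size)
        (solve 1 (λ s → con 2 :* (con 1 :+ s) := con 2 :* s :+ con 2) refl ∣ VS I ∣)))
        where open +-*-Solver

      cyc : ∃[ C ] (C ⊆ I × Cycle C)
      cyc = hasCycle someEdge (<⇒≤ over)

      crossing : ∀ {X Y v} → I ≐ X ⊔ Y → Cycle X → V X v → V Y v → 3 ≤ d I v
      crossing {X} {Y} {v} p (_ , _ , d2) vx vy = begin
        2 + 1          ≤⟨ +-mono-≤ (≤-reflexive (sym (d2 v vx))) (d-pos {Y} vy) ⟩
        d X v + d Y v  ≡⟨ sym (d-split p v) ⟩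
        d I v          ∎
        where open ≤-Reasoning

      rest-nonempty : ∀ {C} → C ⊆ I → Cycle C → Nonempty (I ─ C)
      rest-nonempty {C} C⊆I c with nonempty? (I ─ C)
      ... | yes ne = ne
      ... | no ¬ne = ⊥-elim (<⇒≢ over (sym (subst (λ Z → ∣ Z ∣ ≡ ∣ VS Z ∣) C≡I (cycle-card c))))
        where
        C≡I : C ≡ I
        C≡I = ⊆-antisym C⊆I (λ {e} e∈ → decidable-stable (e ∈? C) (λ e∉ → ¬ne (e , ∈─ e∈ e∉)))

      -- The cycle `C` can be left only at `w`, since leaving takes degree three. The other edges
      -- then have degree two everywhere and hang together through `w`, so they form a second cycle
      -- and `I` contains a tight handcuff.
      one4⇒⊥ : ∀ C → C ⊆ I → Cycle C → ∀ w → d I w ≡ 4 → (∀ {x} → x ∈ VS I → x ≢ w → d I x ≡ 2) → ⊥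
      one4⇒⊥ C C⊆I c w dw d2 = free (C ∪ Y) (tight C Y (c , cy , (λ e (p , q) → dis part p q) , w , wC , wY ,
              λ x xc xy → only xc xy) (free-cycle-unb free C⊆I c) (free-cycle-unb free Y⊆I cy))
            (∪-lub {p = C} C⊆I Y⊆I)
        where
        Y = I ─ C
        Y⊆I : Y ⊆ I
        Y⊆I = ─ˡ {p = I}
        part : I ≐ C ⊔ Y
        part = part-─ C⊆I
        only : ∀ {x} → V C x → V Y x → x ≡ w
        only {x} xc xy = decidable-stable (x ≟ w) (λ x≢w →
          <⇒≢ (crossing part c xc xy) (sym (d2 (inVS {I} (V-mono C⊆I xc)) x≢w)))
        shared : ∃[ v ] (V C v × V Y v)
        shared = share conn part (proj₁ c) (rest-nonempty C⊆I c)
        wC : V C w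
        wC = subst (V C) (only (proj₁ (proj₂ shared)) (proj₂ (proj₂ shared))) (proj₁ (proj₂ shared))
        wY : V Y w
        wY = subst (V Y) (only (proj₁ (proj₂ shared)) (proj₂ (proj₂ shared))) (proj₂ (proj₂ shared))
        degY : ∀ v → V Y v → d Y v ≡ 2
        degY v vy with v ≟ w
        ... | yes refl = +-cancelˡ-≡ 2 _ _ (trans (cong (_+ d Y w) (sym (proj₂ (proj₂ c) w wC)))
              (trans (sym (d-split part w)) dw))
        ... | no v≢w = trans (d-part (part-swap part) (λ vc → v≢w (only vc vy))) (d2 (inVS {I} (V-mono Y⊆I vy)) v≢w)
        cy : Cycle Y
        cy = rest-nonempty C⊆I c , mkConn (λ A B p na nb vd → case A B p na nb vd (V? A w)) , degY
          where
          -- A part avoiding `w` would be separated in `I` from all other edges.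
          noW : ∀ A B → Y ≐ A ⊔ B → Nonempty A → Nonempty B → VertexDisjoint G A B → ¬ V A w → ⊥
          noW A B p na (b , b∈) vd ¬aw with share {I} {A} {I ─ A} conn (part-─ (Y⊆I ∘ inˡ p)) na
                (b , ∈─ (Y⊆I (inʳ p b∈)) (λ a → dis p a b∈))
          ... | v , va , (e , e∈ , i) with cov part (─ˡ {p = I} e∈)
          ...   | inj₁ e∈C = ¬aw (subst (V A) (only (e , e∈C , i) (V-mono (inˡ p) va)) va)
          ...   | inj₂ e∈Y = [ ─ʳ {p = I} e∈ , (λ e∈B → vd v (va , e , e∈B , i)) ]′ (cov p e∈Y)
          case : ∀ A B → Y ≐ A ⊔ B → Nonempty A → Nonempty B → VertexDisjoint G A B → Dec (V A w) → ⊥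
          case A B p na nb vd (no ¬aw) = noW A B p na nb vd ¬aw
          case A B p na nb vd (yes aw) = noW B A (part-swap p) nb na (vd-sym {A} {B} vd) (λ bw → vd w (aw , bw))

      -- The edges outside both cycles form a path from `u` to `w`. Whatever the labels, a circuit
      -- appears: a balanced cycle, a linear pair or a loose handcuff; one linear and one free cycle
      -- would have to meet.
      handcuff⇒⊥ : ∀ C₁ C₂ → C₁ ⊆ I → C₂ ⊆ I → Cycle C₁ → Cycle C₂ → VertexDisjoint G C₁ C₂ →
        ∀ u w → u ≢ w → d I u ≡ 3 → d I w ≡ 3 → (∀ {x} → x ∈ VS I → x ≢ u → x ≢ w → d I x ≡ 2) → V C₁ u → V C₂ w → ⊥
      handcuff⇒⊥ C₁ C₂ C₁⊆I C₂⊆I c₁ c₂ vd u w u≢w du dw d2 uC₁ wC₂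
        = case (lab C₁) (lab C₂) refl refl
        where
        R P : Subset m
        R = I ─ C₁
        P = R ─ C₂
        C₂⊆R : C₂ ⊆ R
        C₂⊆R {e} e∈ = ∈─ (C₂⊆I e∈) (λ e∈₁ → vd (src G e) ((e , e∈₁ , inj₁ refl) , (e , e∈ , inj₁ refl)))
        part₁ : I ≐ C₁ ⊔ R
        part₁ = part-─ C₁⊆I
        part₂ : R ≐ C₂ ⊔ P
        part₂ = part-─ C₂⊆R
        P⊆I : P ⊆ I
        P⊆I = ─ˡ {p = I} ∘ ─ˡ {p = R}
        dsum : ∀ v → d I v ≡ d C₁ v + (d C₂ v + d P v)
        dsum v = trans (d-split part₁ v) (cong (d C₁ v +_) (d-split part₂ v))
        only₁ : ∀ {x} → V C₁ x → V P x → x ≡ u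
        only₁ {x} xc xp with x ≟ u | x ≟ w
        ... | yes eq | _ = eq
        ... | no _ | yes refl = ⊥-elim (vd x (xc , wC₂))
        ... | no x≢u | no x≢w = ⊥-elim (<⇒≢ (crossing part₁ c₁ xc (V-mono (inʳ part₂) xp)) (sym (d2 (inVS {I} (V-mono C₁⊆I xc)) x≢u x≢w)))
        only₂ : ∀ {x} → V C₂ x → V P x → x ≡ w
        only₂ {x} xc xp with x ≟ u | x ≟ w
        ... | _ | yes eq = eq
        ... | yes refl | no _ = ⊥-elim (vd x (uC₁ , xc))
        ... | no x≢u | no x≢w = ⊥-elim (<⇒≢ (begin
            2 + 1                      ≤⟨ +-mono-≤ (≤-reflexive (sym (proj₂ (proj₂ c₂) x xc))) (d-pos {P} xp) ⟩
            d C₂ x + d P x             ≤⟨ m≤n+m _ (d C₁ x) ⟩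
            d C₁ x + (d C₂ x + d P x)  ≡⟨ sym (dsum x) ⟩
            d I x                      ∎) (sym (d2 (inVS {I} (V-mono C₂⊆I xc)) x≢u x≢w)))
          where open ≤-Reasoning
        dPu : d P u ≡ 1
        dPu = +-cancelˡ-≡ 2 _ _ (trans (cong₂ _+_ (sym (proj₂ (proj₂ c₁) u uC₁))
          (cong (_+ d P u) (sym (d-zero {C₂} (λ uc → vd u (uC₁ , uc)))))) (trans (sym (dsum u)) du))
        dPw : d P w ≡ 1
        dPw = +-cancelˡ-≡ 2 _ _ (trans (cong (_+ d P w) (sym (proj₂ (proj₂ c₂) w wC₂)))
          (trans (cong (_+ (d C₂ w + d P w)) (sym (d-zero {C₁} (λ wc → vd w (wc , wC₂))))) (trans (sym (dsum w)) dw)))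
        dP2 : ∀ v → V P v → v ≢ u → v ≢ w → d P v ≡ 2
        dP2 v vp v≢u v≢w = trans (trans (d-part (part-swap part₂) (λ vc → v≢w (only₂ vc vp)))
          (d-part (part-swap part₁) (λ vc → v≢u (only₁ vc vp)))) (d2 (inVS {I} (V-mono P⊆I vp)) v≢u v≢w)
        meets : ∀ A B → P ≐ A ⊔ B → Nonempty A → Nonempty B → VertexDisjoint G A B → ¬ V A u → ¬ V A w → ⊥
        meets A B p na (b , b∈) vd′ ¬u ¬w with share {I} {A} {I ─ A} conn (part-─ (P⊆I ∘ inˡ p)) na
              (b , ∈─ (P⊆I (inʳ p b∈)) (λ a → dis p a b∈))
        ... | v , va , (e , e∈ , i) with cov part₁ (─ˡ {p = I} e∈)
        ...   | inj₁ e∈C₁ = ¬u (subst (V A) (only₁ (e , e∈C₁ , i) (V-mono (inˡ p) va)) va)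
        ...   | inj₂ e∈R with cov part₂ e∈R
        ...     | inj₁ e∈C₂ = ¬w (subst (V A) (only₂ (e , e∈C₂ , i) (V-mono (inˡ p) va)) va)
        ...     | inj₂ e∈P = [ ─ʳ {p = I} e∈ , (λ e∈B → vd′ v (va , e , e∈B , i)) ]′ (cov p e∈P)
        -- Adding each cycle to the part at its own end would disconnect `I`.
        apart : ∀ A B → P ≐ A ⊔ B → VertexDisjoint G A B → V A u → V B w → ⊥
        apart A B p vd′ au bw with share {I} {C₁ ∪ A} {C₂ ∪ B} conn part
                (let (e , e∈ , _) = uC₁ in e , ∈∪ˡ e∈) (let (e , e∈ , _) = wC₂ in e , ∈∪ˡ e∈)
          where
          part : I ≐ (C₁ ∪ A) ⊔ (C₂ ∪ B)
          part = record
            { inˡ = ∪-lub {p = C₁} C₁⊆I (P⊆I ∘ inˡ p)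
            ; inʳ = ∪-lub {p = C₂} C₂⊆I (P⊆I ∘ inʳ p)
            ; cov = λ e∈ → [ inj₁ ∘ ∈∪ˡ , (λ r → [ inj₂ ∘ ∈∪ˡ , (λ q → [ inj₁ ∘ ∈∪ʳ , inj₂ ∘ ∈∪ʳ ]′ (cov p q)) ]′ (cov part₂ r)) ]′ (cov part₁ e∈)
            ; dis = λ x y → dd (∪-case {p = C₁} x) (∪-case {p = C₂} y) }
            where
            dd : ∀ {e} → e ∈ C₁ ⊎ e ∈ A → e ∈ C₂ ⊎ e ∈ B → ⊥
            dd (inj₁ x) (inj₁ y) = dis part₁ x (C₂⊆R y)
            dd (inj₁ x) (inj₂ y) = dis part₁ x (inʳ part₂ (inʳ p y))
            dd (inj₂ x) (inj₁ y) = dis part₂ y (inˡ p x)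
            dd (inj₂ x) (inj₂ y) = dis p x y
        ... | v , vx , vy with V-∪ {C₁} vx | V-∪ {C₂} vy
        ...   | inj₁ x | inj₁ y = vd v (x , y)
        ...   | inj₁ x | inj₂ y = vd′ v (subst (V A) (sym (only₁ x (V-mono (inʳ p) y))) au , y)
        ...   | inj₂ x | inj₁ y = vd′ v (x , subst (V B) (sym (only₂ y (V-mono (inˡ p) x))) bw)
        ...   | inj₂ x | inj₂ y = vd′ v (x , y)
        connP : EConn P
        connP = mkConn λ A B p na nb vd′ → go A B p na nb vd′ (V? A u) (V? A w) (V? B u) (V? B w)
          where
          go : ∀ A B → P ≐ A ⊔ B → Nonempty A → Nonempty B → VertexDisjoint G A B →
            Dec (V A u) → Dec (V A w) → Dec (V B u) → Dec (V B w) → ⊥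
          go A B p na nb vd′ (no a) (no b) _ _ = meets A B p na nb vd′ a b
          go A B p na nb vd′ _ _ (no a) (no b) = meets B A (part-swap p) nb na (vd-sym {A} {B} vd′) a b
          go A B p na nb vd′ (yes a) _ (yes b) _ = vd′ u (a , b)
          go A B p na nb vd′ _ (yes a) _ (yes b) = vd′ w (a , b)
          go A B p na nb vd′ (yes a) _ _ (yes b) = apart A B p vd′ a b
          go A B p na nb vd′ _ (yes a) (yes b) _ = apart B A (part-swap p) (vd-sym {A} {B} vd′) b a
        path : IsPath G P u w
        path = u≢w , connP , dPu , dPw , dP2
        case : ∀ a b → lab C₁ ≡ a → lab C₂ ≡ b → ⊥
        case bal _ l₁ l₂ = free C₁ (balCycle C₁ c₁ l₁) C₁⊆I
        case lin bal l₁ l₂ = free C₂ (balCycle C₂ c₂ l₂) C₂⊆I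
        case fre bal l₁ l₂ = free C₂ (balCycle C₂ c₂ l₂) C₂⊆I
        case lin lin l₁ l₂ = free _ (linPair C₁ C₂ c₁ c₂ vd l₁ l₂) (∪-lub {p = C₁} C₁⊆I C₂⊆I)
        case lin fre l₁ l₂ = let (v , p) = proj₂ qb C₁ C₂ c₁ c₂ l₁ l₂ in vd v p
        case fre lin l₁ l₂ = let (v , p , q) = proj₂ qb C₂ C₁ c₂ c₁ l₂ l₁ in vd v (q , p)
        case fre fre l₁ l₂ = free _ (loose C₁ C₂ P (c₁ , c₂ , vd , u , w , path , uC₁ , wC₂ ,
            (λ x xp xc → only₁ xc xp) , (λ x xp xc → only₂ xc xp)) l₁ l₂)
          (∪-lub {p = C₁} C₁⊆I (∪-lub {p = C₂} C₂⊆I P⊆I))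

      module _ (u w : Fin n) (u≢w : u ≢ w) (du : d I u ≡ 3) (dw : d I w ≡ 3)
               (d2 : ∀ {x} → x ∈ VS I → x ≢ u → x ≢ w → d I x ≡ 2) where

        -- `I` is connected and larger than `C`, so some vertex of `C` carries a further edge and
        -- has degree at least three.
        exit : ∀ {C} → C ⊆ I → Cycle C → V C u ⊎ V C w
        exit {C} C⊆I c = at (share conn (part-─ C⊆I) (proj₁ c) (rest-nonempty C⊆I c))
          where
          at : ∃[ x ] (V C x × V (I ─ C) x) → V C u ⊎ V C w
          at (x , xc , xr) with x ≟ u | x ≟ w
          ... | yes x≡u | _ = inj₁ (subst (V C) x≡u xc)
          ... | no _ | yes x≡w = inj₂ (subst (V C) x≡w xc)
          ... | no x≢u | no x≢w =
            ⊥-elim (<⇒≢ (crossing (part-─ C⊆I) c xc xr) (sym (d2 (inVS {I} (V-mono C⊆I xc)) x≢u x≢w)))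

        arrange : ∀ {C₁ C₂} → C₁ ⊆ I → C₂ ⊆ I → Cycle C₁ → Cycle C₂ → VertexDisjoint G C₁ C₂ →
          V C₁ u ⊎ V C₁ w → V C₂ u ⊎ V C₂ w → ⊥
        arrange s₁ s₂ c₁ c₂ vd (inj₁ a) (inj₁ b) = vd u (a , b)
        arrange s₁ s₂ c₁ c₂ vd (inj₂ a) (inj₂ b) = vd w (a , b)
        arrange {C₁} {C₂} s₁ s₂ c₁ c₂ vd (inj₁ a) (inj₂ b) = handcuff⇒⊥ C₁ C₂ s₁ s₂ c₁ c₂ vd u w u≢w du dw d2 a b
        arrange {C₁} {C₂} s₁ s₂ c₁ c₂ vd (inj₂ a) (inj₁ b) =
          handcuff⇒⊥ C₁ C₂ s₁ s₂ c₁ c₂ vd w u (u≢w ∘ sym) dw du (λ x q r → d2 x r q) a b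

      -- Without `e`, the two parts together have at least as many edges as vertices, while neither
      -- alone has more. So neither has fewer, each contains a cycle, and two disjoint cycles are
      -- covered by `arrange`.
      bridge⇒⊥ : ∀ u w → u ≢ w → d I u ≡ 3 → d I w ≡ 3 → (∀ {x} → x ∈ VS I → x ≢ u → x ≢ w → d I x ≡ 2) →
        ∀ e X Y → e ∈ I → (I - e) ≐ X ⊔ Y → Nonempty X → Nonempty Y → VertexDisjoint G X Y → ⊥
      bridge⇒⊥ u w u≢w du dw d2 e X Y e∈I p nx ny vd = finish cX cY
        where
        X⊆I : X ⊆ I
        X⊆I = -ˡ {p = I} ∘ inˡ p
        Y⊆I : Y ⊆ I
        Y⊆I = -ˡ {p = I} ∘ inʳ p
        e∉ : ∀ {Z} → Z ⊆ I - e → e ∉ Z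
        e∉ s z = -≢ {p = I} (s z) refl
        cardsum : ∣ VS X ∣ + ∣ VS Y ∣ ≤ ∣ X ∣ + ∣ Y ∣
        cardsum = begin
          ∣ VS X ∣ + ∣ VS Y ∣  ≡⟨ sym (card-split (VS-split p vd)) ⟩
          ∣ VS (I - e) ∣       ≤⟨ p⊆q⇒∣p∣≤∣q∣ (VS-mono (-ˡ {p = I})) ⟩
          ∣ VS I ∣             ≡⟨ suc-injective (trans (sym size) (card-remove e∈I)) ⟩
          ∣ I - e ∣            ≡⟨ card-split p ⟩
          ∣ X ∣ + ∣ Y ∣        ∎
          where open ≤-Reasoning
        squeeze : ∀ a b a′ b′ → a + b ≤ a′ + b′ → b′ ≤ b → a ≤ a′
        squeeze a b a′ b′ h le = +-cancelʳ-≤ b a a′ (≤-trans h (+-monoʳ-≤ a′ le))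
        cX : ∃[ C ] (C ⊆ X × Cycle C)
        cX = hasCycle nx (squeeze (∣ VS X ∣) (∣ VS Y ∣) (∣ X ∣) (∣ Y ∣) cardsum (sparse {Y} Y⊆I e∈I (e∉ {Y} (inʳ p))))
        cY : ∃[ C ] (C ⊆ Y × Cycle C)
        cY = hasCycle ny (squeeze (∣ VS Y ∣) (∣ VS X ∣) (∣ Y ∣) (∣ X ∣)
          (≤-trans (≤-reflexive (+-comm (∣ VS Y ∣) (∣ VS X ∣))) (≤-trans cardsum (≤-reflexive (+-comm (∣ X ∣) (∣ Y ∣)))))
          (sparse {X} X⊆I e∈I (e∉ {X} (inˡ p))))
        finish : ∃[ C ] (C ⊆ X × Cycle C) → ∃[ C ] (C ⊆ Y × Cycle C) → ⊥
        finish (C₁ , s₁ , c₁) (C₂ , s₂ , c₂) =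
          arrange u w u≢w du dw d2 {C₁} {C₂} (X⊆I ∘ s₁) (Y⊆I ∘ s₂) c₁ c₂ (λ v (p , q) → vd v (V-mono s₁ p , V-mono s₂ q))
            (exit u w u≢w du dw d2 {C₁} (X⊆I ∘ s₁) c₁) (exit u w u≢w du dw d2 {C₂} (Y⊆I ∘ s₂) c₂)

      -- Without a bridge `I` is itself a theta graph, and its cycles are unbalanced because `I` is
      -- independent.
      two3⇒⊥ : ∀ u w → u ≢ w → d I u ≡ 3 → d I w ≡ 3 → (∀ {x} → x ∈ VS I → x ≢ u → x ≢ w → d I x ≡ 2) → ⊥
      two3⇒⊥ u w u≢w du dw d2 = case (any? (λ e → (e ∈? I) ×-dec ¬? (EConn? (I - e))))
        where
        case : Dec (∃[ e ] (e ∈ I × ¬ EConn (I - e))) → ⊥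
        case (no ¬b) = free I (theta I (conn
              , (λ e e∈ → decidable-stable (EConn? (I - e)) (λ ¬c → ¬b (e , e∈ , ¬c)))
              , u , w , u≢w , du , dw , (λ v vi → d2 (inVS {I} vi)))
            (λ C c C⊆I → free-cycle-unb free C⊆I c)) ⊆-refl
        case (yes (e , e∈I , ¬c)) = let (X , Y , p , nx , ny , vd) = ¬conn ¬c in
          bridge⇒⊥ u w u≢w du dw d2 e X Y e∈I p nx ny vd

      impossible : Excess2 (VS I) (d I) → ⊥
      impossible (one4 w _ dw d2) = let (C , C⊆I , c) = cyc in one4⇒⊥ C C⊆I c w dw d2
      impossible (two3 u w _ _ u≢w du dw d2) = two3⇒⊥ u w u≢w du dw d2

    -- The basic upper bound on ranks. A minimal violation inside `I` has one of the two degree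
    -- patterns excluded above.
    free-card : ∀ {I} → Free I → ∣ I ∣ ≤ ∣ VS I ∣
    free-card {I} free = ≮⇒≥ λ over → case (minimalSubset {P = Over} (λ Z → suc ∣ VS Z ∣ ≤? ∣ Z ∣) I over)
      where
      case : ∃[ Y ] (Y ⊆ I × Over Y × (∀ Z → Z ⊆ Y → Over Z → Y ⊆ Z)) → ⊥
      case (Y , Y⊆I , over , min) = impossible shape
        where open Minimal {Y} (λ D c D⊆Y → free D c (Y⊆I ∘ D⊆Y)) over min

-- Edges that no circuit uses, and unions of cycles that are independent.

module Growth {n m : ℕ} (G : Graph n m) (lab : Subset m → Label) where
  open Circuits G lab public

  1+2≰2 : ¬ (1 + 2 ≤ 2)
  1+2≰2 (s≤s (s≤s ()))

  loop-cycle : ∀ {C f} → Cycle C → f ∈ C → IsLoop G f → C ≡ ⁅ f ⁆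
  loop-cycle {C} {f} c f∈C l = ⊆-antisym (cycle-closed c f⊆C (f , x∈⁅x⁆ f)
      (λ {v} vf → ≤-reflexive (sym (trans (d-sing f v) (inc-loop l (V-sing vf)))))) f⊆C
    where
    f⊆C : ⁅ f ⁆ ⊆ C
    f⊆C e∈ = subst (_∈ C) (sym (sing≡ e∈)) f∈C

  path-start : ∀ {P u v} → IsPath G P u v → V P u
  path-start {P} (_ , _ , du , _) = d-V {P} (≤-reflexive (sym du))

  path-end : ∀ {P u v} → IsPath G P u v → V P v
  path-end {P} (_ , _ , _ , dv , _) = d-V {P} (≤-reflexive (sym dv))

  cycle≥2 : ∀ {C D v} → Cycle C → C ⊆ D → V C v → 2 ≤ d D v
  cycle≥2 {v = v} (_ , _ , d2) s vc = ≤-trans (≤-reflexive (sym (d2 v vc))) (d-mono s v)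

  -- Together with `cycle-closed` this shows that a circuit inside a cycle is all of it.
  circuit-deg : ∀ {D v} → Circuit D → V D v → 2 ≤ d D v
  circuit-deg (balCycle C c _) v = cycle≥2 c ⊆-refl v
  circuit-deg {v = v} (theta T (_ , _ , u , w , _ , du , dw , d2) _) vt with v ≟ u | v ≟ w
  ... | yes refl | _ = ≤-trans (n≤1+n 2) (≤-reflexive (sym du))
  ... | no _ | yes refl = ≤-trans (n≤1+n 2) (≤-reflexive (sym dw))
  ... | no v≢u | no v≢w = ≤-reflexive (sym (d2 v vt v≢u v≢w))
  circuit-deg (tight C₁ C₂ (c₁ , c₂ , _) _ _) v =
    [ cycle≥2 c₁ ∈∪ˡ , cycle≥2 c₂ (∈∪ʳ {p = C₁}) ]′ (V-∪ {C₁} v)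
  circuit-deg (linPair C₁ C₂ c₁ c₂ _ _ _) v =
    [ cycle≥2 c₁ ∈∪ˡ , cycle≥2 c₂ (∈∪ʳ {p = C₁}) ]′ (V-∪ {C₁} v)
  circuit-deg {v = v} (loose C₁ C₂ P (c₁ , c₂ , _ , x , y , (_ , _ , _ , _ , d2) , xc , yc , _) _ _) vd =
    [ cycle≥2 c₁ ∈∪ˡ , (λ q → [ cycle≥2 c₂ C₂⊆ , onP ]′ (V-∪ {C₂} q)) ]′ (V-∪ {C₁} vd)
    where
    C₂⊆ : C₂ ⊆ C₁ ∪ C₂ ∪ P
    C₂⊆ = ∈∪ʳ {p = C₁} ∘ ∈∪ˡ
    onP : V P v → 2 ≤ d (C₁ ∪ C₂ ∪ P) v
    onP vp with v ≟ x | v ≟ y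
    ... | yes refl | _ = cycle≥2 c₁ ∈∪ˡ xc
    ... | no _ | yes refl = cycle≥2 c₂ C₂⊆ yc
    ... | no v≢x | no v≢y = ≤-trans (≤-reflexive (sym (d2 v vp v≢x v≢y))) (d-mono (∈∪ʳ {p = C₁} ∘ ∈∪ʳ {p = C₂}) v)

  circuit-nonempty : ∀ {D} → Circuit D → Nonempty D
  circuit-nonempty (balCycle C c _) = proj₁ c
  circuit-nonempty (theta T (_ , _ , u , _ , _ , du , _) _) with d-V {T} {u} (≤-trans (s≤s z≤n) (≤-reflexive (sym du)))
  ... | e , e∈ , _ = e , e∈
  circuit-nonempty (tight C₁ C₂ (c₁ , _) _ _) = let (e , e∈) = proj₁ c₁ in e , ∈∪ˡ e∈
  circuit-nonempty (linPair C₁ C₂ c₁ _ _ _ _) = let (e , e∈) = proj₁ c₁ in e , ∈∪ˡ e∈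
  circuit-nonempty (loose C₁ C₂ P (c₁ , _) _ _) = let (e , e∈) = proj₁ c₁ in e , ∈∪ˡ e∈

  -- Edges that lie in no circuit of a given set

  module Pendant {e : Fin m} {w : Fin n} (¬l : ¬ IsLoop G e) (i : Inc G e w) where

    -- Loops at `w` with a label other than `fre` are tolerated, because the closures used later can
    -- contain such loops away from the chosen vertex set. A free loop could not be allowed: `e`
    -- might then belong to the path of a loose handcuff that ends at this loop.
    Only : Subset m → Set
    Only D = ∀ {f} → f ∈ D → Inc G f w → f ≡ e ⊎ (IsLoop G f × lab ⁅ f ⁆ ≢ fre)

    no-second : ∀ {K} → Only K → e ∈ K → d K w ≢ 2
    no-second {K} only e∈K d2 with d-second {K} e∈K (≤-reflexive (inc-nonloop ¬l i)) (≤-reflexive (sym d2))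
    ... | f , f∈K , f≢e , j with only f∈K j
    ...   | inj₁ f≡e = f≢e f≡e
    ...   | inj₂ (l , _) = 1+2≰2 (begin
            1 + 2               ≡⟨ cong₂ _+_ (sym (inc-nonloop ¬l i)) (sym (inc-loop l j)) ⟩
            inc e w + inc f w   ≤⟨ d-two {K} e∈K f∈K (f≢e ∘ sym) w ⟩
            d K w               ≡⟨ d2 ⟩
            2                   ∎)
            where open ≤-Reasoning

    no-cycle : ∀ {K D} → Only D → K ⊆ D → Cycle K → e ∉ K
    no-cycle {K} only s c e∈K = no-second {K} (only ∘ s) e∈K (proj₂ (proj₂ c) w (e , e∈K , i))

    no-theta : ∀ {T} → Only T → IsTheta G T → e ∉ T
    no-theta {T} only (_ , br , x , y , _ , dx , dy , d2) e∈T = case (w ≟ x) (w ≟ y)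
      where
      T≥2 : ∀ {z} → V T z → 2 ≤ d T z
      T≥2 {z} vz with z ≟ x | z ≟ y
      ... | yes refl | _ = ≤-trans (n≤1+n 2) (≤-reflexive (sym dx))
      ... | no _ | yes refl = ≤-trans (n≤1+n 2) (≤-reflexive (sym dy))
      ... | no z≢x | no z≢y = ≤-reflexive (sym (d2 z vz z≢x z≢y))
      -- Deleting e isolates the loop f, which contradicts bridgelessness.
      go : d T w ≡ 3 → ∃[ f ] (f ∈ T × f ≢ e × Inc G f w) → ∃[ z ] (z ≢ w × Inc G e z) → ⊥
      go d3 (f , f∈T , f≢e , j) (z , z≢w , k) with only f∈T j
      ... | inj₁ f≡e = f≢e f≡e
      ... | inj₂ (l , _) = go₂ (d-second {T} e∈T (≤-reflexive (inc-nonloop ¬l k)) (T≥2 (e , e∈T , k)))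
        where
        f-only : ∀ {v} → Inc G f v → v ≡ w
        f-only (inj₁ p) = [ (λ q → trans (sym p) q) , (λ q → trans (sym p) (trans l q)) ]′ j
        f-only (inj₂ p) = [ (λ q → trans (sym p) (trans (sym l) q)) , (λ q → trans (sym p) q) ]′ j
        go₂ : ∃[ g ] (g ∈ T × g ≢ e × Inc G g z) → ⊥
        go₂ (g , g∈T , g≢e , gz) with share {T - e} {⁅ f ⁆} {T - e - f} (br e e∈T) (part-- (∈- f∈T f≢e))
              (f , x∈⁅x⁆ f) (g , ∈- (∈- g∈T g≢e) (λ { refl → z≢w (f-only gz) }))
        ... | v , vf , (h , h∈ , hv) with only (-ˡ {p = T} (-ˡ {p = T - e} h∈)) (subst (Inc G h) (f-only (V-sing vf)) hv)
        ...   | inj₁ h≡e = -≢ {p = T} (-ˡ {p = T - e} h∈) h≡e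
        ...   | inj₂ (l′ , _) = 1+2≰2 (≤-trans (n≤1+n 3) (≤-trans (begin
              2 + 2                       ≡⟨ cong₂ _+_ (sym (inc-loop l j)) (sym (inc-loop l′ (subst (Inc G h) (f-only (V-sing vf)) hv))) ⟩
              inc f w + inc h w           ≤⟨ d-two {T - e} (∈- f∈T f≢e) (-ˡ {p = T - e} h∈) (λ eq → -≢ {p = T - e} h∈ (sym eq)) w ⟩
              d (T - e) w                 ≡⟨ +-cancelˡ-≡ 1 _ _ (trans (cong (_+ d (T - e) w) (sym (inc-nonloop ¬l i))) (trans (sym (d-remove {T} e∈T w)) d3)) ⟩
              2                           ∎) ≤-refl))
              where open ≤-Reasoning
      at3 : d T w ≡ 3 → ⊥
      at3 d3 = go d3 (d-second {T} e∈T (≤-reflexive (inc-nonloop ¬l i)) (≤-trans (n≤1+n 2) (≤-reflexive (sym d3)))) (other-end ¬l i)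
      case : Dec (w ≡ x) → Dec (w ≡ y) → ⊥
      case (yes w≡x) _ = at3 (trans (cong (d T) w≡x) dx)
      case (no _) (yes w≡y) = at3 (trans (cong (d T) w≡y) dy)
      case (no w≢x) (no w≢y) = no-second {T} only e∈T (d2 w (e , e∈T , i) w≢x w≢y)

    no-circuit : ∀ {D} → Circuit D → Only D → e ∉ D
    no-circuit (balCycle C c _) only = no-cycle {C} only ⊆-refl c
    no-circuit (theta T t _) only = no-theta only t
    no-circuit (tight C₁ C₂ (c₁ , c₂ , _) _ _) only e∈ =
      [ no-cycle {C₁} only ∈∪ˡ c₁ , no-cycle {C₂} only (∈∪ʳ {p = C₁}) c₂ ]′ (∪-case {p = C₁} e∈)
    no-circuit (linPair C₁ C₂ c₁ c₂ _ _ _) only e∈ =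
      [ no-cycle {C₁} only ∈∪ˡ c₁ , no-cycle {C₂} only (∈∪ʳ {p = C₁}) c₂ ]′ (∪-case {p = C₁} e∈)
    no-circuit (loose C₁ C₂ P (c₁ , c₂ , _ , x , y , (_ , _ , _ , _ , d2) , xc , yc , _) l₁ l₂) only e∈ =
      [ no-cycle {C₁} only ∈∪ˡ c₁ , (λ q → [ no-cycle {C₂} only C₂⊆ c₂ , onP ]′ (∪-case {p = C₂} q)) ]′ (∪-case {p = C₁} e∈)
      where
      C₂⊆ : C₂ ⊆ C₁ ∪ C₂ ∪ P
      C₂⊆ = ∈∪ʳ {p = C₁} ∘ ∈∪ˡ
      -- A free end cycle through `w` would use `e`, or a loop at `w` and then consist of it; the
      -- label of that loop is not `fre`.
      end : ∀ {C} → C ⊆ C₁ ∪ C₂ ∪ P → Cycle C → lab C ≡ fre → ¬ V C w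
      end {C} s c l (f , f∈C , j) with only (s f∈C) j
      ... | inj₁ refl = no-cycle {C} only s c f∈C
      ... | inj₂ (lp , ≢fre) = ≢fre (trans (cong lab (sym (loop-cycle c f∈C lp))) l)
      onP : e ∉ P
      onP e∈P with w ≟ x | w ≟ y
      ... | yes refl | _ = end {C₁} ∈∪ˡ c₁ l₁ xc
      ... | no _ | yes refl = end {C₂} C₂⊆ c₂ l₂ yc
      ... | no w≢x | no w≢y = no-second {P} (only ∘ ∈∪ʳ {p = C₁} ∘ ∈∪ʳ {p = C₂}) e∈P (d2 w (e , e∈P , i) w≢x w≢y)

  -- A circuit through a free loop has another edge at the same vertex: theta graphs are connected,
  -- a tight handcuff has its second cycle there, and a loose handcuff its path. A linear loop
  -- behaves differently, since it forms a circuit with any disjoint linear cycle.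
  module IsolatedLoop {e : Fin m} {w : Fin n} (l : IsLoop G e) (i : Inc G e w) (f : lab ⁅ e ⁆ ≡ fre) where

    e-only : ∀ {v} → Inc G e v → v ≡ w
    e-only (inj₁ p) = [ (λ q → trans (sym p) q) , (λ q → trans (sym p) (trans l q)) ]′ i
    e-only (inj₂ p) = [ (λ q → trans (sym p) (trans (sym l) q)) , (λ q → trans (sym p) q) ]′ i

    Only : Subset m → Set
    Only D = ∀ {g} → g ∈ D → Inc G g w → g ≡ e

    alone : ∀ {T} → EConn T → Only T → e ∈ T → ¬ Nonempty (T - e)
    alone {T} ec only e∈T ne with share {T} {⁅ e ⁆} {T - e} ec (part-- e∈T) (e , x∈⁅x⁆ e) ne
    ... | v , ve , (g , g∈ , gv) = -≢ {p = T} g∈ (only (-ˡ {p = T} g∈) (subst (Inc G g) (e-only (V-sing ve)) gv))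

    in-cycle : ∀ {C} → Cycle C → e ∈ C → lab C ≡ fre
    in-cycle c e∈C = trans (cong lab (loop-cycle c e∈C l)) f

    no-circuit : ∀ {D} → Circuit D → Only D → e ∉ D
    no-circuit (balCycle C c lb) only e∈ with trans (sym (in-cycle c e∈)) lb
    ... | ()
    no-circuit (theta T (ec , _ , x , y , x≢y , dx , dy , _) _) only e∈ = alone ec only e∈ (other (w ≟ x))
      where
      at : ∀ {z} → w ≢ z → d T z ≡ 3 → Nonempty (T - e)
      at {z} w≢z dz with d-V {T} {z} (≤-trans (s≤s z≤n) (≤-reflexive (sym dz)))
      ... | g , g∈ , gz = g , ∈- g∈ (λ { refl → w≢z (sym (e-only gz)) })
      other : Dec (w ≡ x) → Nonempty (T - e)
      other (yes refl) = at x≢y dy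
      other (no w≢x) = at w≢x dx
    no-circuit (tight C₁ C₂ (c₁ , c₂ , ed , v , v₁ , v₂ , _) _ _) only e∈ =
      [ (λ q → side C₂ (∈∪ʳ {p = C₁}) c₁ q v₁ v₂ (λ r → ed e (q , r))) , (λ q → side C₁ ∈∪ˡ c₂ q v₂ v₁ (λ r → ed e (r , q))) ]′ (∪-case {p = C₁} e∈)
      where
      side : ∀ {C} C′ → C′ ⊆ C₁ ∪ C₂ → Cycle C → e ∈ C → V C v → V C′ v → e ∉ C′ → ⊥
      side {C} C′ s c e∈C vC (g , g∈ , gv) e∉ = e∉ (subst (_∈ C′) (only (s g∈) (subst (Inc G g) v≡w gv)) g∈)
        where
        v≡w : v ≡ w
        v≡w = e-only (V-sing (subst (λ Z → V Z v) (loop-cycle c e∈C l) vC))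
    no-circuit (linPair C₁ C₂ c₁ c₂ _ l₁ l₂) only e∈ with ∪-case {p = C₁} e∈
    ... | inj₁ q with trans (sym (in-cycle c₁ q)) l₁
    ...   | ()
    no-circuit (linPair C₁ C₂ c₁ c₂ _ l₁ l₂) only e∈ | inj₂ q with trans (sym (in-cycle c₂ q)) l₂
    ...   | ()
    no-circuit (loose C₁ C₂ P (c₁ , c₂ , _ , x , y , pth@(x≢y , ecP , dx , dy , d2) , xc , yc , _) _ _) only e∈ =
      [ (λ q → end c₁ q xc dx) , (λ r → [ (λ q → end c₂ q yc dy) , onP ]′ (∪-case {p = C₂} r)) ]′ (∪-case {p = C₁} e∈)
      where
      P⊆ : P ⊆ C₁ ∪ C₂ ∪ P
      P⊆ = ∈∪ʳ {p = C₁} ∘ ∈∪ʳ {p = C₂}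
      not1 : ∀ {z} → e ∈ P → Inc G e z → d P z ≢ 1
      not1 {z} e∈P j d1 = 1+2≰2 (s≤s (≤-trans (≤-trans (≤-reflexive (sym (inc-loop l j))) (d-elem {P} e∈P z)) (≤-reflexive d1)))
      end : ∀ {C z} → Cycle C → e ∈ C → V C z → d P z ≡ 1 → ⊥
      end {C} {z} c e∈C zC d1 with d-V {P} {z} (≤-reflexive (sym d1))
      ... | g , g∈ , gz = not1 (subst (_∈ P) g≡e g∈) (subst (λ h → Inc G h z) g≡e gz) d1
        where
        g≡e : g ≡ e
        g≡e = only (P⊆ g∈) (subst (Inc G g) (e-only (V-sing (subst (λ Z → V Z z) (loop-cycle c e∈C l) zC))) gz)
      onP : e ∉ P
      onP e∈P with path-start pth
      ... | g , g∈ , gx = alone ecP (only ∘ P⊆) e∈P (g , ∈- g∈ (λ { refl → not1 e∈P gx dx }))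

  -- Independence of unbalanced cycles

  unb-free : ∀ {C} → Unb C → Free C
  unb-free {C} (c , ≢bal) D circ D⊆C = go circ (⊆-antisym D⊆C (cycle-closed c D⊆C (circuit-nonempty circ) (circuit-deg circ)))
    where
    all : ∀ {K D} → K ⊆ D → D ≡ C → Cycle K → K ≡ C
    all s refl k = cycle-⊆ c k s
    go : ∀ {D} → Circuit D → D ≡ C → ⊥
    go (balCycle _ _ lb) refl = ≢bal lb
    go (theta T (_ , _ , u , _ , _ , du , _) _) refl =
      1+2≰2 (≤-trans (≤-reflexive (sym du)) (≤-reflexive (proj₂ (proj₂ c) u (d-V {T} (≤-trans (s≤s z≤n) (≤-reflexive (sym du)))))))
    go (tight C₁ C₂ (c₁ , c₂ , ed , _) _ _) eq with all {C₁} ∈∪ˡ eq c₁ | all {C₂} (∈∪ʳ {p = C₁}) eq c₂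
    ... | refl | refl = let (e , e∈) = proj₁ c₁ in ed e (e∈ , e∈)
    go (linPair C₁ C₂ c₁ c₂ vd _ _) eq with all {C₁} ∈∪ˡ eq c₁ | all {C₂} (∈∪ʳ {p = C₁}) eq c₂
    ... | refl | refl = let (e , e∈) = proj₁ c₁ in vd (src G e) ((e , e∈ , inj₁ refl) , (e , e∈ , inj₁ refl))
    go (loose C₁ C₂ P (c₁ , c₂ , vd , _) _ _) eq with all {C₁} ∈∪ˡ eq c₁ | all {C₂} (∈∪ʳ {p = C₁} ∘ ∈∪ˡ) eq c₂
    ... | refl | refl = let (e , e∈) = proj₁ c₁ in vd (src G e) ((e , e∈ , inj₁ refl) , (e , e∈ , inj₁ refl))

  -- Connected pieces of a circuit stay within one of the two cycles. A loose handcuff in the union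
  -- would need its path, which meets both cycles, to lie inside one of them.
  fre-free : ∀ {C₁ C₂} → Cycle C₁ → Cycle C₂ → VertexDisjoint G C₁ C₂ → lab C₁ ≡ fre → lab C₂ ≡ fre → Free (C₁ ∪ C₂)
  fre-free {C₁} {C₂} c₁ c₂ vd l₁ l₂ D = go
    where
    part : (C₁ ∪ C₂) ≐ C₁ ⊔ C₂
    part = part-∪ (λ {e} p q → vd (src G e) ((e , p , inj₁ refl) , (e , q , inj₁ refl)))
    one : ∀ {K} → EConn K → K ⊆ C₁ ∪ C₂ → K ⊆ C₁ ⊎ K ⊆ C₂
    one ec s = inOne ec (∪-case ∘ s) vd
    cyc : ∀ {K} → Cycle K → K ⊆ C₁ ∪ C₂ → K ≡ C₁ ⊎ K ≡ C₂
    cyc {K} k s with one {K} (proj₁ (proj₂ k)) s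
    ... | inj₁ q = inj₁ (cycle-⊆ c₁ k q)
    ... | inj₂ q = inj₂ (cycle-⊆ c₂ k q)
    isFre : ∀ {K} → Cycle K → K ⊆ C₁ ∪ C₂ → lab K ≡ fre
    isFre k s with cyc k s
    ... | inj₁ refl = l₁
    ... | inj₂ refl = l₂
    d≤2 : ∀ {v} → V (C₁ ∪ C₂) v → d (C₁ ∪ C₂) v ≤ 2
    d≤2 {v} vv with V-∪ {C₁} vv
    ... | inj₁ x = ≤-reflexive (trans (sym (d-part part (λ y → vd v (x , y)))) (proj₂ (proj₂ c₁) v x))
    ... | inj₂ y = ≤-reflexive (trans (sym (d-part (part-swap part) (λ x → vd v (x , y)))) (proj₂ (proj₂ c₂) v y))
    distinct : ∀ {K₁ K₂ v} → K₁ ≡ C₁ ⊎ K₁ ≡ C₂ → K₂ ≡ C₁ ⊎ K₂ ≡ C₂ → V K₁ v → V K₂ v → K₁ ≡ K₂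
    distinct (inj₁ refl) (inj₁ refl) _ _ = refl
    distinct (inj₂ refl) (inj₂ refl) _ _ = refl
    distinct {v = v} (inj₁ refl) (inj₂ refl) a b = ⊥-elim (vd v (a , b))
    distinct {v = v} (inj₂ refl) (inj₁ refl) a b = ⊥-elim (vd v (b , a))
    go : ∀ {D} → Circuit D → ¬ (D ⊆ C₁ ∪ C₂)
    go (balCycle K k lb) s with trans (sym (isFre k s)) lb
    ... | ()
    go (theta T (_ , _ , u , _ , _ , du , _) _) s =
      1+2≰2 (≤-trans (≤-reflexive (sym du)) (≤-trans (d-mono s u) (d≤2 (V-mono s (d-V {T} (≤-trans (s≤s z≤n) (≤-reflexive (sym du))))))))
    go (tight K₁ K₂ (k₁ , k₂ , ed , v , v₁ , v₂ , _) _ _) s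
      with distinct (cyc k₁ (s ∘ ∈∪ˡ)) (cyc k₂ (s ∘ ∈∪ʳ {p = K₁})) v₁ v₂
    ... | refl = let (e , e∈) = proj₁ k₁ in ed e (e∈ , e∈)
    go (linPair K₁ K₂ k₁ k₂ _ m₁ m₂) s with trans (sym (isFre k₁ (s ∘ ∈∪ˡ))) m₁
    ... | ()
    go (loose K₁ K₂ P (k₁ , k₂ , vd′ , x , y , pth@(_ , ecP , _) , xK , yK , _) _ _) s = fin
      (cyc k₁ (s ∘ ∈∪ˡ)) (cyc k₂ (s ∘ ∈∪ʳ {p = K₁} ∘ ∈∪ˡ)) (one {P} ecP (s ∘ ∈∪ʳ {p = K₁} ∘ ∈∪ʳ {p = K₂}))
      where
      fin : K₁ ≡ C₁ ⊎ K₁ ≡ C₂ → K₂ ≡ C₁ ⊎ K₂ ≡ C₂ → P ⊆ C₁ ⊎ P ⊆ C₂ → ⊥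
      fin (inj₁ refl) (inj₁ refl) _ = vd′ x (xK , xK)
      fin (inj₂ refl) (inj₂ refl) _ = vd′ x (xK , xK)
      fin (inj₁ refl) (inj₂ refl) (inj₁ q) = vd y (V-mono q (path-end pth) , yK)
      fin (inj₁ refl) (inj₂ refl) (inj₂ q) = vd x (xK , V-mono q (path-start pth))
      fin (inj₂ refl) (inj₁ refl) (inj₁ q) = vd x (V-mono q (path-start pth) , xK)
      fin (inj₂ refl) (inj₁ refl) (inj₂ q) = vd y (yK , V-mono q (path-end pth))

-- Rerouting an unbalanced cycle along a chord.

module Chords {n m : ℕ} (G : Graph n m) (lab : Subset m → Label) where
  open Growth G lab

  -- `R` is a chord path of `C` from `x` to `y`; of the two arcs of `C`, `P` is the one kept and `Q`
  -- the one replaced by `R`.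
  record Ear (C R : Subset m) (x y : Fin n) : Set where
    field
      P Q   : Subset m
      arcs  : C ≐ P ⊔ Q
      unb   : Unb (P ∪ R)
      meet  : ∀ {w} → V P w → V Q w → w ≡ x ⊎ w ≡ y
      xP    : V P x
      yP    : V P y
      xQ    : V Q x
      yQ    : V Q y

  module Theta {C R : Subset m} {x y : Fin n} (c : Cycle C) (path : IsPath G R x y) (xC : V C x) (yC : V C y)
    (inner : ∀ {w} → V R w → V C w → w ≡ x ⊎ w ≡ y) (disj : ∀ {e} → e ∈ R → e ∉ C) where

    x≢y = proj₁ path
    ecR = proj₁ (proj₂ path)
    dRx = proj₁ (proj₂ (proj₂ path))
    dRy = proj₁ (proj₂ (proj₂ (proj₂ path)))
    dR2 = proj₂ (proj₂ (proj₂ (proj₂ path)))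
    dC2 = proj₂ (proj₂ c)

    xR : V R x
    xR = path-start path
    yR : V R y
    yR = path-end path

    mid : Subset n
    mid = VS R - x - y

    mid∌C : ∀ {w} → w ∈ mid → ¬ V C w
    mid∌C w∈ wc = [ -≢ {p = VS R} (-ˡ {p = VS R - x} w∈) , -≢ {p = VS R - x} w∈ ]′
      (inner (outVS {R} (-ˡ {p = VS R} (-ˡ {p = VS R - x} w∈))) wc)

    path-card : ∣ R ∣ ≡ suc ∣ mid ∣
    path-card = *-cancelˡ-≡ _ _ 2 (begin
      2 * ∣ R ∣                                  ≡⟨ sym (handshake R) ⟩
      wsum (VS R) (d R)                          ≡⟨ wsum-remove {X = VS R} (inVS {R} xR) (d R) ⟩
      d R x + wsum (VS R - x) (d R)              ≡⟨ cong₂ _+_ dRx (wsum-remove {X = VS R - x} (∈- (inVS {R} yR) (x≢y ∘ sym)) (d R)) ⟩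
      1 + (d R y + wsum mid (d R))               ≡⟨ cong (1 +_) (cong₂ _+_ dRy (wsum-cong {X = mid} {d R} {λ _ → 2} two)) ⟩
      2 + wsum mid (λ _ → 2)                     ≡⟨ cong (2 +_) (wsum-const mid 2) ⟩
      2 + 2 * ∣ mid ∣                            ≡⟨ sym (*-distribˡ-+ 2 1 (∣ mid ∣)) ⟩
      2 * suc ∣ mid ∣                            ∎)
      where
      open ≡-Reasoning
      two : ∀ {w} → w ∈ mid → d R w ≡ 2
      two {w} w∈ = dR2 w (outVS {R} (-ˡ {p = VS R} (-ˡ {p = VS R - x} w∈)))
        (-≢ {p = VS R} (-ˡ {p = VS R - x} w∈)) (-≢ {p = VS R - x} w∈)

    -- The union of `C` and `R` has one edge more than it has vertices, so one edge can be deleted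
    -- and a cycle still remains.
    cycle-off : ∀ {f} → f ∈ C → ∃[ Z ] (Z ⊆ (C - f) ∪ R × Cycle Z)
    cycle-off {f} f∈ = hasCycle {(C - f) ∪ R} (let (e , e∈ , _) = xR in e , ∈∪ʳ e∈) (begin
      ∣ VS ((C - f) ∪ R) ∣          ≤⟨ p⊆q⇒∣p∣≤∣q∣ (VS⊆ {(C - f) ∪ R} {VS C ∪ mid} (λ v → [ ∈∪ˡ ∘ inVS {C} ∘ V-mono (-ˡ {p = C}) , onR ]′ (V-∪ {C - f} v))) ⟩
      ∣ VS C ∪ mid ∣                ≡⟨ card-split (part-∪ (λ p q → mid∌C q (outVS {C} p))) ⟩
      ∣ VS C ∣ + ∣ mid ∣            ≡⟨ cong (_+ ∣ mid ∣) (sym (cycle-card c)) ⟩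
      ∣ C ∣ + ∣ mid ∣               ≡⟨ cong (_+ ∣ mid ∣) (card-remove f∈) ⟩
      suc ∣ C - f ∣ + ∣ mid ∣       ≡⟨ sym (+-suc (∣ C - f ∣) (∣ mid ∣)) ⟩
      ∣ C - f ∣ + suc ∣ mid ∣       ≡⟨ cong (∣ C - f ∣ +_) (sym path-card) ⟩
      ∣ C - f ∣ + ∣ R ∣             ≡⟨ sym (card-split (part-∪ {X = C - f} {R} (λ p q → disj q (-ˡ {p = C} p)))) ⟩
      ∣ (C - f) ∪ R ∣               ∎)
      where
      open ≤-Reasoning
      onR : ∀ {v} → V R v → v ∈ VS C ∪ mid
      onR {v} vr with v ≟ x | v ≟ y
      ... | yes refl | _ = ∈∪ˡ (inVS {C} xC)
      ... | no _ | yes refl = ∈∪ˡ (inVS {C} yC)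
      ... | no v≢x | no v≢y = ∈∪ʳ (∈- (∈- (inVS {R} vr) v≢x) v≢y)

    T : Subset m
    T = C ∪ R

    partT : T ≐ C ⊔ R
    partT = part-∪ (λ p q → disj q p)

    -- After deleting `f`, one of `C` and `R` is intact and holds both `x` and `y`. If the rest fell
    -- apart, the side without `x` and `y` would have only vertices of degree two, which `evenCut`
    -- forbids.
    isTheta : IsTheta G T
    isTheta = ecT , (λ f f∈ → mkConn (λ A B p na nb vd → bridgeless f f∈ A B p na nb vd)) , x , y , x≢y
      , trans (d-split partT x) (cong₂ _+_ (dC2 x xC) dRx)
      , trans (d-split partT y) (cong₂ _+_ (dC2 y yC) dRy)
      , λ v vt p q → even vt p q
      where
      ecT : EConn T
      ecT = conn-∪ {C} {R} (proj₁ (proj₂ c)) ecR xC xR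
      even : ∀ {v} → V T v → v ≢ x → v ≢ y → d T v ≡ 2
      even {v} vt v≢x v≢y with V-∪ {C} vt
      ... | inj₁ vc = trans (sym (d-part partT (λ vr → [ v≢x , v≢y ]′ (inner vr vc)))) (dC2 v vc)
      ... | inj₂ vr = trans (sym (d-part (part-swap partT) (λ vc → [ v≢x , v≢y ]′ (inner vr vc)))) (dR2 v vr v≢x v≢y)
      side : ∀ {f K} A B → f ∈ T → (T - f) ≐ A ⊔ B → Nonempty A → Nonempty B → VertexDisjoint G A B →
        V K x → V K y → K ⊆ A → ⊥
      side A B f∈ p na nb vd kx ky s = evenCut {T} {X = A} {B} ecT f∈ p na nb vd (λ {v} vb → even (V-mono (-ˡ {p = T} ∘ inʳ p) vb)
        (λ { refl → vd v (V-mono s kx , vb) }) (λ { refl → vd v (V-mono s ky , vb) }))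
      sides : ∀ {f K} A B → f ∈ T → (T - f) ≐ A ⊔ B → Nonempty A → Nonempty B → VertexDisjoint G A B →
        V K x → V K y → K ⊆ A ⊎ K ⊆ B → ⊥
      sides {f} {K} A B f∈ p na nb vd kx ky (inj₁ s) = side {f} {K} A B f∈ p na nb vd kx ky s
      sides {f} {K} A B f∈ p na nb vd kx ky (inj₂ s) = side {f} {K} B A f∈ (part-swap p) nb na (vd-sym {A} {B} vd) kx ky s
      bridgeless : ∀ f → f ∈ T → ∀ A B → (T - f) ≐ A ⊔ B → Nonempty A → Nonempty B → VertexDisjoint G A B → ⊥
      bridgeless f f∈ A B p na nb vd with f ∈? R
      ... | yes f∈R = sides {f} {C} A B f∈ p na nb vd xC yC
            (inOne {C} {A} {B} (proj₁ (proj₂ c)) (λ e∈ → cov p (∈- (∈∪ˡ e∈) (λ { refl → disj f∈R e∈ }))) vd)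
      ... | no f∉R = sides {f} {R} A B f∈ p na nb vd xR yR
            (inOne {R} {A} {B} ecR (λ e∈ → cov p (∈- (∈∪ʳ e∈) (λ { refl → f∉R e∈ }))) vd)

    -- The arcs are read off from a cycle that avoids an edge `f` of `C`: its edges outside `R` form
    -- one arc, and the remaining edges of `C` the other.
    module FromCycle {f : Fin m} (f∈C : f ∈ C) {Z : Subset m} (Z⊆ : Z ⊆ (C - f) ∪ R) (z : Cycle Z) where

      dZ2 = proj₂ (proj₂ z)

      f∉Z : f ∉ Z
      f∉Z q = [ (λ p → -≢ {p = C} p refl) , (λ p → disj p f∈C) ]′ (∪-case (Z⊆ q))

      meetsR : Nonempty (R ∩ Z)
      meetsR = decidable-stable (nonempty? (R ∩ Z)) λ ¬ne → f∉Z (subst (f ∈_) (sym (cycle-⊆ c z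
        (λ {e} e∈ → [ -ˡ {p = C} , (λ r → ⊥-elim (¬ne (e , x∈p∩q⁺ (r , e∈)))) ]′ (∪-case (Z⊆ e∈))))) f∈C)

      R⊆Z : R ⊆ Z
      R⊆Z = [ (λ s → s) , (λ w → ⊥-elim (contra w)) ]′ (⊆-or-witness R Z)
        where
        partR : R ≐ (R ∩ Z) ⊔ (R ─ (R ∩ Z))
        partR = part-─ (p∩q⊆p R Z)
        partZ : Z ≐ (R ∩ Z) ⊔ (Z ─ (R ∩ Z))
        partZ = part-─ (p∩q⊆q R Z)
        at : ∃[ w ] (V (R ∩ Z) w × V (R ─ (R ∩ Z)) w) → ⊥
        at (w , w₁ , w₂) = 1+2≰2 (begin
            2 + 1                               ≤⟨ +-mono-≤ (≤-reflexive (sym dz)) (d-pos {R ─ (R ∩ Z)} w₂) ⟩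
            d (R ∩ Z) w + d (R ─ (R ∩ Z)) w     ≡⟨ sym (d-split partR w) ⟩
            d R w                               ≡⟨ dR2 w (V-mono (p∩q⊆p R Z) w₁) (off dRx) (off dRy) ⟩
            2                                   ∎)
          where
          open ≤-Reasoning
          off : ∀ {t} → d R t ≡ 1 → w ≢ t
          off {t} d1 refl = 1+2≰2 (s≤s (≤-trans (+-mono-≤ (d-pos {R ∩ Z} w₁) (d-pos {R ─ (R ∩ Z)} w₂))
            (≤-reflexive (trans (sym (d-split partR w)) d1))))
          dz : d (R ∩ Z) w ≡ 2
          dz = trans (d-part partZ notC) (dZ2 w (V-mono (p∩q⊆q R Z) w₁))
            where
            notC : ¬ V (Z ─ (R ∩ Z)) w
            notC (e , e∈ , i) with ∪-case (Z⊆ (─ˡ {p = Z} e∈))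
            ... | inj₁ q = [ off dRx , off dRy ]′ (inner (V-mono (p∩q⊆p R Z) w₁) (e , -ˡ {p = C} q , i))
            ... | inj₂ q = ─ʳ {p = Z} e∈ (x∈p∩q⁺ (q , ─ˡ {p = Z} e∈))
        contra : ¬ (∃[ e ] (e ∈ R × e ∉ Z))
        contra (e , e∈R , e∉Z) = at (share ecR partR meetsR (e , ∈─ e∈R (e∉Z ∘ p∩q⊆q R Z)))

      P Q : Subset m
      P = Z ─ R
      Q = C ─ P

      partP : Z ≐ R ⊔ P
      partP = part-─ R⊆Z

      P⊆C : P ⊆ C
      P⊆C e∈ = [ -ˡ {p = C} , (λ r → ⊥-elim (─ʳ {p = Z} e∈ r)) ]′ (∪-case (Z⊆ (─ˡ {p = Z} e∈)))

      arcs : C ≐ P ⊔ Q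
      arcs = part-─ P⊆C

      P∪R≡Z : P ∪ R ≡ Z
      P∪R≡Z = ⊆-antisym (∪-lub {p = P} (─ˡ {p = Z}) R⊆Z) (λ e∈ → [ ∈∪ʳ , ∈∪ˡ ]′ (cov partP e∈))

      dP-end : ∀ {t} → V R t → V C t → d R t ≡ 1 → d P t ≡ 1
      dP-end {t} tR tC d1 = +-cancelˡ-≡ 1 _ _ (trans (cong (_+ d P t) (sym d1)) (trans (sym (d-split partP t)) (dZ2 t (V-mono R⊆Z tR))))

      dQ-end : ∀ {t} → V R t → V C t → d R t ≡ 1 → d Q t ≡ 1
      dQ-end {t} tR tC d1 = +-cancelˡ-≡ 1 _ _ (trans (cong (_+ d Q t) (sym (dP-end tR tC d1))) (trans (sym (d-split arcs t)) (dC2 t tC)))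

      dPx : d P x ≡ 1
      dPx = dP-end xR xC dRx
      dPy : d P y ≡ 1
      dPy = dP-end yR yC dRy
      dQx : d Q x ≡ 1
      dQx = dQ-end xR xC dRx
      dQy : d Q y ≡ 1
      dQy = dQ-end yR yC dRy

      meet : ∀ {w} → V P w → V Q w → w ≡ x ⊎ w ≡ y
      meet {w} wp wq with V? R w
      ... | yes wr = inner wr (V-mono P⊆C wp)
      ... | no ¬wr = ⊥-elim (1+2≰2 (begin
            2 + 1          ≤⟨ +-mono-≤ (≤-reflexive (sym (trans (d-part (part-swap partP) ¬wr) (dZ2 w (V-mono (─ˡ {p = Z}) wp))))) (d-pos {Q} wq) ⟩
            d P w + d Q w  ≡⟨ sym (d-split arcs w) ⟩
            d C w          ≡⟨ dC2 w (V-mono P⊆C wp) ⟩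
            2              ∎))
            where open ≤-Reasoning

      partQR : (Q ∪ R) ≐ Q ⊔ R
      partQR = part-∪ (λ q r → disj r (inʳ arcs q))

      dQ2 : ∀ {w} → V Q w → w ≢ x → w ≢ y → d Q w ≡ 2
      dQ2 {w} wq w≢x w≢y = trans (d-part (part-swap arcs) (λ wp → [ w≢x , w≢y ]′ (meet wp wq))) (dC2 w (V-mono (inʳ arcs) wq))

      dQR2 : ∀ v → V (Q ∪ R) v → d (Q ∪ R) v ≡ 2
      dQR2 v vv with v ≟ x | v ≟ y
      ... | yes refl | _ = trans (d-split partQR v) (cong₂ _+_ dQx dRx)
      ... | no _ | yes refl = trans (d-split partQR v) (cong₂ _+_ dQy dRy)
      ... | no v≢x | no v≢y with V-∪ {Q} vv
      ...   | inj₁ vq = trans (sym (d-part partQR (λ vr → [ v≢x , v≢y ]′ (inner vr (V-mono (inʳ arcs) vq))))) (dQ2 vq v≢x v≢y)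
      ...   | inj₂ vr = trans (sym (d-part (part-swap partQR) (λ vq → [ v≢x , v≢y ]′ (inner vr (V-mono (inʳ arcs) vq))))) (dR2 v vr v≢x v≢y)

      PE : ∃[ e ] (e ∈ P × e ∉ Q)
      PE = let (e , e∈ , _) = d-V {P} {x} (≤-reflexive (sym dPx)) in e , e∈ , λ q → dis arcs e∈ q

      cycleQR : Cycle (Q ∪ R)
      cycleQR = (let (e , e∈ , _) = xR in e , ∈∪ʳ e∈) , mkConn (λ A B p na nb vd → conn A B p na nb vd (inOne {R} {A} {B} ecR (cov p ∘ ∈∪ʳ) vd)) , dQR2
        where
        -- A part avoiding R would be a proper closed part of C.
        closed : ∀ A B → (Q ∪ R) ≐ A ⊔ B → Nonempty B → VertexDisjoint G A B → R ⊆ A → ⊥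
        closed A B p ne vd s = proj₂ (proj₂ PE) (B⊆Q (cycle-closed c (inʳ arcs ∘ B⊆Q) ne
            (λ {v} vb → ≤-reflexive (sym (trans (d-part (part-swap p) (λ va → vd v (va , vb))) (dQR2 v (V-mono (inʳ p) vb)))))
            (P⊆C (proj₁ (proj₂ PE)))))
          where
          B⊆Q : B ⊆ Q
          B⊆Q e∈ = [ (λ q → q) , (λ r → ⊥-elim (dis p (s r) e∈)) ]′ (∪-case (inʳ p e∈))
        conn : ∀ A B → (Q ∪ R) ≐ A ⊔ B → Nonempty A → Nonempty B → VertexDisjoint G A B → R ⊆ A ⊎ R ⊆ B → ⊥
        conn A B p na nb vd (inj₁ s) = closed A B p nb vd s
        conn A B p na nb vd (inj₂ s) = closed B A (part-swap p) na (vd-sym {A} {B} vd) s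

      cyclePR : Cycle (P ∪ R)
      cyclePR = subst Cycle (sym P∪R≡Z) z

  -- In the theta graph `C ∪ R` the cycle `C` is unbalanced, so the other two cycles cannot both be
  -- balanced; the arc of an unbalanced one is kept.
  chord : QuasiBiased G lab → ∀ {C R x y} → Unb C → IsPath G R x y → V C x → V C y →
    (∀ {w} → V R w → V C w → w ≡ x ⊎ w ≡ y) → (∀ {e} → e ∈ R → e ∉ C) → Ear C R x y
  chord qb {C} {R} {x} {y} (c , ≢bal) path xC yC inner disj = use (cycle-off (proj₁ (proj₂ xC)))
    where
    open Theta {C} {R} c path xC yC inner disj
    use : ∃[ Z ] (Z ⊆ (C - proj₁ xC) ∪ R × Cycle Z) → Ear C R x y
    use (Z , Z⊆ , z) = pick (lab (P ∪ R) ≟ᴸ bal) (lab (Q ∪ R) ≟ᴸ bal)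
      where
      open FromCycle (proj₁ (proj₂ xC)) Z⊆ z
      r∈ : ∃[ e ] (e ∈ R)
      r∈ = let (e , e∈ , _) = xR in e , e∈
      ≢C : ∀ {X} → X ∪ R ≢ C
      ≢C {X} eq = disj (proj₂ r∈) (subst (proj₁ r∈ ∈_) eq (∈∪ʳ {p = X} (proj₂ r∈)))
      P≢Q : P ∪ R ≢ Q ∪ R
      P≢Q eq = [ proj₂ (proj₂ PE) , (λ r → disj r (P⊆C (proj₁ (proj₂ PE)))) ]′
        (∪-case (subst (proj₁ PE ∈_) eq (∈∪ˡ (proj₁ (proj₂ PE)))))
      ⊆T : ∀ {X} → X ⊆ C → X ∪ R ⊆ T
      ⊆T {X} s = ∪-lub {p = X} (∈∪ˡ ∘ s) ∈∪ʳ
      pick : Dec (lab (P ∪ R) ≡ bal) → Dec (lab (Q ∪ R) ≡ bal) → Ear C R x y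
      pick (no ¬b) _ = record { P = P ; Q = Q ; arcs = arcs ; unb = cyclePR , ¬b ; meet = meet
        ; xP = d-V {P} (≤-reflexive (sym dPx)) ; yP = d-V {P} (≤-reflexive (sym dPy))
        ; xQ = d-V {Q} (≤-reflexive (sym dQx)) ; yQ = d-V {Q} (≤-reflexive (sym dQy)) }
      pick (yes _) (no ¬b) = record { P = Q ; Q = P ; arcs = part-swap arcs ; unb = cycleQR , ¬b ; meet = λ q p → meet p q
        ; xQ = d-V {P} (≤-reflexive (sym dPx)) ; yQ = d-V {P} (≤-reflexive (sym dPy))
        ; xP = d-V {Q} (≤-reflexive (sym dQx)) ; yP = d-V {Q} (≤-reflexive (sym dQy)) }
      pick (yes b₁) (yes b₂) = ⊥-elim (proj₁ qb T isTheta (P ∪ R , Q ∪ R , C , cyclePR , cycleQR , c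
        , ⊆T {P} P⊆C , ⊆T {Q} (inʳ arcs) , ∈∪ˡ , P≢Q , ≢C {P} , ≢C {Q} , b₁ , b₂ , ≢bal))

-- Connected vertex sets and forests grown inside them.

module Vertices {n m : ℕ} (G : Graph n m) (lab : Subset m → Label) where
  open Growth G lab public

  -- Adjacency and separations of vertex sets

  Joins : Fin m → Fin n → Fin n → Set
  Joins e x y = (src G e ≡ x × tgt G e ≡ y) ⊎ (src G e ≡ y × tgt G e ≡ x)

  Adj : Fin n → Fin n → Set
  Adj x y = ∃[ e ] Joins e x y

  abstract
    Adj? : ∀ x y → Dec (Adj x y)
    Adj? x y = any? (λ e → ((src G e ≟ x) ×-dec (tgt G e ≟ y)) ⊎-dec ((src G e ≟ y) ×-dec (tgt G e ≟ x)))

  adj-sym : ∀ {x y} → Adj x y → Adj y x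
  adj-sym (e , j) = e , swap j

  joinsˡ : ∀ {e x y} → Joins e x y → Inc G e x
  joinsˡ (inj₁ (p , _)) = inj₁ p
  joinsˡ (inj₂ (_ , p)) = inj₂ p

  joinsʳ : ∀ {e x y} → Joins e x y → Inc G e y
  joinsʳ = joinsˡ ∘ swap

  joins-end : ∀ {e x y v} → Joins e x y → Inc G e v → v ≡ x ⊎ v ≡ y
  joins-end (inj₁ (refl , refl)) (inj₁ p) = inj₁ (sym p)
  joins-end (inj₁ (refl , refl)) (inj₂ p) = inj₂ (sym p)
  joins-end (inj₂ (refl , refl)) (inj₁ p) = inj₂ (sym p)
  joins-end (inj₂ (refl , refl)) (inj₂ p) = inj₁ (sym p)

  joins-nonloop : ∀ {e x y} → Joins e x y → x ≢ y → ¬ IsLoop G e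
  joins-nonloop (inj₁ (refl , refl)) x≢y l = x≢y l
  joins-nonloop (inj₂ (refl , refl)) x≢y l = x≢y (sym l)

  inc-joins : ∀ {e x y} → Inc G e x → Inc G e y → x ≢ y → Joins e x y
  inc-joins (inj₁ p) (inj₁ q) x≢y = ⊥-elim (x≢y (trans (sym p) q))
  inc-joins (inj₁ p) (inj₂ q) x≢y = inj₁ (p , q)
  inc-joins (inj₂ p) (inj₁ q) x≢y = inj₂ (q , p)
  inc-joins (inj₂ p) (inj₂ q) x≢y = ⊥-elim (x≢y (trans (sym p) q))

  record Split (U A B : Subset n) : Set where
    field
      parts : U ≐ A ⊔ B
      neA   : Nonempty A
      neB   : Nonempty B
      apart : ∀ {x y} → x ∈ A → y ∈ B → ¬ Adj x y
  open Split public

  -- Connectedness of the subgraph induced on `U`, with the empty set allowed.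
  NoSplit : Subset n → Set
  NoSplit U = ∀ A B → ¬ Split U A B

  split-swap : ∀ {U A B} → Split U A B → Split U B A
  split-swap s = record { parts = part-swap (parts s) ; neA = neB s ; neB = neA s
                        ; apart = λ x y a → apart s y x (adj-sym a) }

  private
    Separates : Subset n → Subset n → Set
    Separates U A = A ⊆ U × Nonempty A × Nonempty (U ─ A) × ¬ (∃[ x ] ∃[ y ] (x ∈ A × y ∈ U ─ A × Adj x y))

    Separates? : ∀ U A → Dec (Separates U A)
    Separates? U A = (A ⊆? U) ×-dec (nonempty? A ×-dec (nonempty? (U ─ A) ×-dec
      ¬? (any? (λ x → any? (λ y → (x ∈? A) ×-dec ((y ∈? (U ─ A)) ×-dec Adj? x y))))))

    separates-split : ∀ {U A} → Separates U A → Split U A (U ─ A)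
    separates-split (s , na , nb , ¬e) = record
      { parts = part-─ s ; neA = na ; neB = nb ; apart = λ {x} {y} x∈ y∈ a → ¬e (x , y , x∈ , y∈ , a) }

  abstract
    NoSplit-dec : ∀ U → NoSplit U ⊎ ∃[ A ] ∃[ B ] Split U A B
    NoSplit-dec U with anySubset? (Separates? U)
    ... | yes (A , s) = inj₂ (A , U ─ A , separates-split s)
    ... | no ¬s = inj₁ λ A B sp → ¬s (A , inˡ (parts sp) , neA sp
          , (let (b , b∈) = neB sp in b , ∈─ (inʳ (parts sp) b∈) (λ a → dis (parts sp) a b∈))
          , λ (x , y , x∈ , y∈ , a) → apart sp x∈
              ([ (λ p → ⊥-elim (─ʳ {p = U} y∈ p)) , (λ q → q) ]′ (cov (parts sp) (─ˡ {p = U} y∈))) a)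

    NoSplit? : ∀ U → Dec (NoSplit U)
    NoSplit? U with NoSplit-dec U
    ... | inj₁ ns = yes ns
    ... | inj₂ (A , B , s) = no λ ns → ns A B s

    connected-noSplit : ∀ {U} → ConnectedOn G U → NoSplit U
    connected-noSplit {U} (_ , h) A B s with h A (inˡ (parts s)) (neA s)
          (let (b , b∈) = neB s in b , ∈─ (inʳ (parts s) b∈) (λ a → dis (parts s) a b∈))
    ... | e , inj₁ (p , q) = apart s p ([ (λ r → ⊥-elim (─ʳ {p = U} q r)) , (λ r → r) ]′ (cov (parts s) (─ˡ {p = U} q))) (e , inj₁ (refl , refl))
    ... | e , inj₂ (p , q) = apart s p ([ (λ r → ⊥-elim (─ʳ {p = U} q r)) , (λ r → r) ]′ (cov (parts s) (─ˡ {p = U} q))) (e , inj₂ (refl , refl))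

    noSplit-connected : ∀ {U} → Nonempty U → NoSplit U → ConnectedOn G U
    noSplit-connected {U} ne ns = ne , λ A A⊆U na nb → edge A (decidable-stable
        (any? (λ x → any? (λ y → (x ∈? A) ×-dec ((y ∈? (U ─ A)) ×-dec Adj? x y))))
        (λ ¬e → ns A (U ─ A) (separates-split (A⊆U , na , nb , ¬e))))
      where
      edge : ∀ A → ∃[ x ] ∃[ y ] (x ∈ A × y ∈ U ─ A × Adj x y) →
        ∃[ e ] ((src G e ∈ A × tgt G e ∈ (U ─ A)) ⊎ (tgt G e ∈ A × src G e ∈ (U ─ A)))
      edge A (x , y , x∈ , y∈ , e , inj₁ (refl , refl)) = e , inj₁ (x∈ , y∈)
      edge A (x , y , x∈ , y∈ , e , inj₂ (refl , refl)) = e , inj₂ (x∈ , y∈)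

  noSplit-side : ∀ {U X Y} → NoSplit U → (∀ {x} → x ∈ U → x ∈ X ⊎ x ∈ Y) → (∀ {x y} → x ∈ X → y ∈ Y → ¬ Adj x y) →
    U ⊆ X ⊎ U ⊆ Y
  noSplit-side {U} {X} {Y} ns c ap with ⊆-or-witness U X
  ... | inj₁ s = inj₁ s
  ... | inj₂ (y , y∈U , y∉X) with ⊆-or-witness U Y
  ...   | inj₁ s = inj₂ s
  ...   | inj₂ (x , x∈U , x∉Y) = ⊥-elim (ns (U ∩ X) (U ─ (U ∩ X)) (record
            { parts = part-─ (p∩q⊆p U X)
            ; neA = x , x∈p∩q⁺ (x∈U , [ (λ q → q) , ⊥-elim ∘ x∉Y ]′ (c x∈U))
            ; neB = y , ∈─ y∈U (y∉X ∘ p∩q⊆q U X)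
            ; apart = λ a b → ap (p∩q⊆q U X a) (inY b) }))
    where
    inY : ∀ {z} → z ∈ U ─ (U ∩ X) → z ∈ Y
    inY z∈ = [ (λ q → ⊥-elim (─ʳ {p = U} z∈ (x∈p∩q⁺ (─ˡ {p = U} z∈ , q)))) , (λ q → q) ]′ (c (─ˡ {p = U} z∈))

  -- For `T₀ ⊆ U` this says that every component of the subgraph induced on `U` meets `T₀`. It is
  -- weaker than connectedness, so that a forest can grow from two disjoint cycles at once.
  Grows : Subset n → Subset n → Set
  Grows T₀ U = ∀ T → T₀ ⊆ T → T ⊆ U → ∃[ y ] (y ∈ U × y ∉ T) →
    ∃[ x ] ∃[ y ] (x ∈ T × y ∈ U × y ∉ T × Adj x y)

  noSplit-grows : ∀ {T₀ U} → Nonempty T₀ → NoSplit U → Grows T₀ U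
  noSplit-grows {T₀} {U} (t , t∈) ns T T₀⊆T T⊆U (z , z∈U , z∉T) =
    repack (decidable-stable (any? (λ x → any? (λ y → (x ∈? T) ×-dec ((y ∈? (U ─ T)) ×-dec Adj? x y))))
      (λ ¬e → ns T (U ─ T) (separates-split (T⊆U , (t , T₀⊆T t∈) , (z , ∈─ z∈U z∉T) , ¬e))))
    where
    repack : ∃[ x ] ∃[ y ] (x ∈ T × y ∈ U ─ T × Adj x y) → ∃[ x ] ∃[ y ] (x ∈ T × y ∈ U × y ∉ T × Adj x y)
    repack (x , y , x∈ , y∈ , a) = x , y , x∈ , ─ˡ {p = U} y∈ , ─ʳ {p = U} y∈ , a

  module _ (Φ : Subset n → Set) {T₀ U : Subset n} (T₀⊆U : T₀ ⊆ U) (grows : Grows T₀ U)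
    (step : ∀ {T x y} → T₀ ⊆ T → T ⊆ U → Φ T → x ∈ T → y ∈ U → y ∉ T → Adj x y → Φ (T ∪ ⁅ y ⁆)) where

    private
      go : ∀ T → Acc _<_ (n ∸ ∣ T ∣) → T₀ ⊆ T → T ⊆ U → Φ T → Φ U
      go T (acc rs) T₀⊆T T⊆U φ with ⊆-or-witness U T
      ... | inj₁ U⊆T = subst Φ (⊆-antisym T⊆U U⊆T) φ
      ... | inj₂ z with grows T T₀⊆T T⊆U z
      ...   | x , y , x∈T , y∈U , y∉T , a = go (T ∪ ⁅ y ⁆)
              (rs (∸-monoʳ-< (≤-reflexive (sym (card-insert y∉T))) (∣p∣≤n (T ∪ ⁅ y ⁆))))
              (∈∪ˡ ∘ T₀⊆T) (∪-lub {p = T} T⊆U (λ q → subst (_∈ U) (sym (sing≡ q)) y∈U))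
              (step T₀⊆T T⊆U φ x∈T y∈U y∉T a)

    grow : Φ T₀ → Φ U
    grow φ = go T₀ (<-wellFounded _) ⊆-refl T₀⊆U φ

  -- Each new vertex is joined by one edge that is pendant, up to loops that are not free, over
  -- everything chosen before; hence no circuit uses it. With `F` independent this enlarges an
  -- independent set, with `F` a flat it yields elements independent in the contraction.
  pendantForest : ∀ {F T₀ U} →
    (∀ {e} → e ∈ F → (∀ v → Inc G e v → v ∈ T₀) ⊎ (IsLoop G e × lab ⁅ e ⁆ ≢ fre)) →
    T₀ ⊆ U → Grows T₀ U →
    ∃[ K ] ((∀ {v} → V K v → v ∈ U) × ∣ K ∣ + ∣ T₀ ∣ ≡ ∣ U ∣ × (∀ {e} → e ∈ K → e ∉ F)
      × (∀ D → Circuit D → D ⊆ F ∪ K → D ⊆ F))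
  pendantForest {F} {T₀} {U} hF T₀⊆U grows = grow Φ T₀⊆U grows step start
    where
    Φ : Subset n → Set
    Φ T = ∃[ K ] ((∀ {v} → V K v → v ∈ T) × ∣ K ∣ + ∣ T₀ ∣ ≡ ∣ T ∣ × (∀ {e} → e ∈ K → e ∉ F)
      × (∀ D → Circuit D → D ⊆ F ∪ K → D ⊆ F))
    start : Φ T₀
    start = ∅ , (λ (e , e∈ , _) → ⊥-elim (∉⊥ e∈)) , cong (_+ ∣ T₀ ∣) (∣⊥∣≡0 m) , (λ e∈ → ⊥-elim (∉⊥ e∈))
      , λ D _ s e∈ → [ (λ q → q) , (λ q → ⊥-elim (∉⊥ q)) ]′ (∪-case (s e∈))
    step : ∀ {T x y} → T₀ ⊆ T → T ⊆ U → Φ T → x ∈ T → y ∈ U → y ∉ T → Adj x y → Φ (T ∪ ⁅ y ⁆)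
    step {T} {x} {y} T₀⊆T T⊆U (K , VK , size , K∩F , circ) x∈T y∈U y∉T (e , j) =
        K ∪ ⁅ e ⁆
      , (λ v → [ ∈∪ˡ ∘ VK , (λ q → [ (λ { refl → ∈∪ˡ x∈T }) , (λ { refl → ∈∪ʳ (x∈⁅x⁆ y) }) ]′ (joins-end j (V-sing q))) ]′ (V-∪ {K} v))
      , trans (cong (_+ ∣ T₀ ∣) (card-insert e∉K)) (trans (cong suc size) (sym (card-insert y∉T)))
      , (λ q → [ K∩F , (λ r → subst (_∉ F) (sym (sing≡ r)) e∉F) ]′ (∪-case q))
      , λ D c s → circ D c (λ {g} g∈ → [ ∈∪ˡ , (λ q → [ ∈∪ʳ , (λ r → ⊥-elim (no-circuit c (only D s) (subst (_∈ D) (sing≡ r) g∈))) ]′ (∪-case {p = K} q)) ]′ (∪-case {p = F} (s g∈)))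
      where
      x≢y : x ≢ y
      x≢y refl = y∉T x∈T
      ¬l : ¬ IsLoop G e
      ¬l = joins-nonloop j x≢y
      e∉K : e ∉ K
      e∉K q = y∉T (VK (e , q , joinsʳ j))
      e∉F : e ∉ F
      e∉F q = [ (λ h → y∉T (T₀⊆T (h y (joinsʳ j)))) , ¬l ∘ proj₁ ]′ (hF q)
      open Pendant ¬l (joinsʳ j)
      only : ∀ D → D ⊆ F ∪ K ∪ ⁅ e ⁆ → Only D
      only D s f∈ i with ∪-case {p = F} (s f∈)
      ... | inj₁ q = [ (λ h → ⊥-elim (y∉T (T₀⊆T (h y i)))) , inj₂ ]′ (hF q)
      ... | inj₂ r = [ (λ q → ⊥-elim (y∉T (VK (_ , q , i)))) , inj₁ ∘ sing≡ ]′ (∪-case {p = K} r)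

  extend : ∀ {I T₀ U} → Free I → (∀ {v} → V I v → v ∈ T₀) → ∣ I ∣ ≡ ∣ T₀ ∣ → T₀ ⊆ U → Grows T₀ U →
    ∃[ J ] (Free J × (∀ {v} → V J v → v ∈ U) × ∣ J ∣ ≡ ∣ U ∣)
  extend {I} {T₀} {U} free VI size T₀⊆U grows
    with pendantForest {I} {T₀} {U} (λ e∈ → inj₁ (λ v i → VI (_ , e∈ , i))) T₀⊆U grows
  ... | K , VK , sizeK , K∩I , circ = I ∪ K
      , (λ D c s → free D c (circ D c s))
      , (λ v → [ T₀⊆U ∘ VI , VK ]′ (V-∪ {I} v))
      , trans (card-split (part-∪ (λ p q → K∩I q p))) (trans (+-comm (∣ I ∣) (∣ K ∣)) (trans (cong (∣ K ∣ +_) size) sizeK))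

-- Rank is a relation, so values must be exhibited before a separation can be stated. The search
-- starts from the empty set, which is independent because circuits are nonempty.
rankExists : ∀ {m} (S : Subset m) (Circ : Subset m → Set) → (∀ X → Dec (Circ X)) → (∀ {D} → Circ D → Nonempty D) →
  ∀ X → ∃[ r ] Rank S Circ X r
rankExists S Circ Circ? ne X = repack (largestSubset {P = λ I → I ⊆ X × Indep S Circ I}
    (λ I → (I ⊆? X) ×-dec ((I ⊆? S) ×-dec allSubset? (λ D → Circ? D →-dec ¬? (D ⊆? I))))
    ∅ (⊥⊆ , ⊥⊆ , λ D c s → let (e , e∈) = ne c in ∉⊥ (s e∈)))
  where
  repack : ∃[ r ] ((∃[ I ] ((I ⊆ X × Indep S Circ I) × ∣ I ∣ ≡ r)) × (∀ I → (I ⊆ X × Indep S Circ I) → ∣ I ∣ ≤ r)) →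
    ∃[ r ] Rank S Circ X r
  repack (r , (I , (s , ind) , eq) , max) = r , (I , s , ind , eq) , λ J t ind → max J (t , ind)

contractCirc? : ∀ {m} {S : Subset m} {Circ : Subset m → Set} → (∀ X → Dec (Circ X)) → ∀ F C → Dec (ContractCirc S Circ F C)
contractCirc? Circ? F C = nonempty? C ×-dec (trace? C ×-dec
  allSubset? (λ C′ → nonempty? C′ →-dec (trace? C′ →-dec ((C′ ⊆? C) →-dec (C′ ≟ˢ C)))))
  where
  trace? = λ C → anySubset? (λ D → Circ? D ×-dec (C ≟ˢ D ─ F))

-- Contracting the closure of the edges inside a vertex set.

module Unbreak {n m : ℕ} (G : Graph n m) (lab : Subset m → Label) (qb : QuasiBiased G lab)
               (unbreakable : Unbreakable ⊤ (MCircuit G lab))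
               (connected : ∀ A B → ¬ Vertices.Split G lab ⊤ A B) where
  open Vertices G lab public

  module Contract {W : Subset n} {I : Subset m} (free : Free I) (VI : ∀ {v} → V I v → v ∈ W) (size : ∣ I ∣ ≡ ∣ W ∣) (neW : Nonempty W) where

    -- Rank at most |W|. A maximal set with this property above the edges inside `W` plays the role
    -- of their closure: adding any element raises the rank, which is flatness.
    Bounded : Subset m → Set
    Bounded F = ∀ J → J ⊆ F → Free J → ∣ J ∣ ≤ ∣ W ∣

    Bounded? : ∀ F → Dec (Bounded F)
    Bounded? F = allSubset? (λ J → (J ⊆? F) →-dec (Free? J →-dec (∣ J ∣ ≤? ∣ W ∣)))

    inside? : ∀ e → Dec (src G e ∈ W × tgt G e ∈ W)
    inside? e = (src G e ∈? W) ×-dec (tgt G e ∈? W)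

    I⊆inside : I ⊆ ⟪ inside? ⟫
    I⊆inside {e} e∈ = ∈⟪⟫ inside? (VI (e , e∈ , inj₁ refl) , VI (e , e∈ , inj₂ refl))

    inside-bounded : Bounded ⟪ inside? ⟫
    inside-bounded J s f = ≤-trans (free-card qb f) (p⊆q⇒∣p∣≤∣q∣ (VS⊆ {J} at))
      where
      at : ∀ {v} → V J v → v ∈ W
      at (e , e∈ , inj₁ refl) = proj₁ (⟪⟫∈ inside? (s e∈))
      at (e , e∈ , inj₂ refl) = proj₂ (⟪⟫∈ inside? (s e∈))

    module Flats (F : Subset m) (in⊆F : ⟪ inside? ⟫ ⊆ F) (bd : Bounded F) (max : ∀ Z → F ⊆ Z → Bounded Z → Z ⊆ F) where

      I⊆F : I ⊆ F
      I⊆F = in⊆F ∘ I⊆inside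

      not-extended : ∀ {e} → e ∈ F → e ∉ I → ¬ Free (I ∪ ⁅ e ⁆)
      not-extended {e} e∈F e∉I f = 1+n≰n (begin
        suc ∣ W ∣        ≡⟨ cong suc (sym size) ⟩
        suc ∣ I ∣        ≡⟨ sym (card-insert e∉I) ⟩
        ∣ I ∪ ⁅ e ⁆ ∣    ≤⟨ bd (I ∪ ⁅ e ⁆) (∪-lub {p = I} I⊆F (λ q → subst (_∈ F) (sym (sing≡ q)) e∈F)) f ⟩
        ∣ W ∣            ∎)
        where open ≤-Reasoning

      adjoin : ∀ {e} → (∀ {D} → Circuit D → D ⊆ I ∪ ⁅ e ⁆ → e ∉ D) → Free (I ∪ ⁅ e ⁆)
      adjoin {e} h D c s = free D c (λ {g} g∈ → [ (λ q → q) , (λ q → ⊥-elim (h c s (subst (_∈ D) (sing≡ q) g∈))) ]′ (∪-case (s g∈)))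

      -- Otherwise `e` would be pendant over `I`, or a free loop isolated from `I`, and adding it to
      -- `I` would give |W| + 1 independent edges inside `F`.
      outer : ∀ {e w} → e ∈ F → Inc G e w → w ∉ W → IsLoop G e × lab ⁅ e ⁆ ≢ fre
      outer {e} {w} e∈F i w∉W with src G e ≟ tgt G e
      ... | no ¬l = ⊥-elim (not-extended e∈F e∉I (adjoin λ {D} c s → no-circuit c (only D s)))
        where
        e∉I : e ∉ I
        e∉I q = w∉W (VI (e , q , i))
        open Pendant ¬l i
        only : ∀ D → D ⊆ I ∪ ⁅ e ⁆ → Only D
        only D s g∈ j = [ (λ q → ⊥-elim (w∉W (VI (_ , q , j)))) , inj₁ ∘ sing≡ ]′ (∪-case (s g∈))
      ... | yes l = l , loop-not-free
        where
        loop-not-free : lab ⁅ e ⁆ ≢ fre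
        loop-not-free f = not-extended e∈F (λ q → w∉W (VI (e , q , i))) (adjoin λ {D} c s → IsolatedLoop.no-circuit l i f c
          (λ g∈ j → [ (λ q → ⊥-elim (w∉W (VI (_ , q , j)))) , sing≡ ]′ (∪-case (s g∈))))

      ends : ∀ {e} → e ∈ F → (∀ v → Inc G e v → v ∈ W) ⊎ (IsLoop G e × lab ⁅ e ⁆ ≢ fre)
      ends {e} e∈F with src G e ∈? W | tgt G e ∈? W
      ... | yes p | yes q = inj₁ λ { v (inj₁ refl) → p ; v (inj₂ refl) → q }
      ... | no p  | _     = inj₂ (outer e∈F (inj₁ refl) p)
      ... | yes _ | no q  = inj₂ (outer e∈F (inj₂ refl) q)

      flat : Flat ⊤ Circuit F
      flat = ⊆⊤ , λ e _ e∉F a b (rankF , _) (_ , ub) → ≤-trans (s≤s (aBound rankF))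
          (≰⇒> (λ b≤ → e∉F (max (F ∪ ⁅ e ⁆) ∈∪ˡ (λ J s f → ≤-trans (ub J s (⊆⊤ , f)) b≤) (∈∪ʳ (x∈⁅x⁆ e)))))
        where
        aBound : ∀ {a} → ∃[ J ] (J ⊆ F × Indep ⊤ Circuit J × ∣ J ∣ ≡ a) → a ≤ ∣ W ∣
        aBound (J , s , (_ , f) , refl) = bd J s f

      Circ/F : Subset m → Set
      Circ/F = ContractCirc ⊤ Circuit F

      S : Subset m
      S = ⊤ ─ F

      -- A circuit inside `I ∪ J` either lies in `I` or has a nonempty trace outside `F`. A minimal
      -- trace below that one is a circuit of the contraction, and it lies in `J`.
      lift-free : ∀ {J} → Indep S Circ/F J → Free (I ∪ J)
      lift-free {J} (J⊆S , ind) D c s with nonempty? (D ─ F)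
      ... | no ¬ne = free D c λ {e} e∈ → [ (λ q → q) , (λ q → ⊥-elim (¬ne (e , ∈─ e∈ (─ʳ {p = ⊤} (J⊆S q))))) ]′ (∪-case (s e∈))
      ... | yes ne = use (minimalSubset {P = Trace} (λ C → nonempty? C ×-dec anySubset? (λ D → Circuit? D ×-dec (C ≟ˢ D ─ F)))
              (D ─ F) (ne , D , c , refl))
        where
        Trace : Subset m → Set
        Trace C = Nonempty C × ∃[ D ] (Circuit D × C ≡ D ─ F)
        use : ∃[ C ] (C ⊆ D ─ F × Trace C × (∀ Z → Z ⊆ C → Trace Z → C ⊆ Z)) → ⊥
        use (C , C⊆ , (neC , tr) , min) = ind C (neC , tr , λ C′ ne′ tr′ C′⊆C → ⊆-antisym C′⊆C (min C′ C′⊆C (ne′ , tr′)))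
          (λ {e} e∈ → [ (λ q → ⊥-elim (─ʳ {p = D} (C⊆ e∈) (I⊆F q))) , (λ q → q) ]′ (∪-case (s (─ˡ {p = D} (C⊆ e∈)))))

      -- `I` accounts for |W| edges of the independent set `I ∪ J`, which touches at most |W| + |Z|
      -- vertices.
      contract-bound : ∀ {J Z} → Indep S Circ/F J → (∀ {v} → V J v → v ∈ W ⊎ v ∈ Z) → (∀ {v} → v ∈ W → v ∉ Z) → ∣ J ∣ ≤ ∣ Z ∣
      contract-bound {J} {Z} ind VJ W∩Z = +-cancelˡ-≤ (∣ W ∣) _ _ (begin
        ∣ W ∣ + ∣ J ∣   ≡⟨ cong (_+ ∣ J ∣) (sym size) ⟩
        ∣ I ∣ + ∣ J ∣   ≡⟨ sym (card-split (part-∪ (λ i j → ─ʳ {p = ⊤} (proj₁ ind j) (I⊆F i)))) ⟩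
        ∣ I ∪ J ∣       ≤⟨ free-card qb (lift-free ind) ⟩
        ∣ VS (I ∪ J) ∣  ≤⟨ p⊆q⇒∣p∣≤∣q∣ (VS⊆ {I ∪ J} (λ v → [ ∈∪ˡ ∘ VI , x∈p∪q⁺ ∘ VJ ]′ (V-∪ {I} v))) ⟩
        ∣ W ∪ Z ∣       ≡⟨ card-split (part-∪ W∩Z) ⟩
        ∣ W ∣ + ∣ Z ∣   ∎)
        where open ≤-Reasoning

      module _ {A B : Subset n} (sp : Split (∁ W) A B) where

        A∌W : ∀ {v} → v ∈ A → v ∉ W
        A∌W a = x∈∁p⇒x∉p (inˡ (parts sp) a)

        B∌W : ∀ {v} → v ∈ B → v ∉ W
        B∌W b = x∈∁p⇒x∉p (inʳ (parts sp) b)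

        where? : ∀ v → v ∈ W ⊎ (v ∈ A ⊎ v ∈ B)
        where? v with v ∈? W
        ... | yes p = inj₁ p
        ... | no ¬p = inj₂ (cov (parts sp) (x∉p⇒x∈∁p ¬p))

        X? : ∀ e → Dec (e ∉ F × (src G e ∈ A ⊎ tgt G e ∈ A))
        X? e = ¬? (e ∈? F) ×-dec ((src G e ∈? A) ⊎-dec (tgt G e ∈? A))

        X : Subset m
        X = ⟪ X? ⟫

        touches : ∀ {e v} → Inc G e v → v ∈ A → src G e ∈ A ⊎ tgt G e ∈ A
        touches (inj₁ refl) a = inj₁ a
        touches (inj₂ refl) a = inj₂ a

        X⊆S : X ⊆ S
        X⊆S x = ∈─ ∈⊤ (proj₁ (⟪⟫∈ X? x))

        -- Connectedness gives an edge leaving `Z`. It is not in `F`, whose edges either lie within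
        -- `W` or are loops. Thus both sides of the separation are nonempty.
        leaving : ∀ {Z} → Nonempty Z → (∀ {v} → v ∈ Z → v ∉ W) → ∃[ e ] (e ∉ F × ∃[ v ] (v ∈ Z × Inc G e v))
        leaving {Z} ne Z∌W with noSplit-grows ne connected Z ⊆-refl ⊆⊤ (let (w , w∈) = neW in w , ∈⊤ , λ q → Z∌W q w∈)
        ... | x , y , x∈ , _ , y∉ , e , j = e , e∉F , x , x∈ , joinsˡ j
          where
          e∉F : e ∉ F
          e∉F q = [ (λ h → Z∌W x∈ (h x (joinsˡ j))) , (λ (l , _) → joins-nonloop j (λ { refl → y∉ x∈ }) l) ]′ (ends q)

        X-V : ∀ {J v} → J ⊆ X → V J v → v ∈ W ⊎ v ∈ A
        X-V {J} {v} s (e , e∈ , i) with where? v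
        ... | inj₁ w = inj₁ w
        ... | inj₂ (inj₁ a) = inj₂ a
        ... | inj₂ (inj₂ b) = ⊥-elim (other (proj₂ (⟪⟫∈ X? (s e∈))))
          where
          other : src G e ∈ A ⊎ tgt G e ∈ A → ⊥
          other (inj₁ a) = apart sp a b (e , inc-joins (inj₁ refl) i (λ { refl → dis (parts sp) a b }))
          other (inj₂ a) = apart sp a b (e , inc-joins (inj₂ refl) i (λ { refl → dis (parts sp) a b }))

        Y-V : ∀ {J v} → J ⊆ S ─ X → V J v → v ∈ W ⊎ v ∈ B
        Y-V {J} {v} s (e , e∈ , i) with where? v
        ... | inj₁ w = inj₁ w
        ... | inj₂ (inj₂ b) = inj₂ b
        ... | inj₂ (inj₁ a) = ⊥-elim (─ʳ {p = S} (s e∈) (∈⟪⟫ X? (─ʳ {p = ⊤} (─ˡ {p = S} (s e∈)) , touches i a)))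

        neX : 1 ≤ ∣ X ∣
        neX = let (e , e∉F , v , v∈ , i) = leaving (neA sp) A∌W in card-pos {e = e} (∈⟪⟫ X? (e∉F , touches i v∈))

        neY : 1 ≤ ∣ S ─ X ∣
        neY = let (e , e∉F , v , v∈ , i) = leaving (neB sp) B∌W in
          card-pos {e = e} (∈─ (∈─ ∈⊤ e∉F) (λ q → [ (λ w → B∌W v∈ w) , (λ a → dis (parts sp) a v∈) ]′
            (X-V {⁅ e ⁆} (λ r → subst (_∈ X) (sym (sing≡ r)) q) (sing-V i))))

        rank : ∀ Y → ∃[ r ] Rank S Circ/F Y r
        rank = rankExists S Circ/F (contractCirc? {S = ⊤} Circuit? F) proj₁

        rankX≤ : ∀ {a} → Rank S Circ/F X a → a ≤ ∣ A ∣
        rankX≤ ((J , s , ind , refl) , _) = contract-bound ind (X-V s) (λ w a → A∌W a w)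

        rankY≤ : ∀ {b} → Rank S Circ/F (S ─ X) b → b ≤ ∣ B ∣
        rankY≤ ((J , s , ind , refl) , _) = contract-bound ind (Y-V s) (λ w b → B∌W b w)

        -- A forest growing from `W` over the whole graph adds |A| + |B| edges that are independent
        -- modulo `F`.
        rankS≥ : ∀ {c} → Rank S Circ/F S c → ∣ A ∣ + ∣ B ∣ ≤ c
        rankS≥ {c} (_ , ub) = use (pendantForest {F} {W} {⊤} ends ⊆⊤ (noSplit-grows neW connected))
          where
          use : ∃[ K ] ((∀ {v} → V K v → v ∈ ⊤) × ∣ K ∣ + ∣ W ∣ ≡ ∣ ⊤ {n} ∣ × (∀ {e} → e ∈ K → e ∉ F)
            × (∀ D → Circuit D → D ⊆ F ∪ K → D ⊆ F)) → ∣ A ∣ + ∣ B ∣ ≤ c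
          use (K , _ , sizeK , K∩F , circ) = ≤-trans (≤-reflexive count) (ub K K⊆S (K⊆S , indep))
            where
            K⊆S : K ⊆ S
            K⊆S q = ∈─ ∈⊤ (K∩F q)
            indep : ∀ C → Circ/F C → ¬ (C ⊆ K)
            indep C ((e , e∈) , (D , c , refl) , _) s = ─ʳ {p = D} e∈ (circ D c
              (λ {g} g∈ → side g∈ (g ∈? F)) (─ˡ {p = D} e∈))
              where
              side : ∀ {g} → g ∈ D → Dec (g ∈ F) → g ∈ F ∪ K
              side g∈ (yes p) = ∈∪ˡ p
              side g∈ (no ¬p) = ∈∪ʳ (s (∈─ g∈ ¬p))
            count : ∣ A ∣ + ∣ B ∣ ≡ ∣ K ∣
            count = +-cancelʳ-≡ (∣ W ∣) _ _ (begin
              ∣ A ∣ + ∣ B ∣ + ∣ W ∣  ≡⟨ cong (_+ ∣ W ∣) (sym (card-split (parts sp))) ⟩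
              ∣ ∁ W ∣ + ∣ W ∣        ≡⟨ sym (card-split {Z = ⊤} (record { inˡ = λ _ → ∈⊤ ; inʳ = λ _ → ∈⊤
                                          ; cov = λ {x} _ → [ inj₂ , (λ q → inj₁ (inParts q)) ]′ (where? x)
                                          ; dis = x∈∁p⇒x∉p })) ⟩
              ∣ ⊤ {n} ∣              ≡⟨ sym sizeK ⟩
              ∣ K ∣ + ∣ W ∣          ∎)
              where
              open ≡-Reasoning
              inParts : ∀ {x} → x ∈ A ⊎ x ∈ B → x ∈ ∁ W
              inParts = [ inˡ (parts sp) , inʳ (parts sp) ]′

        absurd : ⊥
        absurd = go (rank X) (rank (S ─ X)) (rank S)
          where
          go : ∃[ a ] Rank S Circ/F X a → ∃[ b ] Rank S Circ/F (S ─ X) b → ∃[ c ] Rank S Circ/F S c → ⊥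
          go (a , ra) (b , rb) (c , rc) = proj₂ unbreakable F flat X
            (X⊆S , neX , neY , a , b , c , ra , rb , rc ,
             ≤-trans (s≤s (≤-trans (+-mono-≤ (rankX≤ ra) (rankY≤ rb)) (rankS≥ rc))) (≤-reflexive (+-comm 1 c)))

  -- If W supports an independent set of |W| edges, then contracting its closure leaves a connected matroid,
  -- so W cannot separate G.
  complement-noSplit : ∀ {I T₀ W} → Free I → (∀ {v} → V I v → v ∈ T₀) → ∣ I ∣ ≡ ∣ T₀ ∣ → Nonempty T₀ →
    T₀ ⊆ W → Grows T₀ W → NoSplit (∁ W)
  complement-noSplit {I} {T₀} {W} free VI size (t , t∈) T₀⊆W grows A B sp = use (extend free VI size T₀⊆W grows)
    where
    use : ∃[ J ] (Free J × (∀ {v} → V J v → v ∈ W) × ∣ J ∣ ≡ ∣ W ∣) → ⊥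
    use (J , fJ , VJ , sJ) = go (maximalSubset {P = Bounded} Bounded? ⟪ inside? ⟫ inside-bounded)
      where
      open Contract {W} {J} fJ VJ sJ (t , T₀⊆W t∈)
      go : ∃[ F ] (⟪ inside? ⟫ ⊆ F × Bounded F × (∀ Z → F ⊆ Z → Bounded Z → Z ⊆ F)) → ⊥
      go (F , in⊆F , bd , max) = Flats.absurd F in⊆F bd max sp

  -- The case of a connected `W` around an unbalanced cycle, which is independent and has as many
  -- edges as vertices.
  unb-noSplit : ∀ {C W} → Unb C → (∀ {v} → V C v → v ∈ W) → NoSplit W → NoSplit (∁ W)
  unb-noSplit {C} {W} u VC ns = complement-noSplit {C} {VS C} {W} (unb-free u) (inVS {C}) (cycle-card (proj₁ u)) ne
      (VS⊆ {C} VC) (noSplit-grows ne ns)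
    where
    ne : Nonempty (VS C)
    ne = let (e , e∈) = proj₁ (proj₁ u) in src G e , inVS {C} (e , e∈ , inj₁ refl)

-- If all cycles were balanced, the circuits would be exactly the cycles of `G`, since every other
-- kind of circuit contains an unbalanced cycle.
notGraphic⇒unbalanced : ∀ {n m} (G : Graph n m) (lab : Subset m → Label) → ¬ Graphic (MCircuit G lab) →
  ∃[ C ] (IsCycle G C × lab C ≢ bal)
notGraphic⇒unbalanced {n} {m} G lab ¬g with anySubset? (Circuits.Unb? G lab)
... | yes u = u
... | no ¬u = ⊥-elim (¬g (n , G , λ X → mk⇔ to (λ c → balCycle X c (balanced c))))
  where
  open Circuits G lab
  balanced : ∀ {C} → Cycle C → lab C ≡ bal
  balanced {C} c = decidable-stable (lab C ≟ᴸ bal) (λ l → ¬u (C , c , l))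
  thetaCycle : ∀ {T} → IsTheta G T → ∃[ C ] (C ⊆ T × Cycle C)
  thetaCycle {T} (_ , _ , u , w , u≢w , du , dw , d2) = hasCycle
      (let (e , e∈ , _) = d-V {T} {u} (≤-trans (s≤s z≤n) (≤-reflexive (sym du))) in e , e∈)
      (*-cancelˡ-≤ 2 (≤-trans (wsum≥2 {S = VS T} T≥2) (≤-reflexive (handshake T))))
    where
    T≥2 : ∀ {v} → v ∈ VS T → 2 ≤ d T v
    T≥2 {v} v∈ with v ≟ u | v ≟ w
    ... | yes refl | _ = ≤-trans (n≤1+n 2) (≤-reflexive (sym du))
    ... | no _ | yes refl = ≤-trans (n≤1+n 2) (≤-reflexive (sym dw))
    ... | no v≢u | no v≢w = ≤-reflexive (sym (d2 v (outVS {T} v∈) v≢u v≢w))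
  to : ∀ {X} → MCircuit G lab X → IsCycle G X
  to (balCycle C c _) = c
  to (theta T t h) = let (C , C⊆T , c) = thetaCycle t in ⊥-elim (h C c C⊆T (balanced c))
  to (tight C₁ C₂ (c₁ , _) l _) = ⊥-elim (l (balanced c₁))
  to (linPair C₁ C₂ c₁ _ _ l _) with trans (sym (balanced c₁)) l
  ... | ()
  to (loose C₁ C₂ P (c₁ , _) l _) with trans (sym (balanced c₁)) l
  ... | ()

-- Cuts of two vertices and their sides.

module Cuts {n m : ℕ} (G : Graph n m) (lab : Subset m → Label) (qb : QuasiBiased G lab)
            (threeConnected : ThreeConnected ⊤ (MCircuit G lab))
            (unbreakable : Unbreakable ⊤ (MCircuit G lab))
            (notGraphic : ¬ Graphic (MCircuit G lab))
            (connected : ∀ A B → ¬ Vertices.Split G lab ⊤ A B)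
            (connected₂ : ∀ x A B → ¬ Vertices.Split G lab (⊤ - x) A B) where
  open Unbreak G lab qb unbreakable connected public
  open Chords G lab public

  record Cut (A B : Subset n) (u v : Fin n) : Set where
    field
      neˡ   : Nonempty A
      neʳ   : Nonempty B
      u≢v   : u ≢ v
      u∉A   : u ∉ A
      v∉A   : v ∉ A
      u∉B   : u ∉ B
      v∉B   : v ∉ B
      A∩B   : ∀ {x} → x ∈ A → x ∉ B
      cover : ∀ x → x ∈ A ⊎ x ∈ B ⊎ x ≡ u ⊎ x ≡ v
      sep   : ∀ {x y} → x ∈ A → y ∈ B → ¬ Adj x y
  open Cut public

  cut-flip : ∀ {A B u v} → Cut A B u v → Cut B A u v
  cut-flip c = record
    { neˡ = neʳ c ; neʳ = neˡ c ; u≢v = u≢v c ; u∉A = u∉B c ; v∉A = v∉B c ; u∉B = u∉A c ; v∉B = v∉A c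
    ; A∩B = λ b a → A∩B c a b
    ; cover = λ x → [ inj₂ ∘ inj₁ , [ inj₁ , inj₂ ∘ inj₂ ]′ ]′ (cover c x)
    ; sep = λ b a e → sep c a b (adj-sym e) }

  cut-swap : ∀ {A B u v} → Cut A B u v → Cut A B v u
  cut-swap c = record
    { neˡ = neˡ c ; neʳ = neʳ c ; u≢v = u≢v c ∘ sym ; u∉A = v∉A c ; v∉A = u∉A c ; u∉B = v∉B c ; v∉B = u∉B c
    ; A∩B = A∩B c
    ; cover = λ x → [ inj₁ , [ inj₂ ∘ inj₁ , inj₂ ∘ inj₂ ∘ swap ]′ ]′ (cover c x)
    ; sep = sep c }

  _+⟨_,_⟩ : Subset n → Fin n → Fin n → Subset n
  A +⟨ u , v ⟩ = A ∪ ⁅ u ⁆ ∪ ⁅ v ⁆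

  ∈A : ∀ {A u v x} → x ∈ A → x ∈ A +⟨ u , v ⟩
  ∈A = ∈∪ˡ

  ∈u : ∀ {A u v} → u ∈ A +⟨ u , v ⟩
  ∈u {A} {u} = ∈∪ʳ {p = A} (∈∪ˡ (x∈⁅x⁆ u))

  ∈v : ∀ {A u v} → v ∈ A +⟨ u , v ⟩
  ∈v {A} {u} {v} = ∈∪ʳ {p = A} (∈∪ʳ {p = ⁅ u ⁆} (x∈⁅x⁆ v))

  case+ : ∀ {A u v x} → x ∈ A +⟨ u , v ⟩ → x ∈ A ⊎ x ≡ u ⊎ x ≡ v
  case+ {A} {u} {v} q = [ inj₁ , (λ r → inj₂ ([ inj₁ ∘ sing≡ , inj₂ ∘ sing≡ ]′ (∪-case {p = ⁅ u ⁆} r))) ]′ (∪-case {p = A} q)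

  card+ : ∀ {A u v} → u ∉ A → v ∉ A → u ≢ v → ∣ A +⟨ u , v ⟩ ∣ ≡ ∣ A ∣ + 2
  card+ {A} {u} {v} u∉ v∉ u≢v = trans (card-split (part-∪ {X = A} {⁅ u ⁆ ∪ ⁅ v ⁆}
      (λ a q → [ (λ r → u∉ (subst (_∈ A) (sing≡ r) a)) , (λ r → v∉ (subst (_∈ A) (sing≡ r) a)) ]′ (∪-case {p = ⁅ u ⁆} q))))
    (cong (∣ A ∣ +_) (trans (card-insert {X = ⁅ u ⁆} {v} (λ q → u≢v (sym (sing≡ q)))) (cong suc (∣⁅x⁆∣≡1 u))))

  cut-size : ∀ {A B u v} → Cut A B u v → ∣ A ∣ + ∣ B ∣ + 2 ≡ n
  cut-size {A} {B} {u} {v} c = sym (begin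
    n                          ≡⟨ sym (∣⊤∣≡n n) ⟩
    ∣ ⊤ {n} ∣                  ≡⟨ card-split {Z = ⊤ {n}} {B +⟨ u , v ⟩} {A} (record { inˡ = λ _ → ∈⊤ ; inʳ = λ _ → ∈⊤
                                    ; cov = λ {x} _ → [ inj₂ , [ inj₁ ∘ ∈A , inj₁ ∘ [ (λ { refl → ∈u {B} }) , (λ { refl → ∈v {B} }) ]′ ]′ ]′ (cover c x)
                                    ; dis = λ p a → [ (λ b → A∩B c a b) , [ (λ { refl → u∉A c a }) , (λ { refl → v∉A c a }) ]′ ]′ (case+ {B} p) }) ⟩
    ∣ B +⟨ u , v ⟩ ∣ + ∣ A ∣   ≡⟨ cong (_+ ∣ A ∣) (card+ (u∉B c) (v∉B c) (u≢v c)) ⟩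
    ∣ B ∣ + 2 + ∣ A ∣          ≡⟨ solve 2 (λ b a → b :+ con 2 :+ a := a :+ b :+ con 2) refl (∣ B ∣) (∣ A ∣) ⟩
    ∣ A ∣ + ∣ B ∣ + 2          ∎)
    where
    open ≡-Reasoning
    open +-*-Solver

  -- Otherwise removing `v` alone would separate `A` from `u`.
  attach : ∀ {A B u v} → Cut A B u v → ∃[ a ] (a ∈ A × Adj u a)
  attach {A} {B} {u} {v} c = decidable-stable (any? (λ a → (a ∈? A) ×-dec Adj? u a)) λ ¬e →
    connected₂ v A (B ∪ ⁅ u ⁆) (record
      { parts = record
          { inˡ = λ a → ∈- ∈⊤ (λ { refl → v∉A c a })
          ; inʳ = λ q → ∈- ∈⊤ ([ (λ { b refl → v∉B c b }) , (λ r eq → u≢v c (trans (sym (sing≡ r)) eq)) ]′ (∪-case q))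
          ; cov = λ {x} q → [ inj₁ , [ inj₂ ∘ ∈∪ˡ , [ (λ { refl → inj₂ (∈∪ʳ (x∈⁅x⁆ u)) }) , (λ x≡v → ⊥-elim (-≢ {p = ⊤} q x≡v)) ]′ ]′ ]′ (cover c x)
          ; dis = λ a q → [ A∩B c a , (λ r → u∉A c (subst (_∈ A) (sing≡ r) a)) ]′ (∪-case q) }
      ; neA = neˡ c
      ; neB = u , ∈∪ʳ (x∈⁅x⁆ u)
      ; apart = λ {x} {y} a q e → [ (λ b → sep c a b e) , (λ r → ¬e (x , a , adj-sym (subst (Adj x) (sing≡ r) e))) ]′ (∪-case q) })

  touching? : ∀ A e → Dec (∃[ a ] (a ∈ A × Inc G e a))
  touching? A e = any? (λ a → (a ∈? A) ×-dec Inc? e a)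

  Touching : Subset n → Subset m
  Touching A = ⟪ touching? A ⟫

  touching-V : ∀ {A B u v J x} → Cut A B u v → J ⊆ Touching A → V J x → x ∈ A +⟨ u , v ⟩
  touching-V {A} {B} {u} {v} {J} {x} c s (e , e∈ , i) with cover c x | ⟪⟫∈ (touching? A) (s e∈)
  ... | inj₁ a | _ = ∈A a
  ... | inj₂ (inj₂ (inj₁ refl)) | _ = ∈u {A}
  ... | inj₂ (inj₂ (inj₂ refl)) | _ = ∈v {A}
  ... | inj₂ (inj₁ b) | a , a∈ , j = ⊥-elim (sep c a∈ b (e , inc-joins j i (λ { refl → A∩B c a∈ b })))

  rest-V : ∀ {A B u v J x} → Cut A B u v → J ⊆ ⊤ ─ Touching A → V J x → x ∈ B +⟨ u , v ⟩
  rest-V {A} {B} {u} {v} {J} {x} c s (e , e∈ , i) with cover c x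
  ... | inj₁ a = ⊥-elim (─ʳ {p = ⊤} (s e∈) (∈⟪⟫ (touching? A) (x , a , i)))
  ... | inj₂ (inj₁ b) = ∈A b
  ... | inj₂ (inj₂ (inj₁ refl)) = ∈u {B}
  ... | inj₂ (inj₂ (inj₂ refl)) = ∈v {B}

  two-touching : ∀ {A B u v} → Cut A B u v → 2 ≤ ∣ Touching A ∣
  two-touching {A} {B} {u} {v} c = use (attach c) (attach (cut-swap c))
    where
    use : ∃[ a ] (a ∈ A × Adj u a) → ∃[ a ] (a ∈ A × Adj v a) → 2 ≤ ∣ Touching A ∣
    use (a , a∈ , e , j) (a′ , a′∈ , e′ , j′) = card-two {e = e} {e′} (∈⟪⟫ (touching? A) (a , a∈ , joinsʳ j))
      (∈⟪⟫ (touching? A) (a′ , a′∈ , joinsʳ j′)) (λ { refl → [ (λ { refl → u≢v c refl }) , (λ { refl → u∉A c a′∈ }) ]′ (joins-end j′ (joinsˡ j)) })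

  -- The whole matroid has rank at least n: an unbalanced cycle is extended by pendant edges to all
  -- vertices.
  spanning : ∃[ J ] (Free J × ∣ J ∣ ≡ n)
  spanning = use (notGraphic⇒unbalanced G lab notGraphic)
    where
    use : ∃[ C ] (Unb C) → ∃[ J ] (Free J × ∣ J ∣ ≡ n)
    use (C , u) = repack (extend {C} {VS C} {⊤} (unb-free u) (inVS {C}) (cycle-card (proj₁ u)) ⊆⊤
        (noSplit-grows (let (e , e∈) = proj₁ (proj₁ u) in src G e , inVS {C} (e , e∈ , inj₁ refl)) connected))
      where
      repack : ∃[ J ] (Free J × (∀ {v} → V J v → v ∈ ⊤) × ∣ J ∣ ≡ ∣ ⊤ {n} ∣) → ∃[ J ] (Free J × ∣ J ∣ ≡ n)
      repack (J , f , _ , eq) = J , f , trans eq (∣⊤∣≡n n)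

  -- Otherwise the edges meeting A would form one side of a 2-separation.
  sideCycle : ∀ {A B u v} → Cut A B u v → ∃[ C ] (Unb C × C ⊆ Touching A)
  sideCycle {A} {B} {u} {v} c = decidable-stable (anySubset? (λ C → Unb? C ×-dec (C ⊆? Touching A))) contra
    where
    X = Touching A
    rank : ∀ Y → ∃[ r ] Rank ⊤ Circuit Y r
    rank = rankExists ⊤ Circuit Circuit? circuit-nonempty
    contra : ¬ ¬ (∃[ C ] (Unb C × C ⊆ X))
    contra none = go (rank X) (rank (⊤ ─ X)) (rank ⊤)
      where
      -- A cycle in an independent `J` is unbalanced. If no such cycle lies among the edges meeting
      -- `A`, then `J` has fewer edges than vertices, and this strict inequality supplies the one
      -- unit that a 2-separation needs.
      rankX : ∀ {a} → Rank ⊤ Circuit X a → a < ∣ A ∣ + 2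
      rankX ((J , s , (_ , f) , refl) , _) with nonempty? J
      ... | no ¬ne = ≤-trans (s≤s (≤-reflexive (trans (cong ∣_∣ (Empty-unique ¬ne)) (∣⊥∣≡0 m)))) (≤-trans (s≤s z≤n) (m≤n+m 2 _))
      ... | yes ne = ≤-trans (≰⇒> dense) (≤-trans (p⊆q⇒∣p∣≤∣q∣ (VS⊆ {J} (touching-V {J = J} c s))) (≤-reflexive (card+ (u∉A c) (v∉A c) (u≢v c))))
        where
        dense : ¬ (∣ VS J ∣ ≤ ∣ J ∣)
        dense le = let (C , C⊆J , cy) = hasCycle ne le in none (C , (cy , free-cycle-unb f C⊆J cy) , s ∘ C⊆J)
      rankY : ∀ {b} → Rank ⊤ Circuit (⊤ ─ X) b → b ≤ ∣ B ∣ + 2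
      rankY ((J , s , (_ , f) , refl) , _) = ≤-trans (free-card qb f)
        (≤-trans (p⊆q⇒∣p∣≤∣q∣ (VS⊆ {J} (rest-V {J = J} c s))) (≤-reflexive (card+ (u∉B c) (v∉B c) (u≢v c))))
      go : ∃[ a ] Rank ⊤ Circuit X a → ∃[ b ] Rank ⊤ Circuit (⊤ ─ X) b → ∃[ r ] Rank ⊤ Circuit ⊤ r → ⊥
      go (a , ra) (b , rb) (r , rr) = proj₂ (threeConnected X) (⊆⊤ , two-touching c
        , ≤-trans (two-touching (cut-flip c)) (p⊆q⇒∣p∣≤∣q∣ rest) , a , b , r , ra , rb , rr , bound)
        where
        rest : Touching B ⊆ ⊤ ─ X
        rest {e} q = ∈─ ∈⊤ λ x → clash (⟪⟫∈ (touching? B) q) (⟪⟫∈ (touching? A) x)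
          where
          clash : ∃[ b ] (b ∈ B × Inc G e b) → ∃[ a ] (a ∈ A × Inc G e a) → ⊥
          clash (b , b∈ , i) (a , a∈ , j) = sep c a∈ b∈ (e , inc-joins j i (λ { refl → A∩B c a∈ b∈ }))
        full : n ≤ r
        full = let (J , f , eq) = spanning in subst (_≤ r) eq (proj₂ rr J ⊆⊤ (⊆⊤ , f))
        bound : a + b < r + 2
        bound = begin-strict
          a + b                      <⟨ +-mono-<-≤ (rankX ra) (rankY rb) ⟩
          ∣ A ∣ + 2 + (∣ B ∣ + 2)    ≡⟨ solve 2 (λ a b → a :+ con 2 :+ (b :+ con 2) := a :+ b :+ con 2 :+ con 2) refl (∣ A ∣) (∣ B ∣) ⟩
          ∣ A ∣ + ∣ B ∣ + 2 + 2      ≡⟨ cong (_+ 2) (cut-size c) ⟩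
          n + 2                      ≤⟨ +-monoˡ-≤ 2 full ⟩
          r + 2                      ∎
          where
          open ≤-Reasoning
          open +-*-Solver

  -- The form in which the absence of cut vertices is used: `s` would separate `Y` from `z`.
  isolated : ∀ {Y s z} → Nonempty Y → s ∉ Y → z ∉ Y → z ≢ s →
    (∀ {x y} → x ∈ Y → y ∉ Y → y ≢ s → ¬ Adj x y) → ⊥
  isolated {Y} {s} {z} ne s∉ z∉ z≢s ap = connected₂ s Y ((⊤ - s) ─ Y) (record
    { parts = part-─ (λ y → ∈- ∈⊤ (λ { refl → s∉ y }))
    ; neA = ne
    ; neB = z , ∈─ (∈- ∈⊤ z≢s) z∉
    ; apart = λ x y → ap x (─ʳ {p = ⊤ - s} y) (-≢ {p = ⊤} (─ˡ {p = ⊤ - s} y)) })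

  pair : Fin n → Fin n → Subset n
  pair a b = ⁅ a ⁆ ∪ ⁅ b ⁆

  ∉pair : ∀ {a b x} → x ≢ a → x ≢ b → x ∈ ∁ (pair a b)
  ∉pair {a} p q = x∉p⇒x∈∁p (λ r → [ p ∘ sing≡ , q ∘ sing≡ ]′ (∪-case {p = ⁅ a ⁆} r))

  ∈∁pairˡ : ∀ {a b x} → x ∈ ∁ (pair a b) → x ≢ a
  ∈∁pairˡ q refl = x∈∁p⇒x∉p q (∈∪ˡ (x∈⁅x⁆ _))

  ∈∁pairʳ : ∀ {a b x} → x ∈ ∁ (pair a b) → x ≢ b
  ∈∁pairʳ {a} q refl = x∈∁p⇒x∉p q (∈∪ʳ {p = ⁅ a ⁆} (x∈⁅x⁆ _))

  pair-split : ∀ {a b} → a ≢ b → ¬ Adj a b → Split (∁ (∁ (pair a b))) ⁅ a ⁆ ⁅ b ⁆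
  pair-split {a} {b} a≢b ¬adj = record
    { parts = record
        { inˡ = λ q → x∉p⇒x∈∁p (λ r → ∈∁pairˡ r (sing≡ q))
        ; inʳ = λ q → x∉p⇒x∈∁p (λ r → ∈∁pairʳ {a} r (sing≡ q))
        ; cov = λ q → ∪-case {p = ⁅ a ⁆} (x∉∁p⇒x∈p (x∈∁p⇒x∉p q))
        ; dis = λ p q → a≢b (trans (sym (sing≡ p)) (sing≡ q)) }
    ; neA = a , x∈⁅x⁆ a
    ; neB = b , x∈⁅x⁆ b
    ; apart = λ p q e → ¬adj (subst (λ t → Adj t b) (sing≡ p) (subst (Adj _) (sing≡ q) e)) }

  -- All vertices but `a` and `b` would form a connected set around an unbalanced cycle, and then
  -- the pair itself would have to be connected.
  nonadjacent-pair : ∀ {C a b} → a ≢ b → ¬ Adj a b → Unb C → ¬ V C a → ¬ V C b → ¬ NoSplit (∁ (pair a b))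
  nonadjacent-pair {C} {a} {b} a≢b ¬adj u ¬a ¬b ns = unb-noSplit u
    (λ v → ∉pair (λ { refl → ¬a v }) (λ { refl → ¬b v })) ns ⁅ a ⁆ ⁅ b ⁆ (pair-split a≢b ¬adj)

  noSplit-sing : ∀ u → NoSplit ⁅ u ⁆
  noSplit-sing u A B s = let (a , a∈) = neA s ; (b , b∈) = neB s in
    dis (parts s) a∈ (subst (_∈ B) (trans (sing≡ (inʳ (parts s) b∈)) (sym (sing≡ (inˡ (parts s) a∈)))) b∈)

  noSplit-insert : ∀ {U x c} → NoSplit U → x ∈ U → Adj x c → NoSplit (U ∪ ⁅ c ⁆)
  noSplit-insert {U} {x} {c} ns x∈ adj A B s = go A B s (noSplit-side ns (cov (parts s) ∘ ∈∪ˡ) (apart s))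
    where
    fin : ∀ A B → Split (U ∪ ⁅ c ⁆) A B → U ⊆ A → ⊥
    fin A B s U⊆A = let (b , b∈) = neB s in
      [ (λ q → dis (parts s) (U⊆A q) b∈)
      , (λ q → apart s (U⊆A x∈) (subst (_∈ B) (sing≡ q) b∈) adj) ]′ (∪-case (inʳ (parts s) b∈))
    go : ∀ A B → Split (U ∪ ⁅ c ⁆) A B → U ⊆ A ⊎ U ⊆ B → ⊥
    go A B s (inj₁ q) = fin A B s q
    go A B s (inj₂ q) = fin B A (split-swap s) q

  -- A part holding neither `u` nor `v` would have no neighbours outside the other part and leave a
  -- cut vertex. If the parts hold one end each, each consists of that end alone, which would
  -- otherwise be a cut vertex, and no room is left for `B`.
  side-noSplit : ∀ {A B u v} → Cut A B u v → NoSplit (B +⟨ u , v ⟩)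
  side-noSplit {A} {B} {u} {v} c X Y s = go (cov (parts s) (∈u {B})) (cov (parts s) (∈v {B}))
    where
    noEnds : ∀ X Y → Split (B +⟨ u , v ⟩) X Y → u ∈ X → v ∈ X → ⊥
    noEnds X Y s uX vX = isolated {Y} {u} {v} (neB s) (dis (parts s) uX) (dis (parts s) vX) (u≢v c ∘ sym) (λ {x} {y} x∈ y∉ _ e → out x∈ y∉ e (cover c y))
      where
      inB : ∀ {x} → x ∈ Y → x ∈ B
      inB x∈ = [ (λ q → q) , [ (λ { refl → ⊥-elim (dis (parts s) uX x∈) }) , (λ { refl → ⊥-elim (dis (parts s) vX x∈) }) ]′ ]′ (case+ {B} (inʳ (parts s) x∈))
      toX : ∀ {y} → y ∉ Y → y ∈ B +⟨ u , v ⟩ → y ∈ X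
      toX y∉ q = [ (λ r → r) , ⊥-elim ∘ y∉ ]′ (cov (parts s) q)
      out : ∀ {x y} → x ∈ Y → y ∉ Y → Adj x y → y ∈ A ⊎ y ∈ B ⊎ y ≡ u ⊎ y ≡ v → ⊥
      out x∈ y∉ e (inj₁ a) = sep c a (inB x∈) (adj-sym e)
      out x∈ y∉ e (inj₂ (inj₁ b)) = apart s (toX y∉ (∈A b)) x∈ (adj-sym e)
      out x∈ y∉ e (inj₂ (inj₂ (inj₁ refl))) = apart s uX x∈ (adj-sym e)
      out x∈ y∉ e (inj₂ (inj₂ (inj₂ refl))) = apart s vX x∈ (adj-sym e)
    single : ∀ {u v} → Cut A B u v → ∀ X Y → Split (B +⟨ u , v ⟩) X Y → u ∈ X → v ∈ Y → ∀ {x} → x ∈ X → x ≡ u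
    single {u} {v} c X Y s uX vY {x} x∈ = decidable-stable (x ≟ u) λ x≢u →
      isolated {X - u} {u} {v} (x , ∈- x∈ x≢u) (λ q → -≢ {p = X} q refl) (λ q → dis (parts s) (-ˡ {p = X} q) vY) (u≢v c ∘ sym)
        (λ {a} {b} a∈ b∉ b≢u e → out a∈ b∉ b≢u e (cover c b))
      where
      inB : ∀ {x} → x ∈ X - u → x ∈ B
      inB x∈ = [ (λ q → q) , [ (λ q → ⊥-elim (-≢ {p = X} x∈ q)) , (λ { refl → ⊥-elim (dis (parts s) (-ˡ {p = X} x∈) vY) }) ]′ ]′ (case+ {B} (inˡ (parts s) (-ˡ {p = X} x∈)))
      out : ∀ {x y} → x ∈ X - u → y ∉ X - u → y ≢ u → Adj x y → y ∈ A ⊎ y ∈ B ⊎ y ≡ u ⊎ y ≡ v → ⊥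
      out x∈ y∉ y≢u e (inj₁ a) = sep c a (inB x∈) (adj-sym e)
      out x∈ y∉ y≢u e (inj₂ (inj₁ b)) = [ (λ q → y∉ (∈- q y≢u)) , (λ q → apart s (-ˡ {p = X} x∈) q e) ]′ (cov (parts s) (∈A b))
      out x∈ y∉ y≢u e (inj₂ (inj₂ (inj₁ q))) = y≢u q
      out x∈ y∉ y≢u e (inj₂ (inj₂ (inj₂ refl))) = apart s (-ˡ {p = X} x∈) vY e
    reorder : ∀ {X Y} → Split (B +⟨ u , v ⟩) X Y → Split (B +⟨ v , u ⟩) Y X
    reorder s = record
      { parts = record
          { inˡ = λ q → flip+ (case+ {B} (inʳ (parts s) q)) ; inʳ = λ q → flip+ (case+ {B} (inˡ (parts s) q))
          ; cov = λ q → swap (cov (parts s) (flip+ (case+ {B} q))) ; dis = λ p q → dis (parts s) q p }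
      ; neA = neB s ; neB = neA s ; apart = λ x y e → apart s y x (adj-sym e) }
      where
      flip+ : ∀ {p q x} → x ∈ B ⊎ x ≡ p ⊎ x ≡ q → x ∈ B +⟨ q , p ⟩
      flip+ (inj₁ b) = ∈A b
      flip+ (inj₂ (inj₁ refl)) = ∈v {B}
      flip+ (inj₂ (inj₂ refl)) = ∈u {B}
    separated : ∀ X Y → Split (B +⟨ u , v ⟩) X Y → u ∈ X → v ∈ Y → ⊥
    separated X Y s uX vY = let (b , b∈) = neʳ c in
      [ (λ q → u∉B c (subst (_∈ B) (single c X Y s uX vY q) b∈))
      , (λ q → v∉B c (subst (_∈ B) (single (cut-swap c) Y X (reorder s) vY uX q) b∈)) ]′ (cov (parts s) (∈A b∈))
    go : u ∈ X ⊎ u ∈ Y → v ∈ X ⊎ v ∈ Y → ⊥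
    go (inj₁ p) (inj₁ q) = noEnds X Y s p q
    go (inj₂ p) (inj₂ q) = noEnds Y X (split-swap s) p q
    go (inj₁ p) (inj₂ q) = separated X Y s p q
    go (inj₂ p) (inj₁ q) = separated Y X (split-swap s) p q

  -- A part holding neither `u` nor `v` would be cut off by `a` alone.
  ends-apart : ∀ {A B u v a X Y} → Cut A B u v → a ∈ A → Split ((A +⟨ u , v ⟩) - a) X Y → (u ∈ X × v ∈ Y) ⊎ (u ∈ Y × v ∈ X)
  ends-apart {A} {B} {u} {v} {a} {X} {Y} c a∈ s = go (cov (parts s) u∈) (cov (parts s) v∈)
    where
    u∈ : u ∈ (A +⟨ u , v ⟩) - a
    u∈ = ∈- (∈u {A}) (λ { refl → u∉A c a∈ })
    v∈ : v ∈ (A +⟨ u , v ⟩) - a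
    v∈ = ∈- (∈v {A}) (λ { refl → v∉A c a∈ })
    same : ∀ X Y → Split ((A +⟨ u , v ⟩) - a) X Y → u ∈ X → v ∈ X → ⊥
    same X Y s uX vX = isolated {Y} {a} {u} (neB s) (λ q → -≢ {p = A +⟨ u , v ⟩} (inʳ (parts s) q) refl)
        (dis (parts s) uX) (λ { refl → u∉A c a∈ }) (λ {x} {y} x∈ y∉ y≢a e → out x∈ y∉ y≢a e (cover c y))
      where
      inA : ∀ {x} → x ∈ Y → x ∈ A
      inA x∈ = [ (λ q → q) , [ (λ { refl → ⊥-elim (dis (parts s) uX x∈) }) , (λ { refl → ⊥-elim (dis (parts s) vX x∈) }) ]′ ]′
        (case+ {A} (-ˡ {p = A +⟨ u , v ⟩} (inʳ (parts s) x∈)))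
      out : ∀ {x y} → x ∈ Y → y ∉ Y → y ≢ a → Adj x y → y ∈ A ⊎ y ∈ B ⊎ y ≡ u ⊎ y ≡ v → ⊥
      out x∈ y∉ y≢a e (inj₁ q) = [ (λ r → apart s r x∈ (adj-sym e)) , y∉ ]′ (cov (parts s) (∈- (∈A q) y≢a))
      out x∈ y∉ y≢a e (inj₂ (inj₁ b)) = sep c (inA x∈) b e
      out x∈ y∉ y≢a e (inj₂ (inj₂ (inj₁ refl))) = apart s uX x∈ (adj-sym e)
      out x∈ y∉ y≢a e (inj₂ (inj₂ (inj₂ refl))) = apart s vX x∈ (adj-sym e)
    go : u ∈ X ⊎ u ∈ Y → v ∈ X ⊎ v ∈ Y → (u ∈ X × v ∈ Y) ⊎ (u ∈ Y × v ∈ X)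
    go (inj₁ p) (inj₁ q) = ⊥-elim (same X Y s p q)
    go (inj₂ p) (inj₂ q) = ⊥-elim (same Y X (split-swap s) p q)
    go (inj₁ p) (inj₂ q) = inj₁ (p , q)
    go (inj₂ p) (inj₁ q) = inj₂ (p , q)

  -- Once `s` separates `u` from `v` within a side, the part at `u` becomes a side of its own, and
  -- the part at `v` merges with `B`. This allows induction on the size of a side.
  subcut : ∀ {A B u v s X Y} → Cut A B u v → s ∈ A → Split ((A +⟨ u , v ⟩) - s) X Y → u ∈ X → v ∈ Y →
    ∀ {x} → x ∈ X → x ≢ u → ∃[ B′ ] (Cut (X - u) B′ u s)
  subcut {A} {B} {u} {v} {s} {X} {Y} c s∈ sp uX vY {x} x∈ x≢u = B ∪ Y , record
    { neˡ = x , ∈- x∈ x≢u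
    ; neʳ = v , ∈∪ʳ vY
    ; u≢v = λ { refl → u∉A c s∈ }
    ; u∉A = λ q → -≢ {p = X} q refl
    ; v∉A = λ q → -≢ {p = A +⟨ u , v ⟩} (inˡ (parts sp) (-ˡ {p = X} q)) refl
    ; u∉B = λ q → [ u∉B c , dis (parts sp) uX ]′ (∪-case q)
    ; v∉B = λ q → [ A∩B c s∈ , (λ r → -≢ {p = A +⟨ u , v ⟩} (inʳ (parts sp) r) refl) ]′ (∪-case q)
    ; A∩B = λ p q → [ A∩B c (inA p) , dis (parts sp) (-ˡ {p = X} p) ]′ (∪-case q)
    ; cover = λ y → place y (y ≟ u) (y ≟ s) (cover c y)
    ; sep = λ p q e → [ (λ b → sep c (inA p) b e) , (λ y → apart sp (-ˡ {p = X} p) y e) ]′ (∪-case q) }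
    where
    inA : ∀ {y} → y ∈ X - u → y ∈ A
    inA q = [ (λ r → r) , [ (λ r → ⊥-elim (-≢ {p = X} q r)) , (λ { refl → ⊥-elim (dis (parts sp) (-ˡ {p = X} q) vY) }) ]′ ]′
      (case+ {A} (-ˡ {p = A +⟨ u , v ⟩} (inˡ (parts sp) (-ˡ {p = X} q))))
    place : ∀ y → Dec (y ≡ u) → Dec (y ≡ s) → y ∈ A ⊎ y ∈ B ⊎ y ≡ u ⊎ y ≡ v → y ∈ X - u ⊎ y ∈ B ∪ Y ⊎ y ≡ u ⊎ y ≡ s
    place y (yes p) _ _ = inj₂ (inj₂ (inj₁ p))
    place y (no _) (yes p) _ = inj₂ (inj₂ (inj₂ p))
    place y (no p) (no q) (inj₂ (inj₁ b)) = inj₂ (inj₁ (∈∪ˡ b))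
    place y (no p) (no q) (inj₂ (inj₂ (inj₁ r))) = ⊥-elim (p r)
    place y (no p) (no q) (inj₂ (inj₂ (inj₂ refl))) = inj₂ (inj₁ (∈∪ʳ vY))
    place y (no p) (no q) (inj₁ a) = [ (λ r → inj₁ (∈- r p)) , (λ r → inj₂ (inj₁ (∈∪ʳ r))) ]′ (cov (parts sp) (∈- (∈A a) q))

  -- The only two neighbours of a vertex form a cut with a one-vertex side, so `sideCycle` yields an
  -- unbalanced cycle within `a`, `y` and `z`. The vertex `t` keeps the opposite side nonempty.
  module DegreeTwo {a y z : Fin n} (a≢y : a ≢ y) (a≢z : a ≢ z) (y≢z : y ≢ z)
    (nbrs : ∀ {x} → Adj a x → x ≡ a ⊎ x ≡ y ⊎ x ≡ z) {t : Fin n} (t≢a : t ≢ a) (t≢y : t ≢ y) (t≢z : t ≢ z) where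

    rest : Subset n
    rest = ∁ (⁅ a ⁆ +⟨ y , z ⟩)

    ∈rest : ∀ {x} → x ≢ a → x ≢ y → x ≢ z → x ∈ rest
    ∈rest p q r = x∉p⇒x∈∁p (λ t → [ p ∘ sing≡ , [ q , r ]′ ]′ (case+ {⁅ a ⁆} t))

    rest∌ : ∀ {x} → x ∈ rest → x ∉ ⁅ a ⁆ +⟨ y , z ⟩
    rest∌ = x∈∁p⇒x∉p

    cut : Cut ⁅ a ⁆ rest y z
    cut = record
      { neˡ = a , x∈⁅x⁆ a
      ; neʳ = t , ∈rest t≢a t≢y t≢z
      ; u≢v = y≢z
      ; u∉A = λ q → a≢y (sym (sing≡ q)) ; v∉A = λ q → a≢z (sym (sing≡ q))
      ; u∉B = λ q → rest∌ q (∈u {⁅ a ⁆}) ; v∉B = λ q → rest∌ q (∈v {⁅ a ⁆})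
      ; A∩B = λ p q → rest∌ q (∈A p)
      ; cover = λ x → place x (x ≟ a) (x ≟ y) (x ≟ z)
      ; sep = λ p q e → rest∌ q ([ (λ { refl → ∈A (x∈⁅x⁆ _) }) , [ (λ { refl → ∈u {⁅ a ⁆} }) , (λ { refl → ∈v {⁅ a ⁆} }) ]′ ]′
                (nbrs (subst (λ t → Adj t _) (sing≡ p) e))) }
      where
      place : ∀ x → Dec (x ≡ a) → Dec (x ≡ y) → Dec (x ≡ z) → x ∈ ⁅ a ⁆ ⊎ x ∈ rest ⊎ x ≡ y ⊎ x ≡ z
      place x (yes refl) _ _ = inj₁ (x∈⁅x⁆ _)
      place x (no _) (yes p) _ = inj₂ (inj₂ (inj₁ p))
      place x (no _) (no _) (yes p) = inj₂ (inj₂ (inj₂ p))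
      place x (no p) (no q) (no r) = inj₂ (inj₁ (∈rest p q r))

  -- Paths

  edge-path : ∀ {e x y} → Joins e x y → x ≢ y → IsPath G ⁅ e ⁆ x y
  edge-path {e} {x} {y} j x≢y = x≢y , sing-conn e
    , trans (d-sing e x) (inc-nonloop ¬l (joinsˡ j)) , trans (d-sing e y) (inc-nonloop ¬l (joinsʳ j))
    , λ w vw p q → ⊥-elim ([ p , q ]′ (joins-end j (V-sing vw)))
    where
    ¬l = joins-nonloop j x≢y

  path-cons : ∀ {P e w x y} → IsPath G P x y → Joins e w x → ¬ V P w → IsPath G (P ∪ ⁅ e ⁆) w y
  path-cons {P} {e} {w} {x} {y} pth@(x≢y , ec , dx , dy , d2) j ¬w =
      w≢y , conn-∪ {P} {⁅ e ⁆} ec (sing-conn e) (path-start pth) (sing-V (joinsʳ j))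
    , trans (dsum w) (cong₂ _+_ (d-zero {P} ¬w) (inc-nonloop ¬l (joinsˡ j)))
    , trans (dsum y) (cong₂ _+_ dy (inc-zero (λ i → [ w≢y ∘ sym , x≢y ∘ sym ]′ (joins-end j i))))
    , mid
    where
    w≢y : w ≢ y
    w≢y refl = ¬w (path-end pth)
    w≢x : w ≢ x
    w≢x refl = ¬w (path-start pth)
    ¬l = joins-nonloop j w≢x
    part : (P ∪ ⁅ e ⁆) ≐ P ⊔ ⁅ e ⁆
    part = part-∪ (λ p q → ¬w (_ , subst (_∈ P) (sing≡ q) p , joinsˡ j))
    dsum : ∀ z → d (P ∪ ⁅ e ⁆) z ≡ d P z + inc e z
    dsum z = trans (d-split part z) (cong (d P z +_) (d-sing e z))
    mid : ∀ z → V (P ∪ ⁅ e ⁆) z → z ≢ w → z ≢ y → d (P ∪ ⁅ e ⁆) z ≡ 2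
    mid z vz z≢w z≢y with z ≟ x
    ... | yes refl = trans (dsum z) (cong₂ _+_ dx (inc-nonloop ¬l (joinsʳ j)))
    ... | no z≢x = trans (dsum z) (trans (cong₂ _+_ (d2 z zP z≢x z≢y) (inc-zero no-inc)) refl)
      where
      no-inc : ¬ Inc G e z
      no-inc i = [ z≢w , z≢x ]′ (joins-end j i)
      zP : V P z
      zP = [ (λ q → q) , (λ q → ⊥-elim (no-inc (V-sing q))) ]′ (V-∪ {P} vz)

  -- A set is grown from `y` so that each of its vertices keeps a path to `y`; a new vertex prepends
  -- one edge.
  pathIn : ∀ {S x y} → NoSplit S → x ∈ S → y ∈ S → x ≢ y → ∃[ R ] (IsPath G R x y × (∀ {w} → V R w → w ∈ S))
  pathIn {S} {x} {y} ns x∈ y∈ x≢y = grow Φ (λ q → subst (_∈ S) (sym (sing≡ q)) y∈) (noSplit-grows (y , x∈⁅x⁆ y) ns)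
      step (λ q w≢y → ⊥-elim (w≢y (sing≡ q))) x∈ x≢y
    where
    Φ : Subset n → Set
    Φ T = ∀ {w} → w ∈ T → w ≢ y → ∃[ R ] (IsPath G R w y × (∀ {z} → V R z → z ∈ T))
    step : ∀ {T a b} → ⁅ y ⁆ ⊆ T → T ⊆ S → Φ T → a ∈ T → b ∈ S → b ∉ T → Adj a b → Φ (T ∪ ⁅ b ⁆)
    step {T} {a} {b} y⊆ _ φ a∈ _ b∉ (e , j) {w} w∈ w≢y = [ old , (λ q → subst (λ t → ∃[ R ] (IsPath G R t y × (∀ {z} → V R z → z ∈ T ∪ ⁅ b ⁆))) (sym (sing≡ q)) (new (a ≟ y))) ]′ (∪-case w∈)
      where
      old : w ∈ T → ∃[ R ] (IsPath G R w y × (∀ {z} → V R z → z ∈ T ∪ ⁅ b ⁆))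
      old w∈T = let (R , p , s) = φ w∈T w≢y in R , p , ∈∪ˡ ∘ s
      ends : ∀ {z} → Inc G e z → z ∈ T ∪ ⁅ b ⁆
      ends i = [ (λ { refl → ∈∪ˡ a∈ }) , (λ { refl → ∈∪ʳ (x∈⁅x⁆ b) }) ]′ (joins-end j i)
      new : Dec (a ≡ y) → ∃[ R ] (IsPath G R b y × (∀ {z} → V R z → z ∈ T ∪ ⁅ b ⁆))
      new (yes refl) = ⁅ e ⁆ , edge-path (swap j) (λ { refl → b∉ a∈ }) , ends ∘ V-sing
      new (no a≢y) = let (R , p , s) = φ a∈ a≢y in
        R ∪ ⁅ e ⁆ , path-cons p (swap j) (b∉ ∘ s) , λ q → [ ∈∪ˡ ∘ s , ends ∘ V-sing ]′ (V-∪ {R} q)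

  -- Equivalently, no unbalanced cycle misses both a vertex of `A` and a vertex of `B`.
  Dich : Subset n → Subset n → Set
  Dich A B = ∀ {C} → Unb C → (∀ {a} → a ∈ A → V C a) ⊎ (∀ {b} → b ∈ B → V C b)

  -- Rerouting unbalanced cycles inside one side of a cut.

  module Sigma {A B : Subset n} {u v : Fin n} (c : Cut A B u v) (dich : Dich A B) where

    B∌A+ : ∀ {b} → b ∈ B → b ∉ A +⟨ u , v ⟩
    B∌A+ b∈ q = [ (λ a → A∩B c a b∈) , [ (λ { refl → u∉B c b∈ }) , (λ { refl → v∉B c b∈ }) ]′ ]′ (case+ {A} q)

    A∌B+ : ∀ {a} → a ∈ A → a ∉ B +⟨ u , v ⟩
    A∌B+ a∈ q = [ (λ b → A∩B c a∈ b) , [ (λ { refl → u∉A c a∈ }) , (λ { refl → v∉A c a∈ }) ]′ ]′ (case+ {B} q)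

    contains : ∀ {C q} → Unb C → q ∈ B → ¬ V C q → ∀ {a} → a ∈ A → V C a
    contains {C} x q∈ ¬q = [ (λ h → h) , (λ h → ⊥-elim (¬q (h q∈))) ]′ (dich x)

    contains+ : ∀ {C} → Unb C → (∀ {w} → V C w → w ∈ A +⟨ u , v ⟩) → ∀ {a} → a ∈ A → V C a
    contains+ {C} x s = let (b , b∈) = neʳ c in contains x b∈ (λ q → B∌A+ b∈ (s q))

    -- Suppose `y` and `z` are not adjacent. An unbalanced cycle at side `B` misses both, so
    -- removing them disconnects the graph. The connected set `B` with `u` and `v` lies in one part,
    -- and `a` does so too, being adjacent to `u`. The cycle at the other part misses `a` and all of
    -- `B`, against `dich`.
    adjacent-u : ∀ {a y z} → a ∈ A → y ∈ A → z ∈ A → y ≢ z → a ≢ y → a ≢ z → Adj a u → Adj y z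
    adjacent-u {a} {y} {z} a∈ y∈ z∈ y≢z a≢y a≢z adj = decidable-stable (Adj? y z) λ ¬adj → use ¬adj (sideCycle (cut-flip c))
      where
      fin : ∀ X Y → Split (∁ (pair y z)) X Y → B +⟨ u , v ⟩ ⊆ X → ⊥
      fin X Y s B⊆X = go (sideCycle cut)
        where
        cut : Cut Y X y z
        cut = record
          { neˡ = neB s ; neʳ = neA s ; u≢v = y≢z
          ; u∉A = λ q → ∈∁pairˡ (inʳ (parts s) q) refl ; v∉A = λ q → ∈∁pairʳ {y} (inʳ (parts s) q) refl
          ; u∉B = λ q → ∈∁pairˡ (inˡ (parts s) q) refl ; v∉B = λ q → ∈∁pairʳ {y} (inˡ (parts s) q) refl
          ; A∩B = λ p q → dis (parts s) q p
          ; cover = λ x → place x (x ≟ y) (x ≟ z)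
          ; sep = λ p q e → apart s q p (adj-sym e) }
          where
          place : ∀ x → Dec (x ≡ y) → Dec (x ≡ z) → x ∈ Y ⊎ x ∈ X ⊎ x ≡ y ⊎ x ≡ z
          place x (yes p) _ = inj₂ (inj₂ (inj₁ p))
          place x (no _) (yes p) = inj₂ (inj₂ (inj₂ p))
          place x (no p) (no q) = [ inj₂ ∘ inj₁ , inj₁ ]′ (cov (parts s) (∉pair p q))
        go : ∃[ C ] (Unb C × C ⊆ Touching Y) → ⊥
        go (C , x , C⊆) = [ (λ h → onA (VC (h a∈))) , (λ h → let (b , b∈) = neʳ c in onB b∈ (VC (h b∈))) ]′ (dich x)
          where
          VC : ∀ {w} → V C w → w ∈ Y +⟨ y , z ⟩
          VC = touching-V {J = C} cut C⊆
          onA : a ∉ Y +⟨ y , z ⟩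
          onA q = [ (λ r → apart s (B⊆X (∈u {B})) r (adj-sym adj)) , [ a≢y , a≢z ]′ ]′ (case+ {Y} q)
          onB : ∀ {b} → b ∈ B → b ∉ Y +⟨ y , z ⟩
          onB b∈ q = [ dis (parts s) (B⊆X (∈A b∈)) , [ (λ { refl → A∩B c y∈ b∈ }) , (λ { refl → A∩B c z∈ b∈ }) ]′ ]′ (case+ {Y} q)
      use : ¬ Adj y z → ∃[ C ] (Unb C × C ⊆ Touching B) → ⊥
      use ¬adj (C , x , C⊆) = nonadjacent-pair {C} y≢z ¬adj x (λ q → A∌B+ y∈ (VC q)) (λ q → A∌B+ z∈ (VC q)) ns
        where
        VC : ∀ {w} → V C w → w ∈ B +⟨ u , v ⟩
        VC = touching-V {J = C} (cut-flip c) C⊆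
        ns : NoSplit (∁ (pair y z))
        ns X Y s = [ fin X Y s , fin Y X (split-swap s) ]′ (noSplit-side (side-noSplit c)
          (λ q → cov (parts s) (∉pair (λ { refl → A∌B+ y∈ q }) (λ { refl → A∌B+ z∈ q }))) (apart s))

    -- The neighbours of a vertex of degree two form a cut, whose cycle on that side has at most two vertices.
    no-degree-two : ∀ {a y z} → a ∈ A → y ∈ A → z ∈ A → a ≢ y → a ≢ z → y ≢ z →
      (∀ {x} → Adj a x → x ≡ a ⊎ x ≡ y ⊎ x ≡ z) → ⊥
    no-degree-two {a} {y} {z} a∈ y∈ z∈ a≢y a≢z y≢z nbrs = go (sideCycle cut)
      where
      u≢ : ∀ {x} → x ∈ A → u ≢ x
      u≢ x∈ refl = u∉A c x∈
      open DegreeTwo a≢y a≢z y≢z nbrs {u} (u≢ a∈) (u≢ y∈) (u≢ z∈)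
      go : ∃[ C ] (Unb C × C ⊆ Touching ⁅ a ⁆) → ⊥
      go (C , x , C⊆) = [ onA , (λ h → let (b , b∈) = neʳ c in onB b∈ (VC (h b∈))) ]′ (dich x)
        where
        VC : ∀ {w} → V C w → w ∈ ⁅ a ⁆ +⟨ y , z ⟩
        VC = touching-V {J = C} cut C⊆
        onB : ∀ {b} → b ∈ B → b ∉ ⁅ a ⁆ +⟨ y , z ⟩
        onB b∈ q = [ (λ r → A∩B c a∈ (subst (_∈ B) (sing≡ r) b∈)) , [ (λ { refl → A∩B c y∈ b∈ }) , (λ { refl → A∩B c z∈ b∈ }) ]′ ]′ (case+ {⁅ a ⁆} q)
        at-a : ∀ {e} → e ∈ C → Inc G e a
        at-a {e} e∈ = let (t , t∈ , i) = ⟪⟫∈ (touching? ⁅ a ⁆) (C⊆ e∈) in subst (Inc G e) (sing≡ t∈) i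
        onA : (∀ {t} → t ∈ A → V C t) → ⊥
        onA h = 1+2≰2 (begin
          3                    ≤⟨ card-three (inVS {C} (h a∈)) (inVS {C} (h y∈)) (inVS {C} (h z∈)) a≢y a≢z y≢z ⟩
          ∣ VS C ∣             ≡⟨ sym (cycle-card (proj₁ x)) ⟩
          ∣ C ∣                ≡⟨ card-wsum C ⟩
          wsum C (λ _ → 1)     ≤⟨ wsum-≤ {X = C} (λ e∈ → inc-pos (at-a e∈)) ⟩
          d C a                ≡⟨ proj₂ (proj₂ (proj₁ x)) a (h a∈) ⟩
          2                    ∎)
          where open ≤-Reasoning

    Kept : Subset m → Subset m → Fin n → Fin n → Subset m → Set
    Kept K R h t K′ = ∀ {e z} → e ∈ K → Inc G e z → z ∈ A → z ≢ h → z ≢ t → ¬ V R z → e ∈ K′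

    -- By `full` the new cycle still passes through every vertex of `A`. A vertex of `A` off `R`
    -- must then lie on the kept arc, and since it is not an end of `R`, the dropped arc has no edge
    -- there.
    addPath : ∀ {K R h t} → Unb K → IsPath G R h t → V K h → V K t →
      (∀ {w} → V R w → V K w → w ≡ h ⊎ w ≡ t) → (∀ {e} → e ∈ R → e ∉ K) →
      (∀ {K′} → Unb K′ → K′ ⊆ K ∪ R → ∀ {a} → a ∈ A → V K′ a) →
      ∃[ K′ ] (Unb K′ × R ⊆ K′ × K′ ⊆ K ∪ R × Kept K R h t K′)
    addPath {K} {R} {h} {t} x path hK tK inner disj full = P ∪ R , unb , ∈∪ʳ , sub , kept
      where
      open Ear (chord qb x path hK tK inner disj)
      sub : P ∪ R ⊆ K ∪ R
      sub = ∪-lub {p = P} (∈∪ˡ ∘ inˡ arcs) ∈∪ʳ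
      kept : Kept K R h t (P ∪ R)
      kept {e} {z} e∈ i z∈ z≢h z≢t ¬R = [ ∈∪ˡ , (λ q → ⊥-elim ([ z≢h , z≢t ]′ (meet zP (e , q , i)))) ]′ (cov arcs e∈)
        where
        zP : V P z
        zP = [ (λ q → q) , ⊥-elim ∘ ¬R ]′ (V-∪ {P} (full unb sub z∈))

    addEdge : ∀ {K e h t} → Unb K → (∀ {w} → V K w → w ∈ A +⟨ u , v ⟩) → h ∈ A → t ∈ A → h ≢ t → Joins e h t →
      ∃[ K′ ] (Unb K′ × (∀ {w} → V K′ w → w ∈ A +⟨ u , v ⟩) × e ∈ K′ ×
        (∀ {e′ z} → e′ ∈ K → Inc G e′ z → z ∈ A → z ≢ h → z ≢ t → e′ ∈ K′))
    addEdge {K} {e} {h} {t} x VK h∈ t∈ h≢t j = case (e ∈? K)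
      where
      Goal : Set
      Goal = ∃[ K′ ] (Unb K′ × (∀ {w} → V K′ w → w ∈ A +⟨ u , v ⟩) × e ∈ K′ ×
        (∀ {e′ z} → e′ ∈ K → Inc G e′ z → z ∈ A → z ≢ h → z ≢ t → e′ ∈ K′))
      VKe : ∀ {w} → V (K ∪ ⁅ e ⁆) w → w ∈ A +⟨ u , v ⟩
      VKe q = [ VK , (λ r → [ (λ { refl → ∈A h∈ }) , (λ { refl → ∈A t∈ }) ]′ (joins-end j (V-sing r))) ]′ (V-∪ {K} q)
      repack : ∃[ K′ ] (Unb K′ × ⁅ e ⁆ ⊆ K′ × K′ ⊆ K ∪ ⁅ e ⁆ × Kept K ⁅ e ⁆ h t K′) → Goal
      repack (K′ , x′ , e⊆ , s , kept) = K′ , x′ , VKe ∘ V-mono s , e⊆ (x∈⁅x⁆ e)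
        , λ e′∈ i z∈ z≢h z≢t → kept e′∈ i z∈ z≢h z≢t (λ q → [ z≢h , z≢t ]′ (joins-end j (V-sing q)))
      case : Dec (e ∈ K) → Goal
      case (yes e∈) = K , x , VK , e∈ , λ e′∈ _ _ _ _ → e′∈
      case (no e∉) = repack (addPath {K} {⁅ e ⁆} {h} {t} x (edge-path j h≢t) (contains+ x VK h∈) (contains+ x VK t∈)
        (λ q _ → joins-end j (V-sing q)) (λ q r → e∉ (subst (_∈ K) (sing≡ q) r))
        (λ x′ s → contains+ x′ (VKe ∘ V-mono s)))

    distinct-edges : ∀ {e f h y z} → Joins e h y → Joins f h z → h ≢ z → y ≢ z → e ≢ f
    distinct-edges j k h≢z y≢z refl = [ h≢z ∘ sym , y≢z ∘ sym ]′ (joins-end j (joinsʳ k))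

    three-at : ∀ {K e f g h} → Unb K → e ∈ K → f ∈ K → g ∈ K → e ≢ f → e ≢ g → f ≢ g →
      Inc G e h → Inc G f h → Inc G g h → ⊥
    three-at {K} {h = h} x e∈ f∈ g∈ e≢f e≢g f≢g i j k = 1+2≰2 (≤-trans
      (+-mono-≤ (inc-pos i) (+-mono-≤ (inc-pos j) (inc-pos k)))
      (≤-trans (wsum-three {X = K} e∈ f∈ g∈ e≢f e≢g f≢g (λ e → inc e h)) (≤-reflexive (proj₂ (proj₂ (proj₁ x)) h (_ , e∈ , i)))))

    -- An unbalanced cycle at side `A` is routed through the three edges at `h` one after another.
    -- An edge inserted earlier stays, because its other end is not an end of the next chord. The
    -- final cycle has degree three at `h`.
    hub : ∀ {h z₁ z₂ z₃} → h ∈ A → z₁ ∈ A → z₂ ∈ A → z₃ ∈ A → h ≢ z₁ → h ≢ z₂ → h ≢ z₃ → z₁ ≢ z₂ → z₁ ≢ z₃ → z₂ ≢ z₃ →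
      Adj h z₁ → Adj h z₂ → Adj h z₃ → ⊥
    hub {h} {z₁} {z₂} {z₃} h∈ z₁∈ z₂∈ z₃∈ h≢z₁ h≢z₂ h≢z₃ z₁≢z₂ z₁≢z₃ z₂≢z₃ (e₁ , j₁) (e₂ , j₂) (e₃ , j₃) =
      let (C , x , C⊆) = sideCycle c
          (K₁ , x₁ , V₁ , m₁ , _) = addEdge {C} x (touching-V {J = C} c C⊆) h∈ z₁∈ h≢z₁ j₁
          (K₂ , x₂ , V₂ , m₂ , k₂) = addEdge {K₁} x₁ V₁ h∈ z₂∈ h≢z₂ j₂
          (K₃ , x₃ , V₃ , m₃ , k₃) = addEdge {K₂} x₂ V₂ h∈ z₃∈ h≢z₃ j₃
          e₁∈K₂ = k₂ m₁ (joinsʳ j₁) z₁∈ (h≢z₁ ∘ sym) z₁≢z₂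
          e₁∈K₃ = k₃ e₁∈K₂ (joinsʳ j₁) z₁∈ (h≢z₁ ∘ sym) z₁≢z₃
          e₂∈K₃ = k₃ m₂ (joinsʳ j₂) z₂∈ (h≢z₂ ∘ sym) z₂≢z₃
      in three-at {K₃} x₃ e₁∈K₃ e₂∈K₃ m₃ (distinct-edges j₁ j₂ h≢z₂ z₁≢z₂) (distinct-edges j₁ j₃ h≢z₃ z₁≢z₃)
           (distinct-edges j₂ j₃ h≢z₃ z₂≢z₃) (joinsˡ j₁) (joinsˡ j₂) (joinsˡ j₃)

    module Triangle {x y z : Fin n} (x∈ : x ∈ A) (y∈ : y ∈ A) (z∈ : z ∈ A) (x≢y : x ≢ y) (x≢z : x ≢ z) (y≢z : y ≢ z)
      {e₁ e₂ e₃ : Fin m} (j₁ : Joins e₁ x y) (j₂ : Joins e₂ x z) (j₃ : Joins e₃ y z) where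

      T : Subset m
      T = ⁅ e₁ ⁆ ∪ ⁅ e₂ ⁆ ∪ ⁅ e₃ ⁆

      T-case : ∀ {e} → e ∈ T → e ≡ e₁ ⊎ e ≡ e₂ ⊎ e ≡ e₃
      T-case q = [ inj₁ ∘ sing≡ , (λ r → inj₂ ([ inj₁ ∘ sing≡ , inj₂ ∘ sing≡ ]′ (∪-case {p = ⁅ e₂ ⁆} r))) ]′ (∪-case {p = ⁅ e₁ ⁆} q)

      T₁ : e₁ ∈ T
      T₁ = ∈∪ˡ (x∈⁅x⁆ e₁)
      T₂ : e₂ ∈ T
      T₂ = ∈∪ʳ {p = ⁅ e₁ ⁆} (∈∪ˡ (x∈⁅x⁆ e₂))
      T₃ : e₃ ∈ T
      T₃ = ∈∪ʳ {p = ⁅ e₁ ⁆} (∈∪ʳ {p = ⁅ e₂ ⁆} (x∈⁅x⁆ e₃))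

      T-V : ∀ {w} → V T w → w ≡ x ⊎ w ≡ y ⊎ w ≡ z
      T-V (e , e∈ , i) with T-case e∈
      ... | inj₁ refl = [ inj₁ , inj₂ ∘ inj₁ ]′ (joins-end j₁ i)
      ... | inj₂ (inj₁ refl) = [ inj₁ , inj₂ ∘ inj₂ ]′ (joins-end j₂ i)
      ... | inj₂ (inj₂ refl) = inj₂ (joins-end j₃ i)

      T-deg : ∀ {w} → V T w → 2 ≤ d T w
      T-deg {w} q with T-V q
      ... | inj₁ refl = ≤-trans (+-mono-≤ (inc-pos (joinsˡ j₁)) (inc-pos (joinsˡ j₂))) (d-two {T} T₁ T₂ (distinct-edges j₁ j₂ x≢z y≢z) w)
      ... | inj₂ (inj₁ refl) = ≤-trans (+-mono-≤ (inc-pos (joinsʳ j₁)) (inc-pos (joinsˡ j₃))) (d-two {T} T₁ T₃ (distinct-edges (swap j₁) j₃ y≢z x≢z) w)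
      ... | inj₂ (inj₂ refl) = ≤-trans (+-mono-≤ (inc-pos (joinsʳ j₂)) (inc-pos (joinsʳ j₃))) (d-two {T} T₂ T₃ (distinct-edges (swap j₂) (swap j₃) (y≢z ∘ sym) x≢y) w)

      -- The three edges are inserted in turn, each earlier one protected by an end that the next
      -- edge does not use. The final cycle contains the triangle and hence equals it.
      triangle : Unb T
      triangle =
        let (C , x₀ , C⊆) = sideCycle c
            (K₁ , x₁ , V₁ , m₁ , _) = addEdge {C} x₀ (touching-V {J = C} c C⊆) x∈ y∈ x≢y j₁
            (K₂ , x₂ , V₂ , m₂ , k₂) = addEdge {K₁} x₁ V₁ x∈ z∈ x≢z j₂
            (K₃ , x₃ , V₃ , m₃ , k₃) = addEdge {K₂} x₂ V₂ y∈ z∈ y≢z j₃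
            e₁∈K₂ = k₂ m₁ (joinsʳ j₁) y∈ (x≢y ∘ sym) y≢z
        in closed x₃ (k₃ e₁∈K₂ (joinsˡ j₁) x∈ x≢y x≢z) (k₃ m₂ (joinsˡ j₂) x∈ x≢y x≢z) m₃
        where
        closed : ∀ {K} → Unb K → e₁ ∈ K → e₂ ∈ K → e₃ ∈ K → Unb T
        closed {K} xK q₁ q₂ q₃ = subst Unb (⊆-antisym (cycle-closed (proj₁ xK) T⊆K (e₁ , T₁) T-deg) T⊆K) xK
          where
          T⊆K : T ⊆ K
          T⊆K e∈ = [ (λ { refl → q₁ }) , [ (λ { refl → q₂ }) , (λ { refl → q₃ }) ]′ ]′ (T-case e∈)

      T-end : ∀ {e} → e ∈ T → Inc G e x ⊎ Inc G e y
      T-end e∈ = [ (λ { refl → inj₁ (joinsˡ j₁) }) , [ (λ { refl → inj₁ (joinsˡ j₂) }) , (λ { refl → inj₂ (joinsˡ j₃) }) ]′ ]′ (T-case e∈)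

      -- The detour from `x` through `u` to `y` is inserted into the triangle, then a path from `u`
      -- to `z` inside `S`. All these cycles miss `q` and so contain all of `A`; both detour edges
      -- survive the second insertion through their ends `x` and `y`. With the first edge of the
      -- path, `u` gets degree three.
      spider : ∀ {S q} → NoSplit S → u ∈ S → z ∈ S → (∀ {w} → w ∈ S → w ∈ A → w ≡ z) → q ∈ B → q ∉ S →
        Adj u x → Adj u y → ⊥
      spider {S} {q} ns uS zS S∩A q∈ q∉ (f₁ , g₁) (f₂ , g₂) = let (R₂ , path , VR) = pathIn ns uS zS u≢z in finish R₂ path VR
        where
        u≢ : ∀ {w} → w ∈ A → u ≢ w
        u≢ w∈ refl = u∉A c w∈
        u≢z = u≢ z∈
        f₁≢f₂ : f₁ ≢ f₂
        f₁≢f₂ = distinct-edges g₁ g₂ (u≢ y∈) x≢y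
        R₁ : Subset m
        R₁ = ⁅ f₂ ⁆ ∪ ⁅ f₁ ⁆
        path₁ : IsPath G R₁ x y
        path₁ = path-cons (edge-path g₂ (u≢ y∈)) (swap g₁) (λ r → [ u≢ x∈ ∘ sym , x≢y ]′ (joins-end g₂ (V-sing r)))
        V-R₁ : ∀ {w} → V R₁ w → w ≡ u ⊎ w ≡ x ⊎ w ≡ y
        V-R₁ r = [ (λ s → [ inj₁ , inj₂ ∘ inj₂ ]′ (joins-end g₂ (V-sing s))) , (λ s → [ inj₁ , inj₂ ∘ inj₁ ]′ (joins-end g₁ (V-sing s))) ]′ (V-∪ {⁅ f₂ ⁆} r)
        V-T : ∀ {w} → V T w → w ∈ A
        V-T r = [ (λ { refl → x∈ }) , [ (λ { refl → y∈ }) , (λ { refl → z∈ }) ]′ ]′ (T-V r)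
        V-R₁A : ∀ {w} → V R₁ w → w ∈ A ⊎ w ≡ u
        V-R₁A r = [ inj₂ , [ (λ { refl → inj₁ x∈ }) , (λ { refl → inj₁ y∈ }) ]′ ]′ (V-R₁ r)
        V-TR : ∀ {w} → V (T ∪ R₁) w → w ∈ A ⊎ w ≡ u
        V-TR r = [ inj₁ ∘ V-T , V-R₁A ]′ (V-∪ {T} r)
        R₁-end : ∀ {e} → e ∈ R₁ → Inc G e u × (Inc G e x ⊎ Inc G e y)
        R₁-end e∈ = [ (λ s → subst (λ e → Inc G e u × (Inc G e x ⊎ Inc G e y)) (sym (sing≡ s)) (joinsˡ g₂ , inj₂ (joinsʳ g₂)))
                    , (λ s → subst (λ e → Inc G e u × (Inc G e x ⊎ Inc G e y)) (sym (sing≡ s)) (joinsˡ g₁ , inj₁ (joinsʳ g₁))) ]′ (∪-case {p = ⁅ f₂ ⁆} e∈)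
        inner₁ : ∀ {w} → V R₁ w → V T w → w ≡ x ⊎ w ≡ y
        inner₁ r t = [ (λ { refl → ⊥-elim (u∉A c (V-T t)) }) , (λ s → s) ]′ (V-R₁ r)
        disj₁ : ∀ {e} → e ∈ R₁ → e ∉ T
        disj₁ r t = u∉A c (V-T (_ , t , proj₁ (R₁-end r)))
        A+ : ∀ {w} → w ∈ A ⊎ w ≡ u → w ∈ A +⟨ u , v ⟩
        A+ = [ ∈A , (λ { refl → ∈u {A} }) ]′
        bend : ∃[ K ] (Unb K × R₁ ⊆ K × K ⊆ T ∪ R₁ × Kept T R₁ x y K)
        bend = addPath {T} {R₁} {x} {y} triangle path₁ (e₁ , T₁ , joinsˡ j₁) (e₁ , T₁ , joinsʳ j₁) inner₁ disj₁
          (λ xK s → contains+ xK (λ r → A+ (V-TR (V-mono s r))))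
        finish : ∀ R₂ → IsPath G R₂ u z → (∀ {w} → V R₂ w → w ∈ S) → ⊥
        finish R₂ path VR =
          let (K , xK , R₁⊆K , K⊆ , _) = bend in last K xK R₁⊆K K⊆
          where
          ¬R : ∀ {w} → w ∈ A → w ≢ z → ¬ V R₂ w
          ¬R w∈ w≢z r = w≢z (S∩A (VR r) w∈)
          last : ∀ K → Unb K → R₁ ⊆ K → K ⊆ T ∪ R₁ → ⊥
          last K xK R₁⊆K K⊆ = use (addPath {K} {R₂} {u} {z} xK path (f₁ , f₁∈ , joinsˡ g₁) (contains+ xK (λ r → A+ (VK r)) z∈)
              (λ r k → [ (λ w∈ → inj₂ (S∩A (VR r) w∈)) , inj₁ ]′ (VK k))
              (λ {e} r k → [ (λ i → ¬R x∈ x≢z (e , r , i)) , (λ i → ¬R y∈ y≢z (e , r , i)) ]′ (K-end k))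
              (λ {K′} xK′ s → contains xK′ q∈ (λ r → [ (λ k → [ (λ a → A∩B c a q∈) , (λ { refl → u∉B c q∈ }) ]′ (VK k)) , q∉ ∘ VR ]′ (V-∪ {K} (V-mono s r)))))
            where
            f₁∈ : f₁ ∈ K
            f₁∈ = R₁⊆K (∈∪ʳ {p = ⁅ f₂ ⁆} (x∈⁅x⁆ f₁))
            f₂∈ : f₂ ∈ K
            f₂∈ = R₁⊆K (∈∪ˡ (x∈⁅x⁆ f₂))
            VK : ∀ {w} → V K w → w ∈ A ⊎ w ≡ u
            VK r = V-TR (V-mono K⊆ r)
            K-end : ∀ {e} → e ∈ K → Inc G e x ⊎ Inc G e y
            K-end k = [ T-end , proj₂ ∘ R₁-end ]′ (∪-case {p = T} (K⊆ k))
            use : ∃[ K′ ] (Unb K′ × R₂ ⊆ K′ × K′ ⊆ K ∪ R₂ × Kept K R₂ u z K′) → ⊥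
            use (K′ , xK′ , R₂⊆ , _ , kept) = let (g , g∈ , i) = path-start path in
              three-at {K′} xK′ (kept f₁∈ (joinsʳ g₁) x∈ (u≢ x∈ ∘ sym) x≢z (¬R x∈ x≢z))
                (kept f₂∈ (joinsʳ g₂) y∈ (u≢ y∈ ∘ sym) y≢z (¬R y∈ y≢z)) (R₂⊆ g∈) f₁≢f₂
                (λ { refl → ¬R x∈ x≢z (g , g∈ , joinsʳ g₁) }) (λ { refl → ¬R y∈ y≢z (g , g∈ , joinsʳ g₂) })
                (joinsˡ g₁) (joinsˡ g₂) i

  plus-swap : ∀ A u v → A +⟨ u , v ⟩ ≡ A +⟨ v , u ⟩
  plus-swap A u v = ⊆-antisym (λ q → flip+ (case+ {A} q)) (λ q → flip+ (case+ {A} q))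
    where
    flip+ : ∀ {p q x} → x ∈ A ⊎ x ≡ p ⊎ x ≡ q → x ∈ A +⟨ q , p ⟩
    flip+ (inj₁ b) = ∈A b
    flip+ (inj₂ (inj₁ refl)) = ∈v {A}
    flip+ (inj₂ (inj₂ refl)) = ∈u {A}

  record Triple (A : Subset n) : Set where
    field
      {x y z} : Fin n
      x∈ : x ∈ A
      y∈ : y ∈ A
      z∈ : z ∈ A
      x≢y : x ≢ y
      x≢z : x ≢ z
      y≢z : y ≢ z
      exhaust : ∀ {w} → w ∈ A → w ≡ x ⊎ w ≡ y ⊎ w ≡ z

  triple : ∀ {A} → ∣ A ∣ ≡ 3 → Triple A
  triple {A} three = first (card-elem (≤-trans (s≤s z≤n) (≤-reflexive (sym three))))
    where
    first : Nonempty A → Triple A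
    first (x , x∈) = second (card-elem (≤-trans (s≤s z≤n) (≤-reflexive (sym two))))
      where
      two : ∣ A - x ∣ ≡ 2
      two = suc-injective (trans (sym (card-remove x∈)) three)
      second : Nonempty (A - x) → Triple A
      second (y , y∈) = third (card-elem (≤-trans (s≤s z≤n) (≤-reflexive (sym one))))
        where
        one : ∣ A - x - y ∣ ≡ 1
        one = suc-injective (trans (sym (card-remove y∈)) two)
        third : Nonempty (A - x - y) → Triple A
        third (z , z∈) = record
          { x∈ = x∈ ; y∈ = -ˡ {p = A} y∈ ; z∈ = -ˡ {p = A} (-ˡ {p = A - x} z∈)
          ; x≢y = λ eq → -≢ {p = A} y∈ (sym eq)
          ; x≢z = λ eq → -≢ {p = A} (-ˡ {p = A - x} z∈) (sym eq)
          ; y≢z = λ eq → -≢ {p = A - x} z∈ (sym eq)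
          ; exhaust = λ {w} w∈ → place w∈ (w ≟ x) (w ≟ y) (w ≟ z) }
          where
          zero-left : ∣ A - x - y - z ∣ ≡ 0
          zero-left = suc-injective (trans (sym (card-remove z∈)) one)
          place : ∀ {w} → w ∈ A → Dec (w ≡ x) → Dec (w ≡ y) → Dec (w ≡ z) → w ≡ x ⊎ w ≡ y ⊎ w ≡ z
          place _ (yes p) _ _ = inj₁ p
          place _ (no _) (yes p) _ = inj₂ (inj₁ p)
          place _ (no _) (no _) (yes p) = inj₂ (inj₂ p)
          place w∈ (no p) (no q) (no r) = ⊥-elim (<⇒≢ (card-pos (∈- (∈- (∈- w∈ p) q) r)) (sym zero-left))

  -- Bounds on the number of vertices of a side.

  module SmallSides {A B : Subset n} (dich : Dich A B) where

    adjacent : ∀ {u v} → Cut A B u v → ∀ {a y z} → a ∈ A → y ∈ A → z ∈ A → y ≢ z → a ≢ y → a ≢ z → Adj a u ⊎ Adj a v → Adj y z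
    adjacent c a∈ y∈ z∈ y≢z a≢y a≢z = [ Sigma.adjacent-u c dich a∈ y∈ z∈ y≢z a≢y a≢z
                                      , Sigma.adjacent-u (cut-swap c) dich a∈ y∈ z∈ y≢z a≢y a≢z ]′

    -- Besides a neighbour of `u`, a second vertex of `A` is attached to the cut, or the first would
    -- be a cut vertex. By `adjacent` a third vertex is then joined to both of them and to a fourth,
    -- which `hub` forbids.
    big : ∀ {u v} → Cut A B u v → 4 ≤ ∣ A ∣ → ⊥
    big {u} {v} c four = first (attach c)
      where
      first : ∃[ a ] (a ∈ A × Adj u a) → ⊥
      first (a₁ , a₁∈ , adj₁) = second (decidable-stable (any? (λ a → (a ∈? A) ×-dec (¬? (a ≟ a₁) ×-dec (Adj? a u ⊎-dec Adj? a v)))) lonely)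
        where
        three : 3 ≤ ∣ A - a₁ ∣
        three = ≤-pred (≤-trans four (≤-reflexive (card-remove a₁∈)))
        lonely : ¬ ¬ (∃[ a ] (a ∈ A × a ≢ a₁ × (Adj a u ⊎ Adj a v)))
        lonely none = isolated {A - a₁} {a₁} {u} (card-elem (≤-trans (s≤s z≤n) three)) (λ q → -≢ {p = A} q refl)
          (λ q → u∉A c (-ˡ {p = A} q)) (λ { refl → u∉A c a₁∈ })
          (λ {x} {y} x∈ y∉ y≢ e → out x∈ y∉ y≢ e (cover c y))
          where
          out : ∀ {x y} → x ∈ A - a₁ → y ∉ A - a₁ → y ≢ a₁ → Adj x y → y ∈ A ⊎ y ∈ B ⊎ y ≡ u ⊎ y ≡ v → ⊥
          out x∈ y∉ y≢ e (inj₁ a) = y∉ (∈- a y≢)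
          out x∈ y∉ y≢ e (inj₂ (inj₁ b)) = sep c (-ˡ {p = A} x∈) b e
          out x∈ y∉ y≢ e (inj₂ (inj₂ (inj₁ refl))) = none (_ , -ˡ {p = A} x∈ , -≢ {p = A} x∈ , inj₁ e)
          out x∈ y∉ y≢ e (inj₂ (inj₂ (inj₂ refl))) = none (_ , -ˡ {p = A} x∈ , -≢ {p = A} x∈ , inj₂ e)
        second : ∃[ a ] (a ∈ A × a ≢ a₁ × (Adj a u ⊎ Adj a v)) → ⊥
        second (a₂ , a₂∈ , a₂≢a₁ , adj₂) = third (card-elem (≤-trans (s≤s z≤n) two))
          where
          two : 2 ≤ ∣ A - a₁ - a₂ ∣
          two = ≤-pred (≤-trans three (≤-reflexive (card-remove (∈- a₂∈ a₂≢a₁))))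
          third : Nonempty (A - a₁ - a₂) → ⊥
          third (a₃ , a₃∈′) = fourth (card-second a₃ two)
            where
            a₃∈ = -ˡ {p = A} (-ˡ {p = A - a₁} a₃∈′)
            a₃≢a₁ = -≢ {p = A} (-ˡ {p = A - a₁} a₃∈′)
            a₃≢a₂ = -≢ {p = A - a₁} a₃∈′
            fourth : ∃[ a ] (a ∈ A - a₁ - a₂ × a ≢ a₃) → ⊥
            fourth (a₄ , a₄∈′ , a₄≢a₃) = Sigma.hub c dich a₃∈ a₁∈ a₂∈ a₄∈ a₃≢a₁ a₃≢a₂ (a₄≢a₃ ∘ sym) (a₂≢a₁ ∘ sym) (a₄≢a₁ ∘ sym) (a₄≢a₂ ∘ sym)
                (adjacent c a₂∈ a₃∈ a₁∈ a₃≢a₁ (a₃≢a₂ ∘ sym) a₂≢a₁ adj₂)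
                (adjacent c a₁∈ a₃∈ a₂∈ a₃≢a₂ (a₃≢a₁ ∘ sym) (a₂≢a₁ ∘ sym) (inj₁ (adj-sym adj₁)))
                (adjacent c a₁∈ a₃∈ a₄∈ (a₄≢a₃ ∘ sym) (a₃≢a₁ ∘ sym) (a₄≢a₁ ∘ sym) (inj₁ (adj-sym adj₁)))
              where
              a₄∈ = -ˡ {p = A} (-ˡ {p = A - a₁} a₄∈′)
              a₄≢a₁ = -≢ {p = A} (-ˡ {p = A - a₁} a₄∈′)
              a₄≢a₂ = -≢ {p = A - a₁} a₄∈′

    -- Otherwise the only neighbours of `x` would be `y` and `z`, against `no-degree-two`.
    attached : ∀ {u v x y z} → Cut A B u v → x ∈ A → y ∈ A → z ∈ A → x ≢ y → x ≢ z → y ≢ z →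
      (∀ {w} → w ∈ A → w ≡ x ⊎ w ≡ y ⊎ w ≡ z) → Adj x u ⊎ Adj x v
    attached {u} {v} {x} {y} {z} c x∈ y∈ z∈ x≢y x≢z y≢z exhaust = decidable-stable (Adj? x u ⊎-dec Adj? x v) λ none →
      Sigma.no-degree-two c dich x∈ y∈ z∈ x≢y x≢z y≢z (λ {w} e → nbr none e (cover c w))
      where
      nbr : ∀ {w} → ¬ (Adj x u ⊎ Adj x v) → Adj x w → w ∈ A ⊎ w ∈ B ⊎ w ≡ u ⊎ w ≡ v → w ≡ x ⊎ w ≡ y ⊎ w ≡ z
      nbr none e (inj₁ a) = exhaust a
      nbr none e (inj₂ (inj₁ b)) = ⊥-elim (sep c x∈ b e)
      nbr none e (inj₂ (inj₂ (inj₁ refl))) = ⊥-elim (none (inj₁ e))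
      nbr none e (inj₂ (inj₂ (inj₂ refl))) = ⊥-elim (none (inj₂ e))

    module Three {u v : Fin n} (c : Cut A B u v) (t : Triple A) where
      open Triple t

      att-x : Adj x u ⊎ Adj x v
      att-x = attached c x∈ y∈ z∈ x≢y x≢z y≢z exhaust
      att-y : Adj y u ⊎ Adj y v
      att-y = attached c y∈ x∈ z∈ (x≢y ∘ sym) y≢z x≢z (λ w → [ inj₂ ∘ inj₁ , [ inj₁ , inj₂ ∘ inj₂ ]′ ]′ (exhaust w))
      att-z : Adj z u ⊎ Adj z v
      att-z = attached c z∈ x∈ y∈ (x≢z ∘ sym) (y≢z ∘ sym) x≢y (λ w → [ inj₂ ∘ inj₁ , [ inj₂ ∘ inj₂ , inj₁ ]′ ]′ (exhaust w))

      xy : Adj x y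
      xy = adjacent c z∈ x∈ y∈ x≢y (x≢z ∘ sym) (y≢z ∘ sym) att-z
      xz : Adj x z
      xz = adjacent c y∈ x∈ z∈ x≢z (x≢y ∘ sym) y≢z att-y
      yz : Adj y z
      yz = adjacent c x∈ y∈ z∈ y≢z x≢y x≢z att-x

      -- The third vertex is hung onto `O`, so that the path from `u` to it which `spider` needs
      -- runs outside `A` up to its last vertex.
      core : ∀ {u v O q a b c′} → Cut A B u v → NoSplit O → u ∈ O → (∀ {w} → w ∈ O → w ∉ A) → q ∈ B → q ∉ O →
        a ∈ A → b ∈ A → c′ ∈ A → a ≢ b → a ≢ c′ → b ≢ c′ → Adj a b → Adj a c′ → Adj b c′ →
        Adj a u → Adj b u → ∃[ o ] (o ∈ O × Adj c′ o) → ⊥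
      core {u} {v} {O} {q} {a} {b} {c′} cut ns u∈O O∩A q∈ q∉ a∈ b∈ c∈ a≢b a≢c b≢c (e₁ , j₁) (e₂ , j₂) (e₃ , j₃) au bu (o , o∈ , co) =
        Sigma.Triangle.spider cut dich a∈ b∈ c∈ a≢b a≢c b≢c j₁ j₂ j₃ {O ∪ ⁅ c′ ⁆} {q}
          (noSplit-insert ns o∈ (adj-sym co)) (∈∪ˡ u∈O) (∈∪ʳ (x∈⁅x⁆ c′))
          (λ w∈ w∈A → [ (λ r → ⊥-elim (O∩A r w∈A)) , sing≡ ]′ (∪-case w∈)) q∈
          (λ r → [ q∉ , (λ s → A∩B cut c∈ (subst (_∈ B) (sing≡ s) q∈)) ]′ (∪-case r)) (adj-sym au) (adj-sym bu)

      -- Each of the three vertices is attached to `u` or `v`, so two of them share an attachment;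
      -- the third is reached through `O`, which contains both.
      spread : ∀ {O q} → NoSplit O → u ∈ O → v ∈ O → (∀ {w} → w ∈ O → w ∉ A) → q ∈ B → q ∉ O → ⊥
      spread {O} {q} ns u∈O v∈O O∩A q∈ q∉ = go att-x att-y att-z
        where
        out : ∀ {w} → Adj w u ⊎ Adj w v → ∃[ o ] (o ∈ O × Adj w o)
        out = [ (λ e → u , u∈O , e) , (λ e → v , v∈O , e) ]′
        go : Adj x u ⊎ Adj x v → Adj y u ⊎ Adj y v → Adj z u ⊎ Adj z v → ⊥
        go (inj₁ p) (inj₁ q′) r = core c ns u∈O O∩A q∈ q∉ x∈ y∈ z∈ x≢y x≢z y≢z xy xz yz p q′ (out r)
        go (inj₂ p) (inj₂ q′) r = core (cut-swap c) ns v∈O O∩A q∈ q∉ x∈ y∈ z∈ x≢y x≢z y≢z xy xz yz p q′ (out r)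
        go (inj₁ p) q′ (inj₁ r) = core c ns u∈O O∩A q∈ q∉ x∈ z∈ y∈ x≢z x≢y (y≢z ∘ sym) xz xy (adj-sym yz) p r (out q′)
        go (inj₂ p) q′ (inj₂ r) = core (cut-swap c) ns v∈O O∩A q∈ q∉ x∈ z∈ y∈ x≢z x≢y (y≢z ∘ sym) xz xy (adj-sym yz) p r (out q′)
        go p (inj₁ q′) (inj₁ r) = core c ns u∈O O∩A q∈ q∉ y∈ z∈ x∈ y≢z (x≢y ∘ sym) (x≢z ∘ sym) yz (adj-sym xy) (adj-sym xz) q′ r (out p)
        go p (inj₂ q′) (inj₂ r) = core (cut-swap c) ns v∈O O∩A q∈ q∉ y∈ z∈ x∈ y≢z (x≢y ∘ sym) (x≢z ∘ sym) yz (adj-sym xy) (adj-sym xz) q′ r (out p)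

      star : (∀ {a} → a ∈ A → Adj u a) → ⊥
      star all = let (q , q∈) = neʳ c in core c (noSplit-sing u) (x∈⁅x⁆ u) (λ r s → u∉A c (subst (_∈ A) (sing≡ r) s)) q∈
        (λ r → u∉B c (subst (_∈ B) (sing≡ r) q∈)) x∈ y∈ z∈ x≢y x≢z y≢z xy xz yz (adj-sym (all x∈)) (adj-sym (all y∈)) (u , x∈⁅x⁆ u , adj-sym (all z∈))

    -- If `u` and `a` were not adjacent, removing them would split the graph, as `C` misses both.
    -- The connected set `B` with `v` lies in one part, so the cycle at the other part contains all
    -- of `A`. Then `v` has no neighbour in `A` besides `a`, and none in `u`, so it is isolated once
    -- `a` is removed from the side, against `H`.
    dominates : ∀ {C u v a} → Cut A B u v → Unb C → (∀ {w} → V C w → w ∈ B +⟨ u , v ⟩) → ¬ V C u → ¬ Adj u v →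
      NoSplit ((A +⟨ u , v ⟩) - a) → a ∈ A → Adj u a
    dominates {C} {u} {v} {a} c x VC ¬u ¬uv H a∈ = decidable-stable (Adj? u a) λ ¬adj →
      nonadjacent-pair {C} u≢a ¬adj x ¬u (λ q → Sigma.A∌B+ c dich a∈ (VC q)) ns
      where
      u≢a : u ≢ a
      u≢a refl = u∉A c a∈
      v≢a : v ≢ a
      v≢a refl = v∉A c a∈
      U : Subset n
      U = ∁ (A +⟨ u , v ⟩) ∪ ⁅ v ⁆
      nsB : NoSplit (∁ (A +⟨ u , v ⟩))
      nsB = let (C′ , x′ , C′⊆) = sideCycle c in unb-noSplit x′ (touching-V {J = C′} c C′⊆) (side-noSplit (cut-flip c))
      nsU : NoSplit U
      nsU = let (b , b∈ , e) = attach (cut-swap (cut-flip c)) in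
        noSplit-insert nsB (x∉p⇒x∈∁p (Sigma.B∌A+ c dich b∈)) (adj-sym e)
      U⊆ : ∀ {w} → w ∈ U → w ∈ ∁ (pair u a)
      U⊆ q = [ (λ r → ∉pair (λ { refl → x∈∁p⇒x∉p r (∈u {A}) }) (λ { refl → x∈∁p⇒x∉p r (∈A a∈) }))
             , (λ r → ∉pair (λ w≡u → u≢v c (trans (sym w≡u) (sing≡ r))) (λ w≡a → v≢a (trans (sym (sing≡ r)) w≡a))) ]′ (∪-case q)
      fin : ∀ X Y → Split (∁ (pair u a)) X Y → U ⊆ X → ⊥
      fin X Y s U⊆X = go (sideCycle cut)
        where
        cut : Cut Y X u a
        cut = record
          { neˡ = neB s ; neʳ = neA s ; u≢v = u≢a
          ; u∉A = λ q → ∈∁pairˡ (inʳ (parts s) q) refl ; v∉A = λ q → ∈∁pairʳ {u} (inʳ (parts s) q) refl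
          ; u∉B = λ q → ∈∁pairˡ (inˡ (parts s) q) refl ; v∉B = λ q → ∈∁pairʳ {u} (inˡ (parts s) q) refl
          ; A∩B = λ p q → dis (parts s) q p
          ; cover = λ w → place w (w ≟ u) (w ≟ a)
          ; sep = λ p q e → apart s q p (adj-sym e) }
          where
          place : ∀ w → Dec (w ≡ u) → Dec (w ≡ a) → w ∈ Y ⊎ w ∈ X ⊎ w ≡ u ⊎ w ≡ a
          place w (yes p) _ = inj₂ (inj₂ (inj₁ p))
          place w (no _) (yes p) = inj₂ (inj₂ (inj₂ p))
          place w (no p) (no q) = [ inj₂ ∘ inj₁ , inj₁ ]′ (cov (parts s) (∉pair p q))
        vX : v ∈ X
        vX = U⊆X (∈∪ʳ {p = ∁ (A +⟨ u , v ⟩)} (x∈⁅x⁆ v))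
        B⊆X : ∀ {b} → b ∈ B → b ∈ X
        B⊆X b∈ = U⊆X (∈∪ˡ (x∉p⇒x∈∁p (Sigma.B∌A+ c dich b∈)))
        go : ∃[ C ] (Unb C × C ⊆ Touching Y) → ⊥
        go (C′ , x′ , C′⊆) = [ onA , (λ h → let (b , b∈) = neʳ c in onB b∈ (VC′ (h b∈))) ]′ (dich x′)
          where
          VC′ : ∀ {w} → V C′ w → w ∈ Y +⟨ u , a ⟩
          VC′ = touching-V {J = C′} cut C′⊆
          onB : ∀ {b} → b ∈ B → b ∉ Y +⟨ u , a ⟩
          onB b∈ q = [ dis (parts s) (B⊆X b∈) , [ (λ { refl → u∉B c b∈ }) , (λ { refl → A∩B c a∈ b∈ }) ]′ ]′ (case+ {Y} q)
          onA : (∀ {w} → w ∈ A → V C′ w) → ⊥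
          onA h = H ⁅ v ⁆ (((A +⟨ u , v ⟩) - a) ─ ⁅ v ⁆) (record
            { parts = part-─ (λ q → subst (_∈ (A +⟨ u , v ⟩) - a) (sym (sing≡ q)) (∈- (∈v {A}) v≢a))
            ; neA = v , x∈⁅x⁆ v
            ; neB = u , ∈─ (∈- (∈u {A}) u≢a) (λ q → u≢v c (sing≡ q))
            ; apart = λ p q e → far (subst (λ t → Adj t _) (sing≡ p) e) (-≢ {p = A +⟨ u , v ⟩} (─ˡ {p = (A +⟨ u , v ⟩) - a} q))
                        (λ w≡v → ─ʳ {p = (A +⟨ u , v ⟩) - a} q (∈sing w≡v)) (case+ {A} (-ˡ {p = A +⟨ u , v ⟩} (─ˡ {p = (A +⟨ u , v ⟩) - a} q))) })
            where
            far : ∀ {w} → Adj v w → w ≢ a → w ≢ v → w ∈ A ⊎ w ≡ u ⊎ w ≡ v → ⊥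
            far e w≢a w≢v (inj₁ w∈) = [ (λ r → apart s vX r e) , [ (λ { refl → u∉A c w∈ }) , w≢a ]′ ]′ (case+ {Y} (VC′ (h w∈)))
            far e w≢a w≢v (inj₂ (inj₁ refl)) = ¬uv (adj-sym e)
            far e w≢a w≢v (inj₂ (inj₂ w≡v)) = w≢v w≡v
      ns : NoSplit (∁ (pair u a))
      ns X Y s = [ fin X Y s , fin Y X (split-swap s) ]′ (noSplit-side nsU (cov (parts s) ∘ U⊆) (apart s))

  -- Cuts with a side in which no vertex separates the cut vertices.

  module Tight {A B : Subset n} {u v : Fin n} (c : Cut A B u v) (H : ∀ {a} → a ∈ A → NoSplit ((A +⟨ u , v ⟩) - a)) where

    -- What is left of side `A` together with `u` and `v` stays in one part, so the other part lies
    -- in `B` and would be cut off by `b` alone.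
    avoid : ∀ {a b} → a ∈ A → b ∈ B → NoSplit (∁ (pair a b))
    avoid {a} {b} a∈ b∈ X Y s = [ fin X Y s , fin Y X (split-swap s) ]′ (noSplit-side (H a∈)
        (λ q → cov (parts s) (∉pair (-≢ {p = A +⟨ u , v ⟩} q) (λ { refl → B∌ (-ˡ {p = A +⟨ u , v ⟩} q) }))) (apart s))
      where
      B∌ : b ∉ A +⟨ u , v ⟩
      B∌ q = [ (λ r → A∩B c r b∈) , [ (λ { refl → u∉B c b∈ }) , (λ { refl → v∉B c b∈ }) ]′ ]′ (case+ {A} q)
      fin : ∀ X Y → Split (∁ (pair a b)) X Y → (A +⟨ u , v ⟩) - a ⊆ X → ⊥
      fin X Y s ⊆X = isolated {Y} {b} {u} (neB s) (λ q → ∈∁pairʳ {a} (inʳ (parts s) q) refl) (dis (parts s) uX) (λ { refl → u∉B c b∈ }) out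
        where
        uX : u ∈ X
        uX = ⊆X (∈- (∈u {A}) (λ { refl → u∉A c a∈ }))
        vX : v ∈ X
        vX = ⊆X (∈- (∈v {A}) (λ { refl → v∉A c a∈ }))
        inB : ∀ {x} → x ∈ Y → x ∈ A ⊎ x ∈ B ⊎ x ≡ u ⊎ x ≡ v → x ∈ B
        inB x∈ (inj₁ q) = ⊥-elim (dis (parts s) (⊆X (∈- (∈A q) (∈∁pairˡ (inʳ (parts s) x∈)))) x∈)
        inB x∈ (inj₂ (inj₁ q)) = q
        inB x∈ (inj₂ (inj₂ (inj₁ refl))) = ⊥-elim (dis (parts s) uX x∈)
        inB x∈ (inj₂ (inj₂ (inj₂ refl))) = ⊥-elim (dis (parts s) vX x∈)
        out : ∀ {x y} → x ∈ Y → y ∉ Y → y ≢ b → ¬ Adj x y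
        out {x} {y} x∈ y∉ y≢b e = at (y ≟ a)
          where
          at : Dec (y ≡ a) → ⊥
          at (yes refl) = sep c a∈ (inB x∈ (cover c x)) (adj-sym e)
          at (no y≢a) = [ (λ q → apart s q x∈ (adj-sym e)) , y∉ ]′ (cov (parts s) (∉pair y≢a y≢b))

    dich : Dich A B
    dich {C} x = decide (any? (λ a → (a ∈? A) ×-dec ¬? (V? C a)))
      where
      decide : Dec (∃[ a ] (a ∈ A × ¬ V C a)) → (∀ {a} → a ∈ A → V C a) ⊎ (∀ {b} → b ∈ B → V C b)
      decide (no ¬e) = inj₁ λ {a} a∈ → decidable-stable (V? C a) (λ ¬v → ¬e (a , a∈ , ¬v))
      decide (yes (a , a∈ , ¬a)) = inj₂ λ {b} b∈ → decidable-stable (V? C b) λ ¬b →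
        nonadjacent-pair {C} (λ { refl → A∩B c a∈ b∈ }) (sep c a∈ b∈) x ¬a ¬b (avoid a∈ b∈)

    dich′ : Dich B A
    dich′ x = swap (dich x)

    -- Sides of four or more vertices are excluded by `big`, and a side of three by `spread`
    -- whenever the opposite side, with `u` and `v`, stays connected after losing some vertex. What
    -- is left is |A| = 3 and |B| = 2 with each vertex of `B` separating `u` from `v`; there a cycle
    -- near one cut vertex makes the other adjacent to all of `A`, against `star`.
    impossible : 5 ≤ ∣ A ∣ + ∣ B ∣ → ⊥
    impossible five = sizes (4 ≤? ∣ A ∣) (4 ≤? ∣ B ∣) (3 ≤? ∣ B ∣)
      where
      smallB : ∣ A ∣ ≡ 3 → 2 ≤ ∣ B ∣ → ⊥
      smallB three two = scan (any? (λ q → (q ∈? B) ×-dec NoSplit? ((B +⟨ u , v ⟩) - q)))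
        where
        t = triple three
        scan : Dec (∃[ q ] (q ∈ B × NoSplit ((B +⟨ u , v ⟩) - q))) → ⊥
        scan (yes (q , q∈ , ns)) = SmallSides.Three.spread {A} {B} dich c t ns
          (∈- (∈u {B}) (λ { refl → u∉B c q∈ })) (∈- (∈v {B}) (λ { refl → v∉B c q∈ }))
          (λ r w∈A → Sigma.A∌B+ c dich w∈A (-ˡ {p = B +⟨ u , v ⟩} r)) q∈ (λ r → -≢ {p = B +⟨ u , v ⟩} r refl)
        scan (no none) = let (q , q∈) = neʳ c in pick q∈ (NoSplit-dec ((B +⟨ u , v ⟩) - q))
          where
          -- b lies on the u-side of q, so some unbalanced cycle avoids v.
          near : ∀ {u v q b X Y} → Cut A B u v → (∀ {a} → a ∈ A → NoSplit ((A +⟨ u , v ⟩) - a)) → q ∈ B →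
            Split ((B +⟨ u , v ⟩) - q) X Y → u ∈ X → v ∈ Y → b ∈ X → b ≢ u → ⊥
          near {u} {v} {q} {b} {X} {Y} c H q∈ s uX vY b∈ b≢u = go (subcut (cut-flip c) q∈ s uX vY b∈ b≢u)
            where
            go : ∃[ B′ ] (Cut (X - u) B′ u q) → ⊥
            go (B′ , cut) = let (C , x , C⊆) = sideCycle cut in
                SmallSides.Three.star {A} {B} dich (cut-swap c) t
                  (λ a∈ → SmallSides.dominates {A} {B} dich {C} (cut-swap c) x
                    (λ r → subst (_ ∈_) (plus-swap B u v) (VC (touching-V {J = C} cut C⊆ r)))
                    (λ r → ¬v (touching-V {J = C} cut C⊆ r)) (λ e → apart s uX vY (adj-sym e))
                    (subst (λ Z → NoSplit (Z - _)) (plus-swap A u v) (H a∈)) a∈)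
              where
              VC : ∀ {w} → w ∈ (X - u) +⟨ u , q ⟩ → w ∈ B +⟨ u , v ⟩
              VC r = [ (λ p → -ˡ {p = B +⟨ u , v ⟩} (inˡ (parts s) (-ˡ {p = X} p))) , [ (λ { refl → ∈u {B} }) , (λ { refl → ∈A q∈ }) ]′ ]′ (case+ {X - u} r)
              ¬v : v ∉ (X - u) +⟨ u , q ⟩
              ¬v r = [ (λ p → dis (parts s) (-ˡ {p = X} p) vY) , [ (λ p → u≢v c (sym p)) , (λ { refl → v∉B c q∈ }) ]′ ]′ (case+ {X - u} r)
          pick : ∀ {q} → q ∈ B → NoSplit ((B +⟨ u , v ⟩) - q) ⊎ ∃[ X ] ∃[ Y ] Split ((B +⟨ u , v ⟩) - q) X Y → ⊥
          pick {q} q∈ (inj₁ ns) = none (q , q∈ , ns)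
          pick {q} q∈ (inj₂ (X , Y , s)) = orient X Y s (ends-apart (cut-flip c) q∈ s)
            where
            other : ∃[ b ] (b ∈ B × b ≢ q)
            other = card-second q two
            b = proj₁ other
            b∈ = proj₁ (proj₂ other)
            b≢u : b ≢ u
            b≢u eq = u∉B c (subst (_∈ B) eq b∈)
            b≢v : b ≢ v
            b≢v eq = v∉B c (subst (_∈ B) eq b∈)
            oriented : ∀ X Y → Split ((B +⟨ u , v ⟩) - q) X Y → u ∈ X → v ∈ Y → ⊥
            oriented X Y s uX vY = [ (λ r → near c H q∈ s uX vY r b≢u)
              , (λ r → near (cut-swap c) (λ a∈ → subst (λ Z → NoSplit (Z - _)) (plus-swap A u v) (H a∈)) q∈
                   (split-swap (subst (λ Z → Split (Z - q) X Y) (plus-swap B u v) s)) vY uX r b≢v) ]′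
              (cov (parts s) (∈- (∈A b∈) (proj₂ (proj₂ other))))
            orient : ∀ X Y → Split ((B +⟨ u , v ⟩) - q) X Y → (u ∈ X × v ∈ Y) ⊎ (u ∈ Y × v ∈ X) → ⊥
            orient X Y s (inj₁ (p , r)) = oriented X Y s p r
            orient X Y s (inj₂ (p , r)) = oriented Y X (split-swap s) p r
      sizes : Dec (4 ≤ ∣ A ∣) → Dec (4 ≤ ∣ B ∣) → Dec (3 ≤ ∣ B ∣) → ⊥
      sizes (yes p) _ _ = SmallSides.big {A} {B} dich c p
      sizes (no _) (yes p) _ = SmallSides.big {B} {A} dich′ (cut-flip c) p
      -- Three vertices in `B`: the roles of the sides are exchanged, and by `H` any vertex of `A`
      -- can be the one that is left out.
      sizes (no _) (no q) (yes r) = let (a , a∈) = neˡ c in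
        SmallSides.Three.spread {B} {A} dich′ (cut-flip c) (triple (≤-antisym (≤-pred (≰⇒> q)) r)) (H a∈)
          (∈- (∈u {A}) (λ { refl → u∉A c a∈ })) (∈- (∈v {A}) (λ { refl → v∉A c a∈ }))
          (λ t w∈B → Sigma.B∌A+ c dich w∈B (-ˡ {p = A +⟨ u , v ⟩} t)) a∈ (λ t → -≢ {p = A +⟨ u , v ⟩} t refl)
      sizes (no p) (no _) (no r) = smallB (≤-antisym A≤3 (+-cancelʳ-≤ 2 3 (∣ A ∣) (≤-trans five (+-monoʳ-≤ (∣ A ∣) B≤2))))
          (+-cancelˡ-≤ 3 2 (∣ B ∣) (≤-trans five (+-monoˡ-≤ (∣ B ∣) A≤3)))
        where
        A≤3 : ∣ A ∣ ≤ 3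
        A≤3 = ≤-pred (≰⇒> p)
        B≤2 : ∣ B ∣ ≤ 2
        B≤2 = ≤-pred (≰⇒> r)

  -- In a split of the smaller side, the part without `s` has no further neighbours in the larger
  -- side, because only `s` leads from `X` to `Y`. It would already split the larger side without
  -- `a`.
  descend : ∀ {A B u v s a X Y} → Cut A B u v → s ∈ A → Split ((A +⟨ u , v ⟩) - s) X Y → u ∈ X → v ∈ Y →
    NoSplit ((A +⟨ u , v ⟩) - a) → a ∈ A → a ∈ X → NoSplit (((X - u) +⟨ u , s ⟩) - a)
  descend {A} {B} {u} {v} {s} {a} {X} {Y} c s∈ sp uX vY H a∈ aX X₁ X₂ s₁₂ = go X₁ X₂ s₁₂ (cov (parts s₁₂) (∈- (∈v {X - u}) s≢a))
    where
    s∉X : s ∉ X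
    s∉X q = -≢ {p = A +⟨ u , v ⟩} (inˡ (parts sp) q) refl
    s≢a : s ≢ a
    s≢a refl = s∉X aX
    s+ : s ∈ (A +⟨ u , v ⟩) - a
    s+ = ∈- (∈A s∈) s≢a
    fin : ∀ X₁ X₂ → Split (((X - u) +⟨ u , s ⟩) - a) X₁ X₂ → s ∈ X₂ → ⊥
    fin X₁ X₂ s₁₂ sX₂ = H X₁ (((A +⟨ u , v ⟩) - a) ─ X₁) (record
      { parts = part-─ (λ q → ∈- (-ˡ {p = A +⟨ u , v ⟩} (inˡ (parts sp) (toX q))) (≢a q))
      ; neA = neA s₁₂
      ; neB = s , ∈─ s+ (λ q → dis (parts s₁₂) q sX₂)
      ; apart = λ p q e → far p (─ˡ {p = (A +⟨ u , v ⟩) - a} q) (─ʳ {p = (A +⟨ u , v ⟩) - a} q) e })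
      where
      ≢a : ∀ {w} → w ∈ X₁ → w ≢ a
      ≢a q = -≢ {p = (X - u) +⟨ u , s ⟩} (inˡ (parts s₁₂) q)
      toX : ∀ {w} → w ∈ X₁ → w ∈ X
      toX q = [ -ˡ {p = X} , [ (λ { refl → uX }) , (λ { refl → ⊥-elim (dis (parts s₁₂) q sX₂) }) ]′ ]′
        (case+ {X - u} (-ˡ {p = (X - u) +⟨ u , s ⟩} (inˡ (parts s₁₂) q)))
      inner : ∀ {w} → w ∈ X → w ∈ (X - u) +⟨ u , s ⟩
      inner {w} w∈ = at (w ≟ u)
        where
        at : Dec (w ≡ u) → w ∈ (X - u) +⟨ u , s ⟩
        at (yes refl) = ∈u {X - u}
        at (no w≢u) = ∈A (∈- w∈ w≢u)
      far : ∀ {x y} → x ∈ X₁ → y ∈ (A +⟨ u , v ⟩) - a → y ∉ X₁ → ¬ Adj x y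
      far {x} {y} x∈ y∈ y∉ e = at (y ≟ s)
        where
        at : Dec (y ≡ s) → ⊥
        at (yes refl) = apart s₁₂ x∈ sX₂ e
        at (no y≢s) = [ (λ q → [ y∉ , (λ r → apart s₁₂ x∈ r e) ]′ (cov (parts s₁₂) (∈- (inner q) (-≢ {p = A +⟨ u , v ⟩} y∈))))
                      , (λ q → apart sp (toX x∈) q e) ]′ (cov (parts sp) (∈- (-ˡ {p = A +⟨ u , v ⟩} y∈) y≢s))
    go : ∀ X₁ X₂ → Split (((X - u) +⟨ u , s ⟩) - a) X₁ X₂ → s ∈ X₁ ⊎ s ∈ X₂ → ⊥
    go X₁ X₂ s₁₂ (inj₁ q) = fin X₂ X₁ (split-swap s₁₂) q
    go X₁ X₂ s₁₂ (inj₂ q) = fin X₁ X₂ s₁₂ q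

  module _ (n≥7 : 7 ≤ n) where

    cut-five : ∀ {A B u v} → Cut A B u v → 5 ≤ ∣ A ∣ + ∣ B ∣
    cut-five {A} {B} c = +-cancelʳ-≤ 2 5 (∣ A ∣ + ∣ B ∣) (≤-trans n≥7 (≤-reflexive (sym (cut-size c))))

    private
      -- Descent on `A`, with `a` a vertex of it that does not separate the cut vertices. If some
      -- `s` of `A` does separate them, the part with `a` gives a smaller side in which `a` still
      -- does not separate; if none does, `Tight` applies.
      go : ∀ A → Acc _<_ ∣ A ∣ → ∀ {B u v a} → Cut A B u v → a ∈ A → NoSplit ((A +⟨ u , v ⟩) - a) → ⊥
      go A (acc rs) {B} {u} {v} {a} c a∈ H = scan (any? (λ s → (s ∈? A) ×-dec ¬? (NoSplit? ((A +⟨ u , v ⟩) - s))))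
        where
        smaller : ∀ {u v s X Y} → Cut A B u v → s ∈ A → Split ((A +⟨ u , v ⟩) - s) X Y → u ∈ X → v ∈ Y →
          NoSplit ((A +⟨ u , v ⟩) - a) → a ∈ X → ⊥
        smaller {u} {v} {s} {X} {Y} c s∈ sp uX vY H aX = use (subcut c s∈ sp uX vY aX a≢u)
          where
          a≢u : a ≢ u
          a≢u refl = u∉A c a∈
          shrink : ∣ X - u ∣ < ∣ A ∣
          shrink = p⊂q⇒∣p∣<∣q∣ ((λ q → [ (λ r → r) , [ (λ r → ⊥-elim (-≢ {p = X} q r)) , (λ { refl → ⊥-elim (dis (parts sp) (-ˡ {p = X} q) vY) }) ]′ ]′
              (case+ {A} (-ˡ {p = A +⟨ u , v ⟩} (inˡ (parts sp) (-ˡ {p = X} q)))))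
            , s , s∈ , λ q → -≢ {p = A +⟨ u , v ⟩} (inˡ (parts sp) (-ˡ {p = X} q)) refl)
          use : ∃[ B′ ] (Cut (X - u) B′ u s) → ⊥
          use (B′ , cut) = go (X - u) (rs shrink) cut (∈- aX a≢u) (descend c s∈ sp uX vY H a∈ aX)
        oriented : ∀ {s} X Y → s ∈ A → s ≢ a → Split ((A +⟨ u , v ⟩) - s) X Y → u ∈ X → v ∈ Y → ⊥
        oriented {s} X Y s∈ s≢a sp uX vY = [ smaller c s∈ sp uX vY H
          , smaller (cut-swap c) s∈ (split-swap (subst (λ Z → Split (Z - s) X Y) (plus-swap A u v) sp)) vY uX
              (subst (λ Z → NoSplit (Z - a)) (plus-swap A u v) H) ]′ (cov (parts sp) (∈- (∈A a∈) (s≢a ∘ sym)))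
        split : ∀ {s} → s ∈ A → s ≢ a → ¬ NoSplit ((A +⟨ u , v ⟩) - s) →
          NoSplit ((A +⟨ u , v ⟩) - s) ⊎ ∃[ X ] ∃[ Y ] Split ((A +⟨ u , v ⟩) - s) X Y → ⊥
        split s∈ s≢a ¬ns (inj₁ ns) = ¬ns ns
        split s∈ s≢a ¬ns (inj₂ (X , Y , sp)) = [ (λ (p , q) → oriented X Y s∈ s≢a sp p q)
          , (λ (p , q) → oriented Y X s∈ s≢a (split-swap sp) p q) ]′ (ends-apart c s∈ sp)
        scan : Dec (∃[ s ] (s ∈ A × ¬ NoSplit ((A +⟨ u , v ⟩) - s))) → ⊥
        scan (no ¬e) = Tight.impossible c (λ {s} s∈ → decidable-stable (NoSplit? ((A +⟨ u , v ⟩) - s)) (λ ¬ns → ¬e (s , s∈ , ¬ns))) (cut-five c)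
        scan (yes (s , s∈ , ¬ns)) = split s∈ (λ { refl → ¬ns H }) ¬ns (NoSplit-dec ((A +⟨ u , v ⟩) - s))

    side-splits : ∀ {A B u v a} → Cut A B u v → a ∈ A → ∃[ X ] ∃[ Y ] (Split ((A +⟨ u , v ⟩) - a) X Y × u ∈ X × v ∈ Y)
    side-splits {A} {B} {u} {v} {a} c a∈ = use (NoSplit-dec ((A +⟨ u , v ⟩) - a))
      where
      use : NoSplit ((A +⟨ u , v ⟩) - a) ⊎ ∃[ X ] ∃[ Y ] Split ((A +⟨ u , v ⟩) - a) X Y →
        ∃[ X ] ∃[ Y ] (Split ((A +⟨ u , v ⟩) - a) X Y × u ∈ X × v ∈ Y)
      use (inj₁ ns) = ⊥-elim (go A (<-wellFounded _) c a∈ ns)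
      use (inj₂ (X , Y , sp)) = [ (λ (p , q) → X , Y , sp , p , q) , (λ (p , q) → Y , X , split-swap sp , p , q) ]′ (ends-apart c a∈ sp)

-- Graphs in which every vertex of a side separates the cut vertices.

module FatCycle {n m : ℕ} (G : Graph n m) (lab : Subset m → Label) (qb : QuasiBiased G lab)
            (threeConnected : ThreeConnected ⊤ (MCircuit G lab))
            (unbreakable : Unbreakable ⊤ (MCircuit G lab))
            (notGraphic : ¬ Graphic (MCircuit G lab))
            (connected : ∀ A B → ¬ Vertices.Split G lab ⊤ A B)
            (connected₂ : ∀ x A B → ¬ Vertices.Split G lab (⊤ - x) A B)
            (n≥7 : 7 ≤ n) where
  open Cuts G lab qb threeConnected unbreakable notGraphic connected connected₂

  cut-nonadjacent : ∀ {A B u v} → Cut A B u v → ¬ Adj u v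
  cut-nonadjacent c = let (a , a∈) = neˡ c ; (X , Y , sp , uX , vY) = side-splits n≥7 c a∈ in apart sp uX vY

  -- A neighbour of `u` in `A` other than `a` would lie on the same side of `a` as `u`, which makes
  -- `u` and `a` a cut; but the two vertices of a cut are never adjacent.
  unique-neighbour : ∀ {A B u v} → Cut A B u v → ∃[ a ] (a ∈ A × Adj u a × (∀ {x} → x ∈ A → Adj u x → x ≡ a))
  unique-neighbour {A} {B} {u} {v} c = use (attach c)
    where
    use : ∃[ a ] (a ∈ A × Adj u a) → ∃[ a ] (a ∈ A × Adj u a × (∀ {x} → x ∈ A → Adj u x → x ≡ a))
    use (a , a∈ , e) = let (X , Y , sp , uX , vY) = side-splits n≥7 c a∈ in a , a∈ , e , only sp uX vY
      where
      only : ∀ {X Y} → Split ((A +⟨ u , v ⟩) - a) X Y → u ∈ X → v ∈ Y → ∀ {x} → x ∈ A → Adj u x → x ≡ a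
      only {X} {Y} sp uX vY {x} x∈ f = decidable-stable (x ≟ a) λ x≢a →
        [ (λ q → cut-nonadjacent (proj₂ (subcut c a∈ sp uX vY q (λ { refl → u∉A c x∈ }))) e)
        , (λ q → apart sp uX q f) ]′ (cov (parts sp) (∈- (∈A x∈) x≢a))

  record TwoNeighbours (w : Fin n) : Set where
    field
      p q : Fin n
      p≢q : p ≢ q
      w≢p : w ≢ p
      w≢q : w ≢ q
      wp  : Adj w p
      wq  : Adj w q
      nbr : ∀ {x} → Adj w x → w ≢ x → x ≡ p ⊎ x ≡ q

  cut-two : ∀ {A B u v} → Cut A B u v → TwoNeighbours u
  cut-two {A} {B} {u} {v} c = build (unique-neighbour c) (unique-neighbour (cut-flip c))
    where
    Unique : Subset n → Set
    Unique Z = ∃[ a ] (a ∈ Z × Adj u a × (∀ {x} → x ∈ Z → Adj u x → x ≡ a))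
    build : Unique A → Unique B → TwoNeighbours u
    build (a , a∈ , ea , onlyA) (b , b∈ , eb , onlyB) = record
      { p = a ; q = b ; p≢q = λ { refl → A∩B c a∈ b∈ } ; w≢p = λ { refl → u∉A c a∈ } ; w≢q = λ { refl → u∉B c b∈ }
      ; wp = ea ; wq = eb
      ; nbr = λ {x} e u≢x → place e u≢x (cover c x) }
      where
      place : ∀ {x} → Adj u x → u ≢ x → x ∈ A ⊎ x ∈ B ⊎ x ≡ u ⊎ x ≡ v → x ≡ a ⊎ x ≡ b
      place e u≢x (inj₁ q) = inj₁ (onlyA q e)
      place e u≢x (inj₂ (inj₁ q)) = inj₂ (onlyB q e)
      place e u≢x (inj₂ (inj₂ (inj₁ q))) = ⊥-elim (u≢x (sym q))
      place e u≢x (inj₂ (inj₂ (inj₂ refl))) = ⊥-elim (cut-nonadjacent c e)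

  -- One side splits at `x` and the other at `b`, both between `u` and `v`. Gluing the two parts at
  -- `u`, and the two at `v`, turns `x` and `b` into a cut. So every vertex lies in some cut, and
  -- `cut-two` applies to all of them.
  crossing-cut : ∀ {A B u v x b} → Cut A B u v → x ∈ A → b ∈ B → ∃[ A′ ] ∃[ B′ ] Cut A′ B′ x b
  crossing-cut {A} {B} {u} {v} {x} {b} c x∈ b∈ =
    let (X , Y , sp , uX , vY) = side-splits n≥7 c x∈ ; (X′ , Y′ , sp′ , uX′ , vY′) = side-splits n≥7 (cut-flip c) b∈ in
    X ∪ X′ , Y ∪ Y′ , build sp uX vY sp′ uX′ vY′
    where
    build : ∀ {X Y X′ Y′} → Split ((A +⟨ u , v ⟩) - x) X Y → u ∈ X → v ∈ Y →
      Split ((B +⟨ u , v ⟩) - b) X′ Y′ → u ∈ X′ → v ∈ Y′ → Cut (X ∪ X′) (Y ∪ Y′) x b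
    build {X} {Y} {X′} {Y′} sp uX vY sp′ uX′ vY′ = record
      { neˡ = u , ∈∪ˡ uX ; neʳ = v , ∈∪ˡ vY
      ; u≢v = λ { refl → A∩B c x∈ b∈ }
      ; u∉A = λ q → [ x∉ ∘ inˡ (parts sp) , x∉′ ∘ inˡ (parts sp′) ]′ (∪-case q)
      ; v∉A = λ q → [ b∉ ∘ inˡ (parts sp) , b∉′ ∘ inˡ (parts sp′) ]′ (∪-case q)
      ; u∉B = λ q → [ x∉ ∘ inʳ (parts sp) , x∉′ ∘ inʳ (parts sp′) ]′ (∪-case q)
      ; v∉B = λ q → [ b∉ ∘ inʳ (parts sp) , b∉′ ∘ inʳ (parts sp′) ]′ (∪-case q)
      ; A∩B = λ p q → disjoint (∪-case p) (∪-case q)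
      ; cover = λ w → place w (w ≟ x) (w ≟ b) (cover c w)
      ; sep = λ p q e → apart′ (∪-case p) (∪-case q) e }
      where
      S = (A +⟨ u , v ⟩) - x
      S′ = (B +⟨ u , v ⟩) - b
      x∉ : x ∉ S
      x∉ q = -≢ {p = A +⟨ u , v ⟩} q refl
      b∉′ : b ∉ S′
      b∉′ q = -≢ {p = B +⟨ u , v ⟩} q refl
      x∉′ : x ∉ S′
      x∉′ q = [ A∩B c x∈ , [ (λ { refl → u∉A c x∈ }) , (λ { refl → v∉A c x∈ }) ]′ ]′ (case+ {B} (-ˡ {p = B +⟨ u , v ⟩} q))
      b∉ : b ∉ S
      b∉ q = [ (λ r → A∩B c r b∈) , [ (λ { refl → u∉B c b∈ }) , (λ { refl → v∉B c b∈ }) ]′ ]′ (case+ {A} (-ˡ {p = A +⟨ u , v ⟩} q))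
      both : ∀ {w} → w ∈ S → w ∈ S′ → w ≡ u ⊎ w ≡ v
      both q r with case+ {A} (-ˡ {p = A +⟨ u , v ⟩} q) | case+ {B} (-ˡ {p = B +⟨ u , v ⟩} r)
      ... | inj₂ t | _ = t
      ... | inj₁ _ | inj₂ t = t
      ... | inj₁ a | inj₁ b = ⊥-elim (A∩B c a b)
      disjoint : ∀ {w} → w ∈ X ⊎ w ∈ X′ → w ∈ Y ⊎ w ∈ Y′ → ⊥
      disjoint (inj₁ p) (inj₁ q) = dis (parts sp) p q
      disjoint (inj₂ p) (inj₂ q) = dis (parts sp′) p q
      disjoint (inj₁ p) (inj₂ q) = [ (λ { refl → dis (parts sp′) uX′ q }) , (λ { refl → dis (parts sp) p vY }) ]′ (both (inˡ (parts sp) p) (inʳ (parts sp′) q))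
      disjoint (inj₂ p) (inj₁ q) = [ (λ { refl → dis (parts sp) uX q }) , (λ { refl → dis (parts sp′) p vY′ }) ]′ (both (inʳ (parts sp) q) (inˡ (parts sp′) p))
      cross : ∀ {X Y X′ Y′ w z} → Split S X Y → v ∈ Y → Split S′ X′ Y′ → u ∈ X′ → u ∈ X → v ∈ Y′ →
        w ∈ X → z ∈ Y′ → ¬ Adj w z
      cross s vY s′ uX′ uX vY′ p q e with case+ {A} (-ˡ {p = A +⟨ u , v ⟩} (inˡ (parts s) p)) | case+ {B} (-ˡ {p = B +⟨ u , v ⟩} (inʳ (parts s′) q))
      ... | inj₁ a | inj₁ b = sep c a b e
      ... | inj₂ (inj₁ refl) | _ = apart s′ uX′ q e
      ... | inj₂ (inj₂ refl) | _ = dis (parts s) p vY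
      ... | inj₁ _ | inj₂ (inj₁ refl) = dis (parts s′) uX′ q
      ... | inj₁ _ | inj₂ (inj₂ refl) = apart s p vY e
      cross′ : ∀ {w z} → w ∈ X′ → z ∈ Y → ¬ Adj w z
      cross′ p q e with case+ {B} (-ˡ {p = B +⟨ u , v ⟩} (inˡ (parts sp′) p)) | case+ {A} (-ˡ {p = A +⟨ u , v ⟩} (inʳ (parts sp) q))
      ... | inj₁ b | inj₁ a = sep c a b (adj-sym e)
      ... | inj₂ (inj₁ refl) | _ = apart sp uX q e
      ... | inj₂ (inj₂ refl) | _ = dis (parts sp′) p vY′
      ... | inj₁ _ | inj₂ (inj₁ refl) = dis (parts sp) uX q
      ... | inj₁ _ | inj₂ (inj₂ refl) = apart sp′ p vY′ e
      apart′ : ∀ {w z} → w ∈ X ⊎ w ∈ X′ → z ∈ Y ⊎ z ∈ Y′ → ¬ Adj w z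
      apart′ (inj₁ p) (inj₁ q) = apart sp p q
      apart′ (inj₂ p) (inj₂ q) = apart sp′ p q
      apart′ (inj₁ p) (inj₂ q) = cross sp vY sp′ uX′ uX vY′ p q
      apart′ (inj₂ p) (inj₁ q) = cross′ p q
      place : ∀ w → Dec (w ≡ x) → Dec (w ≡ b) → w ∈ A ⊎ w ∈ B ⊎ w ≡ u ⊎ w ≡ v → w ∈ X ∪ X′ ⊎ w ∈ Y ∪ Y′ ⊎ w ≡ x ⊎ w ≡ b
      place w (yes p) _ _ = inj₂ (inj₂ (inj₁ p))
      place w (no _) (yes p) _ = inj₂ (inj₂ (inj₂ p))
      place w (no p) (no q) (inj₁ a) = [ inj₁ ∘ ∈∪ˡ , inj₂ ∘ inj₁ ∘ ∈∪ˡ ]′ (cov (parts sp) (∈- (∈A a) p))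
      place w (no p) (no q) (inj₂ (inj₁ b)) = [ inj₁ ∘ ∈∪ʳ , inj₂ ∘ inj₁ ∘ ∈∪ʳ ]′ (cov (parts sp′) (∈- (∈A b) q))
      place w (no p) (no q) (inj₂ (inj₂ (inj₁ refl))) = inj₁ (∈∪ˡ uX)
      place w (no p) (no q) (inj₂ (inj₂ (inj₂ refl))) = inj₂ (inj₁ (∈∪ˡ vY))

  module _ {A₀ B₀ : Subset n} {u₀ v₀ : Fin n} (c₀ : Cut A₀ B₀ u₀ v₀) where

    two-neighbours : ∀ w → TwoNeighbours w
    two-neighbours w = at (cover c₀ w)
      where
      at : w ∈ A₀ ⊎ w ∈ B₀ ⊎ w ≡ u₀ ⊎ w ≡ v₀ → TwoNeighbours w
      at (inj₁ a) = cut-two (proj₂ (proj₂ (crossing-cut c₀ a (proj₂ (neʳ c₀)))))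
      at (inj₂ (inj₁ b)) = cut-two (proj₂ (proj₂ (crossing-cut (cut-flip c₀) b (proj₂ (neˡ c₀)))))
      at (inj₂ (inj₂ (inj₁ refl))) = cut-two c₀
      at (inj₂ (inj₂ (inj₂ refl))) = cut-two (cut-swap c₀)

    Second : Fin n → Fin n → Set
    Second a b = ∃[ t ] (a ≢ t × b ≢ t × Adj a t × (∀ {x} → Adj a x → a ≢ x → x ≡ b ⊎ x ≡ t))

    second-neighbour : ∀ {a b} → a ≢ b → Adj a b → Second a b
    second-neighbour {a} {b} a≢b ab = at (nbr ab a≢b)
      where
      open TwoNeighbours (two-neighbours a)
      at : b ≡ p ⊎ b ≡ q → Second a b
      at (inj₁ b≡p) = q , w≢q , (λ b≡q → p≢q (trans (sym b≡p) b≡q)) , wq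
        , λ {x} e a≢x → [ (λ x≡p → inj₁ (trans x≡p (sym b≡p))) , inj₂ ]′ (nbr e a≢x)
      at (inj₂ b≡q) = p , w≢p , (λ b≡p → p≢q (trans (sym b≡p) b≡q)) , wp
        , λ {x} e a≢x → [ inj₂ , (λ x≡q → inj₁ (trans x≡q (sym b≡q))) ]′ (nbr e a≢x)

    -- Simplification

    Par : Fin m → Fin m → Set
    Par = Parallel G

    Par? : ∀ e f → Dec (Par e f)
    Par? e f = ((src G e ≟ src G f) ×-dec (tgt G e ≟ tgt G f)) ⊎-dec ((src G e ≟ tgt G f) ×-dec (tgt G e ≟ src G f))

    par-sym : ∀ {e f} → Par e f → Par f e
    par-sym (inj₁ (p , q)) = inj₁ (sym p , sym q)
    par-sym (inj₂ (p , q)) = inj₂ (sym q , sym p)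

    par-trans : ∀ {e f g} → Par e f → Par f g → Par e g
    par-trans (inj₁ (p , q)) (inj₁ (r , s)) = inj₁ (trans p r , trans q s)
    par-trans (inj₁ (p , q)) (inj₂ (r , s)) = inj₂ (trans p r , trans q s)
    par-trans (inj₂ (p , q)) (inj₁ (r , s)) = inj₂ (trans p s , trans q r)
    par-trans (inj₂ (p , q)) (inj₂ (r , s)) = inj₁ (trans p s , trans q r)

    joins-par : ∀ {e f x y} → Joins e x y → Joins f x y → Par e f
    joins-par (inj₁ (p , q)) (inj₁ (r , s)) = inj₁ (trans p (sym r) , trans q (sym s))
    joins-par (inj₁ (p , q)) (inj₂ (r , s)) = inj₂ (trans p (sym s) , trans q (sym r))
    joins-par (inj₂ (p , q)) (inj₁ (r , s)) = inj₂ (trans p (sym s) , trans q (sym r))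
    joins-par (inj₂ (p , q)) (inj₂ (r , s)) = inj₁ (trans p (sym r) , trans q (sym s))

    par-joins : ∀ {e f x y} → Par e f → Joins e x y → Joins f x y
    par-joins (inj₁ (p , q)) (inj₁ (r , s)) = inj₁ (trans (sym p) r , trans (sym q) s)
    par-joins (inj₁ (p , q)) (inj₂ (r , s)) = inj₂ (trans (sym p) r , trans (sym q) s)
    par-joins (inj₂ (p , q)) (inj₁ (r , s)) = inj₂ (trans (sym q) s , trans (sym p) r)
    par-joins (inj₂ (p , q)) (inj₂ (r , s)) = inj₁ (trans (sym q) s , trans (sym p) r)

    -- Each parallel class of non-loops is represented by its edge of least index.
    S? : ∀ e → Dec (¬ IsLoop G e × (∀ f → Par e f → toℕ e ≤ toℕ f))
    S? e = ¬? (src G e ≟ tgt G e) ×-dec all? (λ f → Par? e f →-dec (toℕ e ≤? toℕ f))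

    S : Subset m
    S = ⟪ S? ⟫

    least : ∀ e → Acc _<_ (toℕ e) → ∃[ f ] (Par e f × (∀ g → Par f g → toℕ f ≤ toℕ g))
    least e (acc rs) = at (any? (λ f → Par? e f ×-dec (suc (toℕ f) ≤? toℕ e)))
      where
      at : Dec (∃[ f ] (Par e f × toℕ f < toℕ e)) → ∃[ f ] (Par e f × (∀ g → Par f g → toℕ f ≤ toℕ g))
      at (yes (f , p , lt)) = let (g , q , min) = least f (rs lt) in g , par-trans p q , min
      at (no ¬e) = e , inj₁ (refl , refl) , λ g p → ≮⇒≥ (λ lt → ¬e (g , p , lt))

    representative : ∀ {x y} → Adj x y → x ≢ y → ∃[ f ] (f ∈ S × Joins f x y)
    representative (e , j) x≢y = let (f , p , min) = least e (<-wellFounded _) in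
      f , ∈⟪⟫ S? (joins-nonloop (par-joins p j) x≢y , min) , par-joins p j

    S-unique : ∀ e f → e ∈ S → f ∈ S → Par e f → e ≡ f
    S-unique e f e∈ f∈ p = toℕ-injective (≤-antisym (proj₂ (⟪⟫∈ S? e∈) f p) (proj₂ (⟪⟫∈ S? f∈) e (par-sym p)))

    simplification : SimplificationEdges G S
    simplification = (λ e e∈ → proj₁ (⟪⟫∈ S? e∈))
      , (λ e ¬l → let (f , f∈ , j) = representative (e , inj₁ (refl , refl)) ¬l in f , f∈ , joins-par (inj₁ (refl , refl)) j)
      , S-unique

    S-V : ∀ w → V S w
    S-V w = let (f , f∈ , j) = representative wp w≢p in f , f∈ , joinsˡ j
      where open TwoNeighbours (two-neighbours w)

    S-connected : EConn S
    S-connected = mkConn λ X Y p (x , x∈) (y , y∈) vd → connected (VS X) (⊤ ─ VS X) (record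
      { parts = part-─ ⊆⊤
      ; neA = src G x , inVS {X} (x , x∈ , inj₁ refl)
      ; neB = src G y , ∈─ ∈⊤ (λ q → vd (src G y) (outVS {X} q , (y , y∈ , inj₁ refl)))
      ; apart = λ {a} {b} a∈ b∈ e → across p vd (outVS {X} a∈) (λ q → ─ʳ {p = ⊤} b∈ (inVS {X} q)) e })
      where
      across : ∀ {X Y} → S ≐ X ⊔ Y → VertexDisjoint G X Y → ∀ {a b} → V X a → ¬ V X b → ¬ Adj a b
      across {X} {Y} p vd {a} {b} aX ¬bX e = let (f , f∈ , j) = representative e (λ { refl → ¬bX aX }) in
        [ (λ q → ¬bX (f , q , joinsʳ j)) , (λ q → vd a (aX , (f , q , joinsˡ j))) ]′ (cov p f∈)

    S-deg : ∀ w → d S w ≡ 2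
    S-deg w = let (f , f∈ , j) = representative wp w≢p ; (g , g∈ , k) = representative wq w≢q in count f∈ j g∈ k
      where
      open TwoNeighbours (two-neighbours w)
      count : ∀ {f g} → f ∈ S → Joins f w p → g ∈ S → Joins g w q → d S w ≡ 2
      count {f} {g} f∈ j g∈ k = begin
          d S w                                   ≡⟨ d-remove {S} f∈ w ⟩
          inc f w + d (S - f) w                   ≡⟨ cong₂ _+_ (inc-nonloop (joins-nonloop j w≢p) (joinsˡ j)) (d-remove {S - f} (∈- g∈ g≢f) w) ⟩
          1 + (inc g w + d (S - f - g) w)         ≡⟨ cong suc (cong₂ _+_ (inc-nonloop (joins-nonloop k w≢q) (joinsˡ k)) (d-zero {S - f - g} none)) ⟩
          2                                       ∎
        where
        open ≡-Reasoning
        g≢f : g ≢ f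
        g≢f refl = [ w≢q ∘ sym , p≢q ∘ sym ]′ (joins-end j (joinsʳ k))
        none : ¬ V (S - f - g) w
        none (e , e∈ , i) = at (other-end (proj₁ (⟪⟫∈ S? e∈S)) i)
          where
          e∈S : e ∈ S
          e∈S = -ˡ {p = S} (-ˡ {p = S - f} e∈)
          at : ∃[ x ] (x ≢ w × Inc G e x) → ⊥
          at (x , x≢w , ix) = [ (λ { refl → -≢ {p = S} (-ˡ {p = S - f} e∈) (S-unique e f e∈S f∈ (joins-par jx j)) })
                              , (λ { refl → -≢ {p = S - f} e∈ (S-unique e g e∈S g∈ (joins-par jx k)) }) ]′ (nbr (e , jx) (x≢w ∘ sym))
            where
            jx : Joins e w x
            jx = inc-joins i ix (x≢w ∘ sym)

    si-cycle : SiIsCycle G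
    si-cycle = S , simplification , ((let (e , e∈ , _) = S-V u₀ in e , e∈) , S-connected , (λ v _ → S-deg v)) , S-V

    -- Free cycles

    -- Some vertex `x` of `C` has a neighbour off `C`. Only one other neighbour `z` is left, so the
    -- edges of `C` at `x` are loops or run to `z`, and `C` is a loop or a digon.
    short : ∀ {C w} → Cycle C → ¬ V C w → ∃[ p ] ∃[ q ] (p ≢ q × Adj p q × (∀ {x} → V C x → x ≡ p ⊎ x ≡ q))
    short {C} {w} c ¬w = use (noSplit-grows {VS C} {⊤} ne connected (VS C) ⊆-refl ⊆⊤ (w , ∈⊤ , ¬w ∘ outVS {C}))
      where
      ne : Nonempty (VS C)
      ne = let (e , e∈) = proj₁ c in src G e , inVS {C} (e , e∈ , inj₁ refl)
      Goal : Set
      Goal = ∃[ p ] ∃[ q ] (p ≢ q × Adj p q × (∀ {x} → V C x → x ≡ p ⊎ x ≡ q))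
      use : ∃[ x ] ∃[ y ] (x ∈ VS C × y ∈ ⊤ × y ∉ VS C × Adj x y) → Goal
      use (x , y , x∈ , _ , y∉ , e) = at (outVS {C} x∈)
        where
        x≢y : x ≢ y
        x≢y refl = y∉ x∈
        other : Second x y
        other = second-neighbour x≢y e
        z = proj₁ other
        x≢z : x ≢ z
        x≢z = proj₁ (proj₂ other)
        xz : Adj x z
        xz = proj₁ (proj₂ (proj₂ (proj₂ other)))
        only : ∀ {t} → Adj x t → x ≢ t → t ≢ y → t ≡ z
        only f x≢t t≢y = [ (λ t≡y → ⊥-elim (t≢y t≡y)) , (λ r → r) ]′ (proj₂ (proj₂ (proj₂ (proj₂ other))) f x≢t)
        to-z : ∀ {f} → f ∈ C → Inc G f x → ¬ IsLoop G f → Joins f x z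
        to-z {f} f∈ i ¬l = let (t , t≢x , it) = other-end ¬l i ; j = inc-joins i it (t≢x ∘ sym) in
          subst (Joins f x) (only (f , j) (t≢x ∘ sym) (λ { refl → y∉ (inVS {C} (f , f∈ , it)) })) j
        looped : ∀ {f} → f ∈ C → Inc G f x → IsLoop G f → Goal
        -- A loop has one vertex; `z` only fills the second place with a neighbour.
        looped {f} f∈ i l = x , z , x≢z , xz , λ {t} vt → inj₁ (at-x l i (V-sing (subst (λ Z → V Z t) (loop-cycle c f∈ l) vt)))
          where
          at-x : ∀ {t} → IsLoop G f → Inc G f x → Inc G f t → t ≡ x
          at-x l (inj₁ refl) (inj₁ refl) = refl
          at-x l (inj₁ refl) (inj₂ refl) = sym l
          at-x l (inj₂ refl) (inj₁ refl) = l
          at-x l (inj₂ refl) (inj₂ refl) = refl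
        digon : ∀ {f g} → f ∈ C → g ∈ C → g ≢ f → Joins f x z → Joins g x z → Goal
        digon {f} {g} f∈ g∈ g≢f j k = x , z , x≢z , xz , λ vt → ends (V-mono (cycle-closed c Y⊆C (f , ∈∪ˡ (x∈⁅x⁆ f)) Y≥2) vt)
          where
          Y : Subset m
          Y = ⁅ f ⁆ ∪ ⁅ g ⁆
          Y⊆C : Y ⊆ C
          Y⊆C = ∪-lub {p = ⁅ f ⁆} (λ q → subst (_∈ C) (sym (sing≡ q)) f∈) (λ q → subst (_∈ C) (sym (sing≡ q)) g∈)
          ends : ∀ {t} → V Y t → t ≡ x ⊎ t ≡ z
          ends q = [ joins-end j ∘ V-sing , joins-end k ∘ V-sing ]′ (V-∪ {⁅ f ⁆} q)
          Y≥2 : ∀ {t} → V Y t → 2 ≤ d Y t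
          Y≥2 {t} q = ≤-trans ([ (λ { refl → +-mono-≤ (inc-pos (joinsˡ j)) (inc-pos (joinsˡ k)) })
                               , (λ { refl → +-mono-≤ (inc-pos (joinsʳ j)) (inc-pos (joinsʳ k)) }) ]′ (ends q))
            (d-two {Y} {f} {g} (∈∪ˡ (x∈⁅x⁆ f)) (∈∪ʳ {p = ⁅ f ⁆} (x∈⁅x⁆ g)) (g≢f ∘ sym) t)
        at : V C x → Goal
        at (f , f∈ , i) = first (src G f ≟ tgt G f)
          where
          second : ¬ IsLoop G f → ∃[ g ] (g ∈ C × g ≢ f × Inc G g x) → Goal
          second ¬l (g , g∈ , g≢f , k) = third (src G g ≟ tgt G g)
            where
            third : Dec (IsLoop G g) → Goal
            third (yes l) = looped g∈ k l
            third (no ¬l′) = digon f∈ g∈ g≢f (to-z f∈ i ¬l) (to-z g∈ k ¬l′)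
          first : Dec (IsLoop G f) → Goal
          first (yes l) = looped f∈ i l
          first (no ¬l) = second ¬l (d-second {C} f∈ (≤-reflexive (inc-nonloop ¬l i))
            (≤-reflexive (sym (proj₂ (proj₂ c) x (f , f∈ , i)))))

    -- Meant for a vertex set that falls into two connected pieces, each containing one of two
    -- disjoint seed cycles.
    grows-∪ : ∀ {T₀ U₁ U₂ W} → (∀ {w} → w ∈ W → w ∈ U₁ ⊎ w ∈ U₂) → U₁ ⊆ W → U₂ ⊆ W → NoSplit U₁ → NoSplit U₂ →
      ∃[ t ] (t ∈ T₀ × t ∈ U₁) → ∃[ t ] (t ∈ T₀ × t ∈ U₂) → Grows T₀ W
    grows-∪ {T₀} {U₁} {U₂} {W} cv s₁ s₂ n₁ n₂ m₁ m₂ T T₀⊆T T⊆W (y , y∈W , y∉T) =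
      [ (λ q → part U₁ s₁ n₁ m₁ q) , (λ q → part U₂ s₂ n₂ m₂ q) ]′ (cv y∈W)
      where
      part : ∀ U → U ⊆ W → NoSplit U → ∃[ t ] (t ∈ T₀ × t ∈ U) → y ∈ U → ∃[ x ] ∃[ y ] (x ∈ T × y ∈ W × y ∉ T × Adj x y)
      part U s ns (t , t∈ , t∈U) y∈U = repack (noSplit-grows {T ∩ U} {U} (t , x∈p∩q⁺ (T₀⊆T t∈ , t∈U)) ns (T ∩ U) ⊆-refl (p∩q⊆q T U) (y , y∈U , λ q → y∉T (p∩q⊆p T U q)))
        where
        repack : ∃[ x ] ∃[ y ] (x ∈ T ∩ U × y ∈ U × y ∉ T ∩ U × Adj x y) → ∃[ x ] ∃[ y ] (x ∈ T × y ∈ W × y ∉ T × Adj x y)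
        repack (x , y , x∈ , y∈ , y∉ , e) = x , y , p∩q⊆p T U x∈ , s y∈ , (λ q → y∉ (x∈p∩q⁺ (q , y∈))) , e

    outside : ∀ {W : Subset n} → ∣ W ∣ ≤ 6 → ∃[ t ] (t ∉ W)
    outside {W} le = use (⊆-or-witness ⊤ W)
      where
      use : ⊤ ⊆ W ⊎ ∃[ x ] (x ∈ ⊤ × x ∉ W) → ∃[ t ] (t ∉ W)
      use (inj₁ s) = ⊥-elim (<⇒≱ n≥7 (≤-trans (≤-reflexive (sym (∣⊤∣≡n n))) (≤-trans (p⊆q⇒∣p∣≤∣q∣ s) le)))
      use (inj₂ (t , _ , t∉)) = t , t∉

    -- Growing twice from one vertex: the third vertex is adjacent to one of the first two, which
    -- becomes the middle one.
    middle : ∀ {B} → NoSplit B → 3 ≤ ∣ B ∣ → ∃[ b ] ∃[ y ] ∃[ z ] (b ∈ B × y ∈ B × z ∈ B × b ≢ y × b ≢ z × y ≢ z × Adj b y × Adj b z)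
    middle {B} ns three = first (card-elem (≤-trans (s≤s z≤n) three))
      where
      Goal : Set
      Goal = ∃[ b ] ∃[ y ] ∃[ z ] (b ∈ B × y ∈ B × z ∈ B × b ≢ y × b ≢ z × y ≢ z × Adj b y × Adj b z)
      first : Nonempty B → Goal
      first (b , b∈) = second (noSplit-grows {⁅ b ⁆} {B} (b , x∈⁅x⁆ b) ns ⁅ b ⁆ ⊆-refl (λ q → subst (_∈ B) (sym (sing≡ q)) b∈)
          (let (y , y∈ , y≢b) = card-second b (≤-trans (n≤1+n 2) three) in y , y∈ , y≢b ∘ sing≡))
        where
        second : ∃[ x ] ∃[ y ] (x ∈ ⁅ b ⁆ × y ∈ B × y ∉ ⁅ b ⁆ × Adj x y) → Goal
        second (x , y , x∈ , y∈ , y∉ , e) = third (noSplit-grows {pair b y} {B} (b , ∈∪ˡ (x∈⁅x⁆ b)) ns (pair b y) ⊆-refl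
            (∪-lub {p = ⁅ b ⁆} (λ q → subst (_∈ B) (sym (sing≡ q)) b∈) (λ q → subst (_∈ B) (sym (sing≡ q)) y∈)) more)
          where
          b≢y : b ≢ y
          b≢y refl = y∉ (x∈⁅x⁆ b)
          by : Adj b y
          by = subst (λ t → Adj t y) (sing≡ x∈) e
          more : ∃[ z ] (z ∈ B × z ∉ pair b y)
          more = let (z , z∈ , z≢y) = card-second {X = B - b} y (≤-pred (≤-trans three (≤-reflexive (card-remove b∈)))) in
            z , -ˡ {p = B} z∈ , λ q → [ (λ r → -≢ {p = B} z∈ (sing≡ r)) , z≢y ∘ sing≡ ]′ (∪-case {p = ⁅ b ⁆} q)
          third : ∃[ t ] ∃[ z ] (t ∈ pair b y × z ∈ B × z ∉ pair b y × Adj t z) → Goal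
          third (t , z , t∈ , z∈ , z∉ , f) = [ (λ q → b , y , z , b∈ , y∈ , z∈ , b≢y , b≢z , y≢z , by , subst (λ s → Adj s z) (sing≡ q) f)
                                             , (λ q → y , b , z , y∈ , b∈ , z∈ , b≢y ∘ sym , y≢z , b≢z , adj-sym by , subst (λ s → Adj s z) (sing≡ q) f) ]′ (∪-case {p = ⁅ b ⁆} t∈)
            where
            b≢z : b ≢ z
            b≢z refl = z∉ (∈∪ˡ (x∈⁅x⁆ b))
            y≢z : y ≢ z
            y≢z refl = z∉ (∈∪ʳ {p = ⁅ b ⁆} (x∈⁅x⁆ y))

    -- A short free cycle on p, q and a short unbalanced cycle far from it, necessarily free, together span
    -- everything but the outer neighbours of p and q.
    no-short-free : ∀ {C p q} → Cycle C → lab C ≡ fre → p ≢ q → Adj p q → (∀ {x} → V C x → x ≡ p ⊎ x ≡ q) → ⊥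
    no-short-free {C} {p} {q} c lf p≢q pq VC = outer (second-neighbour p≢q pq) (second-neighbour (p≢q ∘ sym) (adj-sym pq))
      where
      ≢bal : lab C ≢ bal
      ≢bal l with trans (sym lf) l
      ... | ()
      card-pair : ∀ {a b} → a ≢ b → ∣ pair a b ∣ ≡ 2
      card-pair {a} {b} a≢b = trans (card-insert {X = ⁅ a ⁆} {b} (λ r → a≢b (sym (sing≡ r)))) (cong suc (∣⁅x⁆∣≡1 a))
      pair-case : ∀ {a b x} → x ∈ pair a b → x ≡ a ⊎ x ≡ b
      pair-case {a} r = [ inj₁ ∘ sing≡ , inj₂ ∘ sing≡ ]′ (∪-case {p = ⁅ a ⁆} r)
      C⊆pair : ∀ {x} → V C x → x ∈ pair p q
      C⊆pair r = [ (λ { refl → ∈∪ˡ (x∈⁅x⁆ _) }) , (λ { refl → ∈∪ʳ {p = ⁅ p ⁆} (x∈⁅x⁆ _) }) ]′ (VC r)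
      outer : Second p q → Second q p → ⊥
      outer (p′ , p≢p′ , q≢p′ , pp′ , nbrP) (q′ , q≢q′ , p≢q′ , qq′ , nbrQ) = distinct (p′ ≟ q′)
        where
        leave : ∀ {x y} → x ∈ pair p q → y ∉ pair p q → Adj x y → y ≡ p′ ⊎ y ≡ q′
        leave {x} {y} x∈ y∉ e = [ (λ { refl → [ (λ y≡q → ⊥-elim (y∉ (∈∪ʳ {p = ⁅ p ⁆} (∈sing y≡q)))) , inj₁ ]′ (nbrP e (λ { refl → y∉ x∈ })) })
                                , (λ { refl → [ (λ y≡p → ⊥-elim (y∉ (∈∪ˡ (∈sing y≡p)))) , inj₂ ]′ (nbrQ e (λ { refl → y∉ x∈ })) }) ]′ (pair-case x∈)
        p′∉ : p′ ∉ pair p q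
        p′∉ r = [ p≢p′ ∘ sym , q≢p′ ∘ sym ]′ (pair-case r)
        q′∉ : q′ ∉ pair p q
        q′∉ r = [ p≢q′ ∘ sym , q≢q′ ∘ sym ]′ (pair-case r)
        distinct : Dec (p′ ≡ q′) → ⊥
        -- A common outer neighbour would separate `p` and `q` from a vertex outside these three.
        distinct (yes p′≡q′) = use (outside {pair p q ∪ ⁅ p′ ⁆} (≤-trans (≤-reflexive (trans (card-insert p′∉) (cong suc (card-pair p≢q)))) (s≤s (s≤s (s≤s z≤n)))))
          where
          use : ∃[ t ] (t ∉ pair p q ∪ ⁅ p′ ⁆) → ⊥
          use (t , t∉) = isolated {pair p q} {p′} {t} (p , ∈∪ˡ (x∈⁅x⁆ p)) p′∉ (t∉ ∘ ∈∪ˡ) (λ t≡ → t∉ (∈∪ʳ {p = pair p q} (∈sing t≡)))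
            (λ x∈ y∉ y≢p′ e → [ y≢p′ , (λ y≡q′ → y≢p′ (trans y≡q′ (sym p′≡q′))) ]′ (leave x∈ y∉ e))
        distinct (no p′≢q′) = far
          where
          W : Subset n
          W = pair p q +⟨ p′ , q′ ⟩
          B : Subset n
          B = ∁ W
          sizeW : ∣ W ∣ ≡ 4
          sizeW = trans (card+ p′∉ q′∉ p′≢q′) (cong (_+ 2) (card-pair p≢q))
          B∌ : ∀ {x} → x ∈ B → x ∉ W
          B∌ = x∈∁p⇒x∉p
          cut : Cut (pair p q) B p′ q′
          cut = record
            { neˡ = p , ∈∪ˡ (x∈⁅x⁆ p)
            ; neʳ = let (t , t∉) = outside {W} (≤-trans (≤-reflexive sizeW) (s≤s (s≤s (s≤s (s≤s z≤n))))) in t , x∉p⇒x∈∁p t∉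
            ; u≢v = p′≢q′ ; u∉A = p′∉ ; v∉A = q′∉
            ; u∉B = λ r → B∌ r (∈u {pair p q}) ; v∉B = λ r → B∌ r (∈v {pair p q})
            ; A∩B = λ a b → B∌ b (∈A a)
            ; cover = λ x → place x (x ∈? W)
            ; sep = λ {x} {y} a b e → B∌ b ([ (λ { refl → ∈u {pair p q} }) , (λ { refl → ∈v {pair p q} }) ]′ (leave a (λ r → B∌ b (∈A r)) e)) }
            where
            place : ∀ x → Dec (x ∈ W) → x ∈ pair p q ⊎ x ∈ B ⊎ x ≡ p′ ⊎ x ≡ q′
            place x (yes r) = [ inj₁ , inj₂ ∘ inj₂ ]′ (case+ {pair p q} r)
            place x (no r) = inj₂ (inj₁ (x∉p⇒x∈∁p r))
          nsB : NoSplit B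
          nsB = unb-noSplit {C} {W} (c , ≢bal) (λ r → ∈A (C⊆pair r)) (side-noSplit (cut-flip cut))
          three : 3 ≤ ∣ B ∣
          three = +-cancelˡ-≤ 2 3 (∣ B ∣) (≤-trans (cut-five n≥7 cut) (≤-reflexive (cong (_+ ∣ B ∣) (card-pair p≢q))))
          Far : Set
          Far = ∃[ K ] (Unb K × (∀ {x} → V K x → x ∈ B))
          -- The middle vertex of three in `B` has both its neighbours in `B`. They form a cut, and
          -- the unbalanced cycle at its one-vertex side stays within `B`.
          farCycle : Far
          farCycle = build (middle nsB three)
            where
            build : ∃[ b ] ∃[ y ] ∃[ z ] (b ∈ B × y ∈ B × z ∈ B × b ≢ y × b ≢ z × y ≢ z × Adj b y × Adj b z) → Far
            build (b , y , z , b∈ , y∈ , z∈ , b≢y , b≢z , y≢z , by , bz) = let (K , x , K⊆) = sideCycle D.cut in K , x , λ r → inB (touching-V {J = K} D.cut K⊆ r)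
              where
              module T = TwoNeighbours (two-neighbours b)
              two : ∀ {x} → Adj b x → b ≢ x → x ≡ y ⊎ x ≡ z
              two {x} e b≢x with T.nbr by b≢y | T.nbr bz b≢z | T.nbr e b≢x
              ... | inj₁ refl | inj₁ refl | _ = ⊥-elim (y≢z refl)
              ... | inj₂ refl | inj₂ refl | _ = ⊥-elim (y≢z refl)
              ... | inj₁ refl | inj₂ refl | r = r
              ... | inj₂ refl | inj₁ refl | r = swap r
              nbrs : ∀ {x} → Adj b x → x ≡ b ⊎ x ≡ y ⊎ x ≡ z
              nbrs {x} e = at (x ≟ b)
                where
                at : Dec (x ≡ b) → x ≡ b ⊎ x ≡ y ⊎ x ≡ z
                at (yes r) = inj₁ r
                at (no r) = inj₂ (two e (r ∘ sym))
              p≢ : ∀ {x} → x ∈ B → p ≢ x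
              p≢ x∈ refl = B∌ x∈ (∈A (∈∪ˡ (x∈⁅x⁆ p)))
              module D = DegreeTwo b≢y b≢z y≢z nbrs {p} (p≢ b∈) (p≢ y∈) (p≢ z∈)
              inB : ∀ {x} → x ∈ ⁅ b ⁆ +⟨ y , z ⟩ → x ∈ B
              inB r = [ (λ s → subst (_∈ B) (sym (sing≡ s)) b∈) , [ (λ { refl → y∈ }) , (λ { refl → z∈ }) ]′ ]′ (case+ {⁅ b ⁆} r)
          far : ⊥
          far = use farCycle
            where
            use : Far → ⊥
            use (K , (k , k≢bal) , VK) = complement-noSplit {C ∪ K} {VS C ∪ VS K} {∁ (pair p′ q′)}
                (fre-free c k vd lf kf) (λ r → [ ∈∪ˡ ∘ inVS {C} , ∈∪ʳ ∘ inVS {K} ]′ (V-∪ {C} r)) sizes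
                (let (e , e∈) = proj₁ c in src G e , ∈∪ˡ (inVS {C} (e , e∈ , inj₁ refl)))
                (∪-lub {p = VS C} (λ r → pair⊆ (C⊆pair (outVS {C} r))) (λ r → B⊆ (VK (outVS {K} r))))
                (grows-∪ {U₁ = pair p q} {U₂ = B} cv pair⊆ B⊆ (noSplit-insert (noSplit-sing p) (x∈⁅x⁆ p) pq) nsB
                  (let (e , e∈) = proj₁ c in src G e , ∈∪ˡ (inVS {C} (e , e∈ , inj₁ refl)) , C⊆pair (e , e∈ , inj₁ refl))
                  (let (e , e∈) = proj₁ k in src G e , ∈∪ʳ (inVS {K} (e , e∈ , inj₁ refl)) , VK (e , e∈ , inj₁ refl)))
                ⁅ p′ ⁆ ⁅ q′ ⁆ (pair-split p′≢q′ (cut-nonadjacent cut))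
              where
              vd : VertexDisjoint G C K
              vd x (r , s) = B∌ (VK s) (∈A (C⊆pair r))
              kf : lab K ≡ fre
              kf = at (lab K) refl
                where
                at : ∀ l → lab K ≡ l → lab K ≡ fre
                at bal eq = ⊥-elim (k≢bal eq)
                at fre eq = eq
                -- A linear `K` would have to meet the free cycle `C`.
                at lin eq = let (x , r , s) = proj₂ qb K C k c eq lf in ⊥-elim (vd x (s , r))
              sizes : ∣ C ∪ K ∣ ≡ ∣ VS C ∪ VS K ∣
              sizes = trans (card-split (part-∪ {X = C} {K} (λ {e} r s → vd (src G e) ((e , r , inj₁ refl) , (e , s , inj₁ refl)))))
                (trans (cong₂ _+_ (cycle-card c) (cycle-card k))
                  (sym (card-split (part-∪ {X = VS C} {VS K} (λ {x} r s → vd x (outVS {C} r , outVS {K} s))))))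
              pair⊆ : pair p q ⊆ ∁ (pair p′ q′)
              pair⊆ r = ∉pair (λ { refl → p′∉ r }) (λ { refl → q′∉ r })
              B⊆ : B ⊆ ∁ (pair p′ q′)
              B⊆ r = ∉pair (λ { refl → B∌ r (∈u {pair p q}) }) (λ { refl → B∌ r (∈v {pair p q}) })
              cv : ∀ {x} → x ∈ ∁ (pair p′ q′) → x ∈ pair p q ⊎ x ∈ B
              cv {x} r = [ inj₁ , [ inj₂ , [ (λ s → ⊥-elim (∈∁pairˡ r s)) , (λ s → ⊥-elim (∈∁pairʳ {p′} r s)) ]′ ]′ ]′ (cover cut x)

    degenerate : Degenerate G lab
    degenerate C₁ C₂ c₁ c₂ l₁ l₂ vd = let
        (e , e∈) = proj₁ c₂
        (p , q , p≢q , pq , VC) = short {C₁} {src G e} c₁ (λ r → vd (src G e) (r , (e , e∈ , inj₁ refl)))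
      in no-short-free c₁ l₁ p≢q pq VC

-- From the failure of 3-connectedness to a cut of two vertices.

theorem4p6 : ∀ {n m : ℕ} (G : Graph n m) (lab : Subset m → Label)
    → QuasiBiased G lab
    → (∀ (v : Fin n) → ∃[ w ] (w ≢ v × SameComponent G v w))
    → ThreeConnected ⊤ (MCircuit G lab)
    → Unbreakable ⊤ (MCircuit G lab)
    → ¬ Graphic (MCircuit G lab)
    → KConnected G 2
    → ¬ KConnected G 3
    → n ≤ 6 ⊎ (SiIsCycle G × Degenerate G lab)
theorem4p6 {n} {m} G lab qb _ threeConnected unbreakable notGraphic (_ , conn) ¬conn₃ = size (n ≤? 6)
  where
  open Vertices G lab

  whole : ∀ A B → ¬ Split ⊤ A B
  whole A B s = connected-noSplit (conn ∅ (≤-trans (≤-reflexive (cong suc (∣⊥∣≡0 n))) (s≤s z≤n))) A B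
    (subst (λ Z → Split Z A B) (sym (p─⊥≡p ⊤)) s)

  minusOne : ∀ x A B → ¬ Split (⊤ - x) A B
  minusOne x = connected-noSplit (conn ⁅ x ⁆ (s≤s (≤-reflexive (∣⁅x⁆∣≡1 x))))

  separator : 7 ≤ n → ∃[ X ] (∣ X ∣ < 3 × ¬ NoSplit (⊤ ─ X))
  separator n≥7 = decidable-stable (anySubset? (λ X → (suc ∣ X ∣ ≤? 3) ×-dec ¬? (NoSplit? (⊤ ─ X)))) λ none →
    ¬conn₃ (≤-trans (s≤s (s≤s (s≤s (s≤s z≤n)))) n≥7 , λ X lt → noSplit-connected (left X lt)
      (decidable-stable (NoSplit? (⊤ ─ X)) (λ ¬ns → none (X , lt , ¬ns))))
    where
    left : ∀ X → ∣ X ∣ < 3 → Nonempty (⊤ ─ X)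
    left X lt = use (⊆-or-witness ⊤ X)
      where
      use : ⊤ ⊆ X ⊎ ∃[ x ] (x ∈ ⊤ × x ∉ X) → Nonempty (⊤ ─ X)
      use (inj₁ s) = ⊥-elim (<⇒≱ (≤-trans lt (≤-trans (s≤s (s≤s (s≤s z≤n))) n≥7)) (≤-trans (≤-reflexive (sym (∣⊤∣≡n n))) (p⊆q⇒∣p∣≤∣q∣ s)))
      use (inj₂ (x , x∈ , x∉)) = x , ∈─ x∈ x∉

  size : Dec (n ≤ 6) → n ≤ 6 ⊎ (SiIsCycle G × Degenerate G lab)
  size (yes le) = inj₁ le
  size (no ¬le) = inj₂ (found (separator (≰⇒> ¬le)))
    where
    open FatCycle G lab qb threeConnected unbreakable notGraphic whole minusOne (≰⇒> ¬le)
    open Cuts G lab qb threeConnected unbreakable notGraphic whole minusOne using (Cut)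
    Goal : Set
    Goal = SiIsCycle G × Degenerate G lab
    found : ∃[ X ] (∣ X ∣ < 3 × ¬ NoSplit (⊤ ─ X)) → Goal
    found (X , lt , ¬ns) = [ (λ ns → ⊥-elim (¬ns ns)) , (λ (A , B , s) → first A B s (nonempty? X)) ]′ (NoSplit-dec (⊤ ─ X))
      where
      first : ∀ A B → Split (⊤ ─ X) A B → Dec (Nonempty X) → Goal
      -- A separator with fewer than two vertices contradicts 2-connectedness; with at most two in
      -- all, it is exactly a pair.
      first A B s (no ¬ne) = ⊥-elim (whole A B (subst (λ Z → Split Z A B) (trans (cong (⊤ ─_) (Empty-unique ¬ne)) (p─⊥≡p ⊤)) s))
      first A B s (yes (u , u∈)) = second (nonempty? (X - u))
        where
        second : Dec (Nonempty (X - u)) → Goal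
        second (no ¬ne) = ⊥-elim (minusOne u A B (subst (λ Z → Split (⊤ ─ Z) A B)
          (⊆-antisym (λ {x} x∈ → ∈sing (decidable-stable (x ≟ u) (λ x≢u → ¬ne (x , ∈- x∈ x≢u)))) (λ r → subst (_∈ X) (sym (sing≡ r)) u∈)) s))
        second (yes (v , v∈)) = si-cycle cut , degenerate cut
          where
          one : ∀ {x} → x ∈ X → x ≡ u ⊎ x ≡ v
          one {x} x∈ = at (x ≟ u) (x ≟ v)
            where
            at : Dec (x ≡ u) → Dec (x ≡ v) → x ≡ u ⊎ x ≡ v
            at (yes r) _ = inj₁ r
            at (no _) (yes r) = inj₂ r
            at (no r) (no t) = ⊥-elim (<⇒≱ lt (card-three x∈ u∈ (-ˡ {p = X} v∈) r t (λ eq → -≢ {p = X} v∈ (sym eq))))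
          X∌ : ∀ {x} → x ∈ ⊤ ─ X → x ∉ X
          X∌ = ─ʳ {p = ⊤}
          cut : Cut A B u v
          cut = record
            { neˡ = neA s ; neʳ = neB s ; u≢v = λ eq → -≢ {p = X} v∈ (sym eq)
            ; u∉A = λ r → X∌ (inˡ (parts s) r) u∈ ; v∉A = λ r → X∌ (inˡ (parts s) r) (-ˡ {p = X} v∈)
            ; u∉B = λ r → X∌ (inʳ (parts s) r) u∈ ; v∉B = λ r → X∌ (inʳ (parts s) r) (-ˡ {p = X} v∈)
            ; A∩B = dis (parts s)
            ; cover = λ x → place x (x ∈? X)
            ; sep = apart s }
            where
            place : ∀ x → Dec (x ∈ X) → x ∈ A ⊎ x ∈ B ⊎ x ≡ u ⊎ x ≡ v
            place x (yes r) = inj₂ (inj₂ (one r))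
            place x (no r) = [ inj₁ , inj₂ ∘ inj₁ ]′ (cov (parts s) (∈─ ∈⊤ r))
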